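{- Let $R(q)=\dfrac{(q;q^5)_\infty(q^4;q^5)_\infty}{(q^2;q^5)_\infty(q^3;q^5)_\infty}$ and define integers $D(n)$ by $\dfrac{R(q^5)}{R^5(q)}=\sum_{n=0}^{\infty}D(n)q^{n}$. Then for all nonnegative integers $n$, $$D(5n)<0,\quad D(5n+2)>0,\quad D(5n+3)>0,\quad D(5n+4)<0,$$ with the sole exception $D(0)=1$.
   Context: For complex $a,q$ with $|q|<1$, $(a;q)_\infty:=\prod_{k=0}^{\infty}(1-aq^k)$. All series are power series in $q$. -}

module Defs where

open import Data.Nat as ℕ using (ℕ; zero; suc; _∸_)
open import Data.Nat.Divisibility using (_∣?_)
open import Data.Integer using (ℤ; 0ℤ; 1ℤ; _+_; _*_; -_)
open import Data.List using (List; foldr; map; upTo)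
open import Relation.Nullary using (yes; no)

-- Formal power series in q with integer coefficients: n ↦ coefficient of q^n.
PS : Set
PS = ℕ → ℤ

one : PS
one zero    = 1ℤ
one (suc _) = 0ℤ

_·_ : PS → PS → PS
(f · g) n = foldr _+_ 0ℤ (map (λ i → f i * g (n ∸ i)) (upTo (suc n)))

infixl 7 _·_

_^ᵖ_ : PS → ℕ → PS
f ^ᵖ zero  = one
f ^ᵖ suc k = f · (f ^ᵖ k)

-- the polynomial 1 - q^m  (for m ≥ 1)
oneMinus : ℕ → PS
oneMinus m n with n ℕ.≟ 0 | n ℕ.≟ m
... | yes _ | _     = 1ℤ
... | no _  | yes _ = - 1ℤ
... | no _  | no _  = 0ℤ

-- the power series 1/(1 - q^m) = Σ_j q^{mj}  (for m ≥ 1)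
geom : ℕ → PS
geom m n with m ∣? n
... | yes _ = 1ℤ
... | no _  = 0ℤ

prodUpTo : (ℕ → PS) → ℕ → PS
prodUpTo F zero    = one
prodUpTo F (suc N) = prodUpTo F N · F N

-- (q^a ; q^d)_∞ = Π_{k≥0} (1 - q^{a+dk}) as a formal power series (a, d ≥ 1).
-- Factors with k ≥ n+1 have a+dk > n and do not affect the coefficient of q^n,
-- so that coefficient equals the one of the finite product over k ≤ n.
poch : ℕ → ℕ → PS
poch a d n = prodUpTo (λ k → oneMinus (a ℕ.+ d ℕ.* k)) (suc n) n

-- 1/(q^a ; q^d)_∞ = Π_{k≥0} 1/(1 - q^{a+dk}), same truncation principle.
pochInv : ℕ → ℕ → PS
pochInv a d n = prodUpTo (λ k → geom (a ℕ.+ d ℕ.* k)) (suc n) n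

R : PS
R = poch 1 5 · poch 4 5 · pochInv 2 5 · pochInv 3 5

Rinv : PS
Rinv = poch 2 5 · poch 3 5 · pochInv 1 5 · pochInv 4 5

dilate5 : PS → PS
dilate5 f n with 5 ∣? n
... | yes _ = f (n ℕ./ 5)
... | no _  = 0ℤ

D : PS
D = dilate5 R · (Rinv ^ᵖ 5)

{-# OPTIONS --safe #-}
module Submission where

open import Defs
import Data.Nat
open import Data.Nat as ℕ using (ℕ; zero; suc; _∸_; s≤s; z≤n)
import Data.Nat.Properties as ℕ
open import Data.Nat.Coprimality using (Coprime; coprime-+; coprime-divisor; coprime?)
open import Data.Nat.Divisibility using (_∣_; _∣?_; divides; ∣m+n∣m⇒∣n; ∣m∣n⇒∣m+n; ∣-refl; ∣⇒≤; _∣0; n∣m*n; ∣m⇒∣m*n)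
open import Data.Nat.DivMod using (m*n/n≡m)
open import Data.Nat.Tactic.RingSolver using () renaming (solve-∀ to solveℕ-∀)
open import Data.Integer as ℤ using (ℤ; 0ℤ; 1ℤ; -1ℤ; +_; -[1+_]; ∣_∣; _+_; _*_; _-_; -_; _≤_; _<_; _>_; +≤+; +<+)
import Data.Integer.Properties as ℤ
open import Data.Integer.Tactic.RingSolver using (solve-∀)
open import Data.Empty using (⊥-elim)
open import Data.List using (foldr)
open import Data.List.Properties using (map-applyUpTo)
open import Data.Maybe using (Maybe; just; nothing)
open import Data.Product using (_×_; _,_)
open import Data.Sum using (_⊎_; inj₁; inj₂)
open import Relation.Nullary using (¬_; yes; no)
open import Relation.Nullary.Decidable using (True; toWitness)
open import Relation.Binary using (Setoid)
open import Relation.Binary.PropositionalEquality as ≡ using (_≡_; _≢_; refl; sym; trans; cong; cong₂; subst)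
open import Algebra using (CommutativeRing; IsCommutativeRing)
open import Algebra.Solver.Ring.AlmostCommutativeRing using (fromCommutativeRing; _-Raw-AlmostCommutative⟶_)
import Algebra.Properties.AbelianGroup ℤ.+-0-abelianGroup as ℤ+
open import Level using (0ℓ)

-- With G = 1/(q,q⁴;q⁵)_∞ and H = 1/(q²,q³;q⁵)_∞ we have R = H/G.  Put v = q R(q⁵), f_m = (q^m;q^m)_∞,
-- X = f₅/H, Y = f₅/G, θ = q d/dq.  By the triple product X and Y are theta series, X Y = f₁ f₅, and X Y is a
-- sum over Gaussian integers.  Decomposing ℤ[i] along multiplication by 2 + i gives
--   X Y = X(q⁵)² − q X(q⁵) Y(q⁵) − q² Y(q⁵)²,   that is   f₁ = f₂₅ (1/R(q⁵) − q − q² R(q⁵)),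
-- and, with Jacobi's series for f₁³,
--   X Y + 5 (X θY − Y θX) = f₁⁶,   that is   θ log (q R⁵) = f₁⁵/f₅.
-- As the left side of the last equation is fixed by Σ aₙ qⁿ ↦ Σ a₅ₙ qⁿ, so is the right side; inserting the
-- dissection of f₁ yields 1/R⁵ − 11 q − q² R⁵ = f₁⁶/f₅⁶.  These facts show that both sides of
--   R⁵ (1 + 3v + 4v² + 2v³ + v⁴) = R(q⁵) (1 − 2v + 4v² − 3v³ + v⁴)
-- have the same logarithmic derivative, so they agree, and hence
--   Σ D(n) qⁿ = (1/R⁵ G⁶ H⁶)(q⁵) · (1 + 5v + 10v² + 5v³ − 15v⁴ − 36v⁵ − 40v⁶ − 30v⁷ − 15v⁸ − 5v⁹ − v¹⁰).
-- The components modulo 5 are 1 − 25 q G⁶H⁶, 10 G⁴H³ E, 5 G³H⁴ E and −5 (3 G⁷H⁵ + q G²H¹⁰) in the classes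
-- 0, 2, 3, 4, where E = G⁵ − 3 q H⁵; and G² E has nonnegative coefficients.

-- By the modular equation the generating series of D is a quotient B/A of quartics in v, and a
-- quotient cannot be sorted by exponents modulo 5. What saves the sorting is the factorization 1 -
-- 11v⁵ - v¹⁰ = (1 - v - v²) A B. Its left side is a series in q⁵, inverted by Ramanujan's identity
-- with q⁵ in place of q, so B/A is a series in q⁵ times B² (1 - v - v²), the polynomial of degree
-- 10 above; vᵏ then lands in the class of k. Both identities drawn from ℤ[i] rest on one mechanism:
-- a coset of the ideal (2 + i) either cancels against itself under a symmetry, or is moved by
-- reflections and translations onto a standard double sum. In classes 2 and 3 positivity must
-- survive the difference G⁵ - 3qH⁵. Corresponding factors of G and H differ by a multiple of (1 -
-- q)², so two factors 1/(1 - q) are needed to compare them; they come from G². A third one, from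
-- one more factor G, replaces coefficients by partial sums and makes them strictly positive.
-- Coefficients stay in ℤ: identities between quotients are multiplied out, and factors with
-- constant term 1 are cancelled.

infix 4 _≈_
infixl 6 _⊕_
infixl 7 _⊗_
infix 8 ⊝_

-- A record rather than a bare function type, so that `f` and `g` can be recovered from the type by
-- unification.
record _≈_ (f g : PS) : Set where
  constructor ⟪_⟫
  field at : ∀ n → f n ≡ g n
open _≈_

-- The commutative ring of formal power series

tail : PS → PS
tail f n = f (suc n)

opaque
  -- The operations are opaque so that convolution sums do not unfold during type checking. Outside
  -- the blocks that unfold them, only coefficient equations such as `⊕-at`, `⊗-zero` and `⊗-suc`
  -- are available.
  _⊕_ : PS → PS → PS
  (f ⊕ g) n = f n + g n

  ⊝_ : PS → PS
  (⊝ f) n = - f n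

  _⊗_ : PS → PS → PS
  _⊗_ = _·_

  const : ℤ → PS
  const c zero = c
  const c (suc _) = 0ℤ

  q : PS
  q 1 = 1ℤ
  q _ = 0ℤ

opaque
  unfolding _⊕_

  ⊕-at : ∀ f g n → (f ⊕ g) n ≡ f n + g n
  ⊕-at f g n = refl

  ⊝-at : ∀ f n → (⊝ f) n ≡ - f n
  ⊝-at f n = refl

  ·≈⊗ : ∀ f g → f · g ≈ f ⊗ g
  ·≈⊗ f g = ⟪ (λ n → refl) ⟫

  const-zero : ∀ c → const c zero ≡ c
  const-zero c = refl

  const-suc : ∀ c n → const c (suc n) ≡ 0ℤ
  const-suc c n = refl

  one≈const : one ≈ const 1ℤ
  one≈const = ⟪ (λ { zero → refl ; (suc n) → refl }) ⟫

  q-zero : q 0 ≡ 0ℤ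
  q-zero = refl

  tail-q : tail q ≈ const 1ℤ
  tail-q = ⟪ (λ { zero → refl ; (suc n) → refl }) ⟫

  tail-const : ∀ c → tail (const c) ≈ const 0ℤ
  tail-const c = ⟪ (λ { zero → refl ; (suc n) → refl }) ⟫

  tail-⊕ : ∀ f g → tail (f ⊕ g) ≈ tail f ⊕ tail g
  tail-⊕ f g = ⟪ (λ n → refl) ⟫

  ⊗-zero : ∀ f g → (f ⊗ g) zero ≡ f 0 * g 0
  ⊗-zero f g = ℤ.+-identityʳ _

  -- Splitting off the first term of the convolution gives a recursion on `tail f`; the ring laws
  -- for `⊗` are inductions along it.
  ⊗-suc : ∀ f g n → (f ⊗ g) (suc n) ≡ f 0 * g (suc n) + (tail f ⊗ g) n
  ⊗-suc f g n = cong (λ l → f 0 * g (suc n) + foldr _+_ 0ℤ l)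
    (trans (map-applyUpTo suc (λ i → f i * g (suc n ∸ i)) (suc n))
      (sym (map-applyUpTo (λ i → i) (λ i → f (suc i) * g (n ∸ i)) (suc n))))

≈-refl : ∀ {f} → f ≈ f
≈-refl = ⟪ (λ n → refl) ⟫

≈-sym : ∀ {f g} → f ≈ g → g ≈ f
≈-sym e = ⟪ (λ n → sym (at e n)) ⟫

≡⇒≈ : ∀ {f g} → f ≡ g → f ≈ g
≡⇒≈ refl = ≈-refl

≈-trans : ∀ {f g h} → f ≈ g → g ≈ h → f ≈ h
≈-trans d e = ⟪ (λ n → trans (at d n) (at e n)) ⟫

⊕-cong : ∀ {f f′ g g′} → f ≈ f′ → g ≈ g′ → f ⊕ g ≈ f′ ⊕ g′
⊕-cong {f} {f′} {g} {g′} d e = ⟪ (λ n → trans (⊕-at f g n) (trans (cong₂ _+_ (at d n) (at e n)) (sym (⊕-at f′ g′ n)))) ⟫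

⊝-cong : ∀ {f g} → f ≈ g → ⊝ f ≈ ⊝ g
⊝-cong {f} {g} d = ⟪ (λ n → trans (⊝-at f n) (trans (cong -_ (at d n)) (sym (⊝-at g n)))) ⟫

-- A coefficient of a product involves only coefficients of the same or lower order. This bounded
-- form is what makes congruence modulo a power of q compatible with multiplication.
⊗-cong-≤ : ∀ n {f f′ g g′} → (∀ m → m ℕ.≤ n → f m ≡ f′ m) → (∀ m → m ℕ.≤ n → g m ≡ g′ m) →
           (f ⊗ g) n ≡ (f′ ⊗ g′) n
⊗-cong-≤ zero {f} {f′} {g} {g′} d e =
  trans (⊗-zero f g) (trans (cong₂ _*_ (d 0 ℕ.z≤n) (e 0 ℕ.z≤n)) (sym (⊗-zero f′ g′)))
⊗-cong-≤ (suc n) {f} {f′} {g} {g′} d e =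
  trans (⊗-suc f g n) (trans (cong₂ _+_ (cong₂ _*_ (d 0 ℕ.z≤n) (e (suc n) ℕ.≤-refl))
      (⊗-cong-≤ n {tail f} {tail f′} {g} {g′} (λ m m≤n → d (suc m) (ℕ.s≤s m≤n)) (λ m m≤n → e m (ℕ.m≤n⇒m≤1+n m≤n))))
    (sym (⊗-suc f′ g′ n)))

⊗-cong : ∀ {f f′ g g′} → f ≈ f′ → g ≈ g′ → f ⊗ g ≈ f′ ⊗ g′
⊗-cong d e = ⟪ (λ n → ⊗-cong-≤ n (λ m _ → at d m) (λ m _ → at e m)) ⟫

module ⊗-laws where

  distribʳ-at : ∀ n h f g → ((f ⊕ g) ⊗ h) n ≡ (f ⊗ h) n + (g ⊗ h) n
  distribʳ-at zero h f g = begin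
      ((f ⊕ g) ⊗ h) 0 ≡⟨ ⊗-zero (f ⊕ g) h ⟩
      (f ⊕ g) 0 * h 0 ≡⟨ cong (_* h 0) (⊕-at f g 0) ⟩
      (f 0 + g 0) * h 0 ≡⟨ ℤ.*-distribʳ-+ (h 0) (f 0) (g 0) ⟩
      f 0 * h 0 + g 0 * h 0 ≡⟨ cong₂ _+_ (sym (⊗-zero f h)) (sym (⊗-zero g h)) ⟩
      (f ⊗ h) 0 + (g ⊗ h) 0 ∎
    where
    open ≡.≡-Reasoning
  distribʳ-at (suc n) h f g = begin
      ((f ⊕ g) ⊗ h) (suc n) ≡⟨ ⊗-suc (f ⊕ g) h n ⟩
      (f ⊕ g) 0 * h (suc n) + (tail (f ⊕ g) ⊗ h) n
        ≡⟨ cong₂ (λ x y → x * h (suc n) + y) (⊕-at f g 0)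
             (trans (at (⊗-cong (tail-⊕ f g) ≈-refl) n) (distribʳ-at n h (tail f) (tail g))) ⟩
      (f 0 + g 0) * h (suc n) + ((tail f ⊗ h) n + (tail g ⊗ h) n)
        ≡⟨ rearrange (f 0) (g 0) (h (suc n)) ((tail f ⊗ h) n) ((tail g ⊗ h) n) ⟩
      (f 0 * h (suc n) + (tail f ⊗ h) n) + (g 0 * h (suc n) + (tail g ⊗ h) n)
        ≡⟨ cong₂ _+_ (sym (⊗-suc f h n)) (sym (⊗-suc g h n)) ⟩
      (f ⊗ h) (suc n) + (g ⊗ h) (suc n) ∎
    where
    open ≡.≡-Reasoning
    rearrange : ∀ a b c d e → (a + b) * c + (d + e) ≡ (a * c + d) + (b * c + e)
    rearrange = solve-∀

  const0-at : ∀ n g → (const 0ℤ ⊗ g) n ≡ 0ℤ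
  const0-at zero g = trans (⊗-zero (const 0ℤ) g) (cong (_* g 0) (const-zero 0ℤ))
  const0-at (suc n) g = trans (⊗-suc (const 0ℤ) g n)
    (cong₂ (λ x y → x * g (suc n) + y) (const-zero 0ℤ) (trans (at (⊗-cong (tail-const 0ℤ) ≈-refl) n) (const0-at n g)))

  scale-at : ∀ c g n → (const c ⊗ g) n ≡ c * g n
  scale-at c g zero = trans (⊗-zero (const c) g) (cong (_* g 0) (const-zero c))
  scale-at c g (suc n) = trans (⊗-suc (const c) g n)
    (trans (cong₂ (λ x y → x * g (suc n) + y) (const-zero c) (trans (at (⊗-cong (tail-const c) ≈-refl) n) (const0-at n g)))
      (ℤ.+-identityʳ _))

  -- The mirror image of `⊗-suc`, peeling the second factor; the two recursions together give
  -- commutativity.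
  ⊗-suc′ : ∀ f g n → (f ⊗ g) (suc n) ≡ g 0 * f (suc n) + (f ⊗ tail g) n
  ⊗-suc′ f g zero = begin
      (f ⊗ g) 1 ≡⟨ ⊗-suc f g 0 ⟩
      f 0 * g 1 + (tail f ⊗ g) 0 ≡⟨ cong (λ x → f 0 * g 1 + x) (⊗-zero (tail f) g) ⟩
      f 0 * g 1 + f 1 * g 0 ≡⟨ rearrange (f 0) (g 1) (f 1) (g 0) ⟩
      g 0 * f 1 + f 0 * g 1 ≡⟨ cong (λ x → g 0 * f 1 + x) (sym (⊗-zero f (tail g))) ⟩
      g 0 * f 1 + (f ⊗ tail g) 0 ∎
    where
    open ≡.≡-Reasoning
    rearrange : ∀ a b c d → a * b + c * d ≡ d * c + a * b
    rearrange = solve-∀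
  ⊗-suc′ f g (suc n) = begin
      (f ⊗ g) (suc (suc n)) ≡⟨ ⊗-suc f g (suc n) ⟩
      f 0 * g (suc (suc n)) + (tail f ⊗ g) (suc n)
        ≡⟨ cong (λ x → f 0 * g (suc (suc n)) + x) (⊗-suc′ (tail f) g n) ⟩
      f 0 * g (suc (suc n)) + (g 0 * f (suc (suc n)) + (tail f ⊗ tail g) n)
        ≡⟨ rearrange (f 0 * g (suc (suc n))) (g 0 * f (suc (suc n))) _ ⟩
      g 0 * f (suc (suc n)) + (f 0 * g (suc (suc n)) + (tail f ⊗ tail g) n)
        ≡⟨ cong (λ x → g 0 * f (suc (suc n)) + x) (sym (⊗-suc f (tail g) n)) ⟩
      g 0 * f (suc (suc n)) + (f ⊗ tail g) (suc n) ∎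
    where
    open ≡.≡-Reasoning
    rearrange : ∀ a b c → a + (b + c) ≡ b + (a + c)
    rearrange = solve-∀

  comm-at : ∀ n f g → (f ⊗ g) n ≡ (g ⊗ f) n
  comm-at zero f g = trans (⊗-zero f g) (trans (ℤ.*-comm (f 0) (g 0)) (sym (⊗-zero g f)))
  comm-at (suc n) f g = trans (⊗-suc f g n)
    (trans (cong (λ x → f 0 * g (suc n) + x) (comm-at n (tail f) g)) (sym (⊗-suc′ g f n)))

  tail-⊗ : ∀ f g → tail (f ⊗ g) ≈ const (f 0) ⊗ tail g ⊕ tail f ⊗ g
  tail-⊗ f g = ⟪ (λ n → trans (⊗-suc f g n) (trans (cong (_+ (tail f ⊗ g) n) (sym (scale-at (f 0) (tail g) n)))
    (sym (⊕-at (const (f 0) ⊗ tail g) (tail f ⊗ g) n)))) ⟫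

  scale-assoc-at : ∀ c n g h → ((const c ⊗ g) ⊗ h) n ≡ c * (g ⊗ h) n
  scale-assoc-at c zero g h = begin
      ((const c ⊗ g) ⊗ h) 0 ≡⟨ ⊗-zero (const c ⊗ g) h ⟩
      (const c ⊗ g) 0 * h 0 ≡⟨ cong (_* h 0) (scale-at c g 0) ⟩
      c * g 0 * h 0 ≡⟨ ℤ.*-assoc c (g 0) (h 0) ⟩
      c * (g 0 * h 0) ≡⟨ cong (c *_) (sym (⊗-zero g h)) ⟩
      c * (g ⊗ h) 0 ∎
    where
    open ≡.≡-Reasoning
  scale-assoc-at c (suc n) g h = begin
      ((const c ⊗ g) ⊗ h) (suc n) ≡⟨ ⊗-suc (const c ⊗ g) h n ⟩
      (const c ⊗ g) 0 * h (suc n) + (tail (const c ⊗ g) ⊗ h) n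
        ≡⟨ cong₂ (λ x y → x * h (suc n) + y) (scale-at c g 0) (at (⊗-cong tail-scale ≈-refl) n) ⟩
      c * g 0 * h (suc n) + ((const c ⊗ tail g) ⊗ h) n
        ≡⟨ cong (λ x → c * g 0 * h (suc n) + x) (scale-assoc-at c n (tail g) h) ⟩
      c * g 0 * h (suc n) + c * (tail g ⊗ h) n
        ≡⟨ rearrange c (g 0) (h (suc n)) ((tail g ⊗ h) n) ⟩
      c * (g 0 * h (suc n) + (tail g ⊗ h) n) ≡⟨ cong (c *_) (sym (⊗-suc g h n)) ⟩
      c * (g ⊗ h) (suc n) ∎
    where
    open ≡.≡-Reasoning
    tail-scale : tail (const c ⊗ g) ≈ const c ⊗ tail g
    tail-scale = ⟪ (λ m → trans (scale-at c g (suc m)) (sym (scale-at c (tail g) m))) ⟫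
    rearrange : ∀ c a b d → c * a * b + c * d ≡ c * (a * b + d)
    rearrange = solve-∀

  assoc-at : ∀ n f g h → ((f ⊗ g) ⊗ h) n ≡ (f ⊗ (g ⊗ h)) n
  assoc-at zero f g h = begin
      ((f ⊗ g) ⊗ h) 0 ≡⟨ ⊗-zero (f ⊗ g) h ⟩
      (f ⊗ g) 0 * h 0 ≡⟨ cong (_* h 0) (⊗-zero f g) ⟩
      f 0 * g 0 * h 0 ≡⟨ ℤ.*-assoc (f 0) (g 0) (h 0) ⟩
      f 0 * (g 0 * h 0) ≡⟨ cong (f 0 *_) (sym (⊗-zero g h)) ⟩
      f 0 * (g ⊗ h) 0 ≡⟨ sym (⊗-zero f (g ⊗ h)) ⟩
      (f ⊗ (g ⊗ h)) 0 ∎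
    where
    open ≡.≡-Reasoning
  assoc-at (suc n) f g h = begin
      ((f ⊗ g) ⊗ h) (suc n) ≡⟨ ⊗-suc (f ⊗ g) h n ⟩
      (f ⊗ g) 0 * h (suc n) + (tail (f ⊗ g) ⊗ h) n
        ≡⟨ cong₂ (λ x y → x * h (suc n) + y) (⊗-zero f g)
             (trans (at (⊗-cong (tail-⊗ f g) ≈-refl) n)
               (trans (distribʳ-at n h (const (f 0) ⊗ tail g) (tail f ⊗ g))
                 (cong₂ _+_ (scale-assoc-at (f 0) n (tail g) h) (assoc-at n (tail f) g h)))) ⟩
      f 0 * g 0 * h (suc n) + (f 0 * (tail g ⊗ h) n + (tail f ⊗ (g ⊗ h)) n)
        ≡⟨ rearrange (f 0) (g 0) (h (suc n)) _ _ ⟩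
      f 0 * (g 0 * h (suc n) + (tail g ⊗ h) n) + (tail f ⊗ (g ⊗ h)) n
        ≡⟨ cong (λ x → f 0 * x + (tail f ⊗ (g ⊗ h)) n) (sym (⊗-suc g h n)) ⟩
      f 0 * (g ⊗ h) (suc n) + (tail f ⊗ (g ⊗ h)) n ≡⟨ sym (⊗-suc f (g ⊗ h) n) ⟩
      (f ⊗ (g ⊗ h)) (suc n) ∎
    where
    open ≡.≡-Reasoning
    rearrange : ∀ a b c d e → a * b * c + (a * d + e) ≡ a * (b * c + d) + e
    rearrange = solve-∀

open ⊗-laws using (scale-at; tail-⊗)

⊗-comm : ∀ f g → f ⊗ g ≈ g ⊗ f
⊗-comm f g = ⟪ (λ n → ⊗-laws.comm-at n f g) ⟫

opaque
  unfolding _⊕_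

  isCommutativeRing : IsCommutativeRing _≈_ _⊕_ _⊗_ ⊝_ (const 0ℤ) (const 1ℤ)
  isCommutativeRing = record
    { isRing = record
      { +-isAbelianGroup = record
        { isGroup = record
          { isMonoid = record
            { isSemigroup = record
              { isMagma = record
                { isEquivalence = record { refl = ≈-refl ; sym = ≈-sym ; trans = ≈-trans }
                ; ∙-cong = ⊕-cong
                }
              ; assoc = λ f g h → ⟪ (λ n → ℤ.+-assoc (f n) (g n) (h n)) ⟫
              }
            ; identity = idˡ , λ f → ≈-trans (⊕-comm f (const 0ℤ)) (idˡ f)
            }
          ; inverse = invˡ , λ f → ≈-trans (⊕-comm f (⊝ f)) (invˡ f)
          ; ⁻¹-cong = ⊝-cong
          }
        ; comm = ⊕-comm
        }
      ; *-cong = ⊗-cong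
      ; *-assoc = λ f g h → ⟪ (λ n → ⊗-laws.assoc-at n f g h) ⟫
      ; *-identity = 1ˡ , λ f → ≈-trans (⊗-comm f (const 1ℤ)) (1ˡ f)
      ; distrib = (λ h f g → ≈-trans (⊗-comm h (f ⊕ g)) (≈-trans (distʳ h f g) (⊕-cong (⊗-comm f h) (⊗-comm g h)))) , distʳ
      }
    ; *-comm = ⊗-comm
    }
    where
    ⊕-comm : ∀ f g → f ⊕ g ≈ g ⊕ f
    ⊕-comm f g = ⟪ (λ n → ℤ.+-comm (f n) (g n)) ⟫
    idˡ : ∀ f → const 0ℤ ⊕ f ≈ f
    idˡ f = ⟪ (λ { zero → ℤ.+-identityˡ (f 0) ; (suc n) → ℤ.+-identityˡ (f (suc n)) }) ⟫
    invˡ : ∀ f → ⊝ f ⊕ f ≈ const 0ℤ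
    invˡ f = ⟪ (λ { zero → ℤ.+-inverseˡ (f 0) ; (suc n) → ℤ.+-inverseˡ (f (suc n)) }) ⟫
    1ˡ : ∀ f → const 1ℤ ⊗ f ≈ f
    1ˡ f = ⟪ (λ n → trans (⊗-laws.scale-at 1ℤ f n) (ℤ.*-identityˡ (f n))) ⟫
    distʳ : ∀ h f g → (f ⊕ g) ⊗ h ≈ f ⊗ h ⊕ g ⊗ h
    distʳ h f g = ⟪ (λ n → ⊗-laws.distribʳ-at n h f g) ⟫

  const-⊕ : ∀ c d → const (c + d) ≈ const c ⊕ const d
  const-⊕ c d = ⟪ (λ { zero → refl ; (suc n) → refl }) ⟫

  const-⊝ : ∀ c → const (- c) ≈ ⊝ const c
  const-⊝ c = ⟪ (λ { zero → refl ; (suc n) → refl }) ⟫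

  const-⊗ : ∀ c d → const (c * d) ≈ const c ⊗ const d
  const-⊗ c d = ⟪ (λ { zero → sym (⊗-laws.scale-at c (const d) 0) ; (suc n) → sym (trans (⊗-laws.scale-at c (const d) (suc n)) (ℤ.*-zeroʳ c)) }) ⟫

PS-ring : CommutativeRing 0ℓ 0ℓ
PS-ring = record { isCommutativeRing = isCommutativeRing }

open CommutativeRing PS-ring
  using (setoid; semiring)
  renaming ( +-assoc to ⊕-assoc; +-comm to ⊕-comm; +-identityˡ to ⊕-identityˡ; +-identityʳ to ⊕-identityʳ
           ; *-assoc to ⊗-assoc; *-identityˡ to ⊗-identityˡ; *-identityʳ to ⊗-identityʳ
           ; distribˡ to ⊗-distribˡ-⊕; distribʳ to ⊗-distribʳ-⊕; zeroˡ to ⊗-zeroˡ; zeroʳ to ⊗-zeroʳ)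

open import Algebra.Properties.Semiring.Exp semiring using (_^_; ^-homo-*; ^-assocʳ; ^-congˡ)

module Solver where
  -- Integers act as solver coefficients through `const`. Since their equality is decidable,
  -- polynomial identities with numerical coefficients are settled by normalisation.
  coefficients : _-Raw-AlmostCommutative⟶_ (CommutativeRing.rawRing ℤ.+-*-commutativeRing) (fromCommutativeRing PS-ring)
  coefficients = record
    { ⟦_⟧ = const ; +-homo = const-⊕ ; *-homo = const-⊗ ; -‿homo = const-⊝ ; 0-homo = ≈-refl ; 1-homo = ≈-refl }

  const-≟ : ∀ c d → Maybe (const c ≈ const d)
  const-≟ c d with c ℤ.≟ d
  ... | yes refl = just ≈-refl
  ... | no _     = nothing

  open import Algebra.Solver.Ring _ (fromCommutativeRing PS-ring) coefficients const-≟ public using (solve; _:=_; con; _:+_; _:*_; _:^_; :-_)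

module ≈-Reasoning where
  open import Relation.Binary.Reasoning.Setoid setoid public

-- Congruence modulo a power of q

infix 4 _≈[_]_

record _≈[_]_ (f : PS) (N : ℕ) (g : PS) : Set where
  constructor ⟪_⟫ₙ
  field at< : ∀ n → n ℕ.< N → f n ≡ g n
open _≈[_]_

≈⇒≈[] : ∀ {f g} N → f ≈ g → f ≈[ N ] g
≈⇒≈[] N e = ⟪ (λ n _ → at e n) ⟫ₙ

≈[]⇒≈ : ∀ {f g} → (∀ N → f ≈[ N ] g) → f ≈ g
≈[]⇒≈ e = ⟪ (λ n → at< (e (suc n)) n ℕ.≤-refl) ⟫

≈[]-refl : ∀ {N f} → f ≈[ N ] f
≈[]-refl = ⟪ (λ _ _ → refl) ⟫ₙ

≈[]-sym : ∀ {N f g} → f ≈[ N ] g → g ≈[ N ] f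
≈[]-sym e = ⟪ (λ n l → sym (at< e n l)) ⟫ₙ

≈[]-trans : ∀ {N f g h} → f ≈[ N ] g → g ≈[ N ] h → f ≈[ N ] h
≈[]-trans d e = ⟪ (λ n l → trans (at< d n l) (at< e n l)) ⟫ₙ

≈[]-weaken : ∀ {M N f g} → M ℕ.≤ N → f ≈[ N ] g → f ≈[ M ] g
≈[]-weaken le e = ⟪ (λ n l → at< e n (ℕ.<-≤-trans l le)) ⟫ₙ

≈[]-setoid : ℕ → Setoid 0ℓ 0ℓ
≈[]-setoid N = record
  { Carrier = PS ; _≈_ = _≈[ N ]_
  ; isEquivalence = record { refl = ≈[]-refl ; sym = ≈[]-sym ; trans = ≈[]-trans } }

module Mod (N : ℕ) where
  open import Relation.Binary.Reasoning.Setoid (≈[]-setoid N) public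

⊕-cong[] : ∀ {N f f′ g g′} → f ≈[ N ] f′ → g ≈[ N ] g′ → f ⊕ g ≈[ N ] f′ ⊕ g′
⊕-cong[] {N} {f} {f′} {g} {g′} d e = ⟪ (λ n l → trans (⊕-at f g n) (trans (cong₂ _+_ (at< d n l) (at< e n l)) (sym (⊕-at f′ g′ n)))) ⟫ₙ

⊝-cong[] : ∀ {N f g} → f ≈[ N ] g → ⊝ f ≈[ N ] ⊝ g
⊝-cong[] {N} {f} {g} d = ⟪ (λ n l → trans (⊝-at f n) (trans (cong -_ (at< d n l)) (sym (⊝-at g n)))) ⟫ₙ

⊗-cong[] : ∀ {N f f′ g g′} → f ≈[ N ] f′ → g ≈[ N ] g′ → f ⊗ g ≈[ N ] f′ ⊗ g′
⊗-cong[] d e = ⟪ (λ n l → ⊗-cong-≤ n (λ m m≤n → at< d m (ℕ.≤-<-trans m≤n l)) (λ m m≤n → at< e m (ℕ.≤-<-trans m≤n l))) ⟫ₙ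

-- Powers of q

-- The coefficient of qⁿ in a power of q; by recursion on both arguments a common shift of exponent
-- and order computes away.
kron : ℕ → ℕ → ℤ
kron zero    zero    = 1ℤ
kron zero    (suc n) = 0ℤ
kron (suc e) zero    = 0ℤ
kron (suc e) (suc n) = kron e n

kron-refl : ∀ n → kron n n ≡ 1ℤ
kron-refl zero = refl
kron-refl (suc n) = kron-refl n

kron-≢ : ∀ {m n} → m ≢ n → kron m n ≡ 0ℤ
kron-≢ {zero} {zero} ne = ⊥-elim (ne refl)
kron-≢ {zero} {suc n} ne = refl
kron-≢ {suc m} {zero} ne = refl
kron-≢ {suc m} {suc n} ne = kron-≢ (λ e → ne (cong suc e))

q⊗-zero : ∀ f → (q ⊗ f) 0 ≡ 0ℤ
q⊗-zero f = trans (⊗-zero q f) (cong (_* f 0) q-zero)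

q⊗-suc : ∀ f n → (q ⊗ f) (suc n) ≡ f n
q⊗-suc f n = trans (⊗-suc q f n) (trans (cong₂ (λ x y → x * f (suc n) + y) q-zero
    (trans (at (⊗-cong tail-q ≈-refl) n) (at (⊗-identityˡ f) n))) (ℤ.+-identityˡ (f n)))

q^⊗-< : ∀ e f {n} → n ℕ.< e → (q ^ e ⊗ f) n ≡ 0ℤ
q^⊗-< (suc e) f {zero} l = trans (at (⊗-assoc q (q ^ e) f) 0) (q⊗-zero (q ^ e ⊗ f))
q^⊗-< (suc e) f {suc n} (s≤s l) = trans (at (⊗-assoc q (q ^ e) f) (suc n)) (trans (q⊗-suc (q ^ e ⊗ f) n) (q^⊗-< e f l))

q^⊗-+ : ∀ e f n → (q ^ e ⊗ f) (e ℕ.+ n) ≡ f n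
q^⊗-+ zero f n = at (⊗-identityˡ f) n
q^⊗-+ (suc e) f n = trans (at (⊗-assoc q (q ^ e) f) (suc (e ℕ.+ n))) (trans (q⊗-suc (q ^ e ⊗ f) (e ℕ.+ n)) (q^⊗-+ e f n))

q^-at : ∀ e n → (q ^ e) n ≡ kron e n
q^-at zero zero = const-zero 1ℤ
q^-at zero (suc n) = const-suc 1ℤ n
q^-at (suc e) zero = q⊗-zero (q ^ e)
q^-at (suc e) (suc n) = trans (q⊗-suc (q ^ e) n) (q^-at e n)

const0-at : ∀ n → const 0ℤ n ≡ 0ℤ
const0-at zero = const-zero 0ℤ
const0-at (suc n) = const-suc 0ℤ n

q^⊗≈[]0 : ∀ {N} e f → N ℕ.≤ e → q ^ e ⊗ f ≈[ N ] const 0ℤ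
q^⊗≈[]0 e f le = ⟪ (λ n l → trans (q^⊗-< e f (ℕ.<-≤-trans l le)) (sym (const0-at n))) ⟫ₙ

q^≈[]0 : ∀ {N} e → N ℕ.≤ e → q ^ e ≈[ N ] const 0ℤ
q^≈[]0 {N} e le = ≈[]-trans (≈⇒≈[] N (≈-sym (⊗-identityʳ (q ^ e)))) (q^⊗≈[]0 e (const 1ℤ) le)

-- The shift by `e` also raises the precision by `e`; this gain closes the induction in `dil-⊗[]`.
q^⊗-cong[] : ∀ {N} e {f g} → f ≈[ N ] g → q ^ e ⊗ f ≈[ e ℕ.+ N ] q ^ e ⊗ g
q^⊗-cong[] {N} e {f} {g} d = ⟪ go ⟫ₙ
  where
  go : ∀ n → n ℕ.< e ℕ.+ N → (q ^ e ⊗ f) n ≡ (q ^ e ⊗ g) n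
  go n l with ℕ.<-≤-connex n e
  ... | inj₁ n<e = trans (q^⊗-< e f n<e) (sym (q^⊗-< e g n<e))
  ... | inj₂ e≤n = subst (λ m → (q ^ e ⊗ f) m ≡ (q ^ e ⊗ g) m) (ℕ.m+[n∸m]≡n e≤n)
      (trans (q^⊗-+ e f (n ∸ e)) (trans (at< d (n ∸ e) (ℕ.+-cancelˡ-< e (n ∸ e) N (subst (ℕ._< e ℕ.+ N) (sym (ℕ.m+[n∸m]≡n e≤n)) l)))
        (sym (q^⊗-+ e g (n ∸ e)))))

head-tail : ∀ f → f ≈ const (f 0) ⊕ q ⊗ tail f
head-tail f = ⟪ go ⟫
  where
  go : ∀ n → f n ≡ (const (f 0) ⊕ q ⊗ tail f) n
  go zero = sym (trans (⊕-at (const (f 0)) (q ⊗ tail f) 0) (trans (cong₂ _+_ (const-zero (f 0)) (q⊗-zero (tail f))) (ℤ.+-identityʳ (f 0))))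
  go (suc n) = sym (trans (⊕-at (const (f 0)) (q ⊗ tail f) (suc n)) (trans (cong₂ _+_ (const-suc (f 0) n) (q⊗-suc (tail f) n)) (ℤ.+-identityˡ (f (suc n)))))

-- A constant term 1 allows the coefficients of the left factor to be recovered one after another,
-- without division.
⊗-cancelʳ[] : ∀ N {f g} h → h 0 ≡ 1ℤ → f ⊗ h ≈[ N ] g ⊗ h → f ≈[ N ] g
⊗-cancelʳ[] zero h h0 e = ⟪ (λ n ()) ⟫ₙ
⊗-cancelʳ[] (suc N) {f} {g} h h0 e = ⟪ go ⟫ₙ
  where
  open ⊗-laws using (⊗-suc′)
  f0≡g0 : f 0 ≡ g 0
  f0≡g0 = trans (head-eq f) (trans (at< e 0 (s≤s z≤n)) (sym (head-eq g)))
    where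
    head-eq : ∀ k → k 0 ≡ (k ⊗ h) 0
    head-eq k = sym (trans (⊗-zero k h) (trans (cong (k 0 *_) h0) (ℤ.*-identityʳ (k 0))))
  tails : tail f ⊗ h ≈[ N ] tail g ⊗ h
  tails = ⟪ (λ n l → ℤ+.∙-cancelˡ (f 0 * h (suc n)) _ _
    (trans (sym (⊗-suc f h n)) (trans (at< e (suc n) (s≤s l)) (trans (⊗-suc g h n)
      (cong (λ x → x * h (suc n) + (tail g ⊗ h) n) (sym f0≡g0)))))) ⟫ₙ
  go : ∀ n → n ℕ.< suc N → f n ≡ g n
  go zero l = f0≡g0
  go (suc n) (s≤s l) = at< (⊗-cancelʳ[] N h h0 tails) n l

⊗-cancelʳ : ∀ {f g} h → h 0 ≡ 1ℤ → f ⊗ h ≈ g ⊗ h → f ≈ g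
⊗-cancelʳ h h0 e = ≈[]⇒≈ (λ N → ⊗-cancelʳ[] N h h0 (≈⇒≈[] N e))

⊗-head1 : ∀ {f g} → f 0 ≡ 1ℤ → g 0 ≡ 1ℤ → (f ⊗ g) 0 ≡ 1ℤ
⊗-head1 {f} {g} p p′ = trans (⊗-zero f g) (cong₂ _*_ p p′)

^-head1 : ∀ {f} n → f 0 ≡ 1ℤ → (f ^ n) 0 ≡ 1ℤ
^-head1 zero p = const-zero 1ℤ
^-head1 {f} (suc n) p = ⊗-head1 {f} {f ^ n} p (^-head1 n p)

-- Infinite products

1-q^ : ℕ → PS
1-q^ m = const 1ℤ ⊕ ⊝ q ^ m

1-q^-at : ∀ m n → 1-q^ m n ≡ kron 0 n - kron m n
1-q^-at m n = trans (⊕-at (const 1ℤ) (⊝ q ^ m) n) (cong₂ _+_ (q^-at 0 n) (trans (⊝-at (q ^ m) n) (cong -_ (q^-at m n))))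

oneMinus≈ : ∀ m → oneMinus (suc m) ≈ 1-q^ (suc m)
oneMinus≈ m = ⟪ (λ n → trans (go n) (sym (1-q^-at (suc m) n))) ⟫
  where
  go : ∀ n → oneMinus (suc m) n ≡ kron 0 n - kron (suc m) n
  go n with n ℕ.≟ 0 | n ℕ.≟ suc m
  go .0 | yes refl | _ = refl
  go .(suc m) | no _ | yes refl = sym (trans (ℤ.+-identityˡ (- kron m m)) (cong -_ (kron-refl m)))
  go zero | no ne | no _ = ⊥-elim (ne refl)
  go (suc n) | no _ | no ne = sym (cong (λ x → 0ℤ - x) (kron-≢ {suc m} {suc n} (λ e → ne (sym e))))

geom-∣ : ∀ {m n} → m ∣ n → geom m n ≡ 1ℤ
geom-∣ {m} {n} d with m ∣? n
... | yes _ = refl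
... | no nd = ⊥-elim (nd d)

geom-∤ : ∀ {m n} → ¬ (m ∣ n) → geom m n ≡ 0ℤ
geom-∤ {m} {n} d with m ∣? n
... | yes d′ = ⊥-elim (d d′)
... | no _ = refl

geom-+ : ∀ m n → geom m (m ℕ.+ n) ≡ geom m n
geom-+ m n with m ∣? n
... | yes d = geom-∣ (∣m∣n⇒∣m+n ∣-refl d)
... | no nd = geom-∤ (λ d → nd (∣m+n∣m⇒∣n d ∣-refl))

geom-rec : ∀ m → geom (suc m) ≈ const 1ℤ ⊕ q ^ suc m ⊗ geom (suc m)
geom-rec m = ⟪ (λ n → trans (go n) (sym (⊕-at (const 1ℤ) (q ^ suc m ⊗ geom (suc m)) n))) ⟫
  where
  go : ∀ n → geom (suc m) n ≡ const 1ℤ n + (q ^ suc m ⊗ geom (suc m)) n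
  go n with ℕ.<-≤-connex n (suc m)
  go zero | inj₁ l = trans (geom-∣ (suc m ∣0)) (sym (cong₂ _+_ (const-zero 1ℤ) (q^⊗-< (suc m) (geom (suc m)) l)))
  go (suc n) | inj₁ l = trans (geom-∤ (λ d → ℕ.<⇒≱ l (∣⇒≤ d))) (sym (cong₂ _+_ (const-suc 1ℤ n) (q^⊗-< (suc m) (geom (suc m)) l)))
  go (suc n) | inj₂ (s≤s l) = sym (begin
      const 1ℤ (suc n) + (q ^ suc m ⊗ geom (suc m)) (suc n)
        ≡⟨ cong₂ _+_ (const-suc 1ℤ n) (cong (λ k → (q ^ suc m ⊗ geom (suc m)) (suc k)) (sym eq)) ⟩
      0ℤ + (q ^ suc m ⊗ geom (suc m)) (suc m ℕ.+ (n ∸ m)) ≡⟨ ℤ.+-identityˡ _ ⟩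
      (q ^ suc m ⊗ geom (suc m)) (suc m ℕ.+ (n ∸ m)) ≡⟨ q^⊗-+ (suc m) (geom (suc m)) (n ∸ m) ⟩
      geom (suc m) (n ∸ m) ≡⟨ geom-+ (suc m) (n ∸ m) ⟨
      geom (suc m) (suc (m ℕ.+ (n ∸ m))) ≡⟨ cong (λ k → geom (suc m) (suc k)) eq ⟩
      geom (suc m) (suc n) ∎)
    where
    open ≡.≡-Reasoning
    eq : m ℕ.+ (n ∸ m) ≡ n
    eq = ℕ.m+[n∸m]≡n l

geom-inverse : ∀ m → 1-q^ (suc m) ⊗ geom (suc m) ≈ const 1ℤ
geom-inverse m = begin
  1-q^ (suc m) ⊗ geom (suc m)
    ≈⟨ solve 2 (λ x g → (con 1ℤ :+ :- x) :* g := g :+ :- (x :* g)) ≈-refl (q ^ suc m) (geom (suc m)) ⟩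
  geom (suc m) ⊕ ⊝ (q ^ suc m ⊗ geom (suc m)) ≈⟨ ⊕-cong (geom-rec m) ≈-refl ⟩
  (const 1ℤ ⊕ q ^ suc m ⊗ geom (suc m)) ⊕ ⊝ (q ^ suc m ⊗ geom (suc m))
    ≈⟨ solve 1 (λ x → (con 1ℤ :+ x) :+ :- x := con 1ℤ) ≈-refl (q ^ suc m ⊗ geom (suc m)) ⟩
  const 1ℤ ∎
  where
  open ≈-Reasoning
  open Solver

prod : (ℕ → PS) → ℕ → PS
prod F zero    = const 1ℤ
prod F (suc N) = prod F N ⊗ F N

lim : (ℕ → PS) → PS
lim F n = prod F (suc n) n

prod-cong : ∀ {F G} → (∀ k → F k ≈ G k) → ∀ N → prod F N ≈ prod G N
prod-cong e zero = ≈-refl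
prod-cong e (suc N) = ⊗-cong (prod-cong e N) (e N)

prod-⊗ : ∀ F G N → prod (λ k → F k ⊗ G k) N ≈ prod F N ⊗ prod G N
prod-⊗ F G zero = ≈-sym (⊗-identityˡ (const 1ℤ))
prod-⊗ F G (suc N) = ≈-trans (⊗-cong (prod-⊗ F G N) ≈-refl)
  (solve 4 (λ a b c d → (a :* b) :* (c :* d) := (a :* c) :* (b :* d)) ≈-refl (prod F N) (prod G N) (F N) (G N))
  where
  open Solver

prod-1 : ∀ N → prod (λ _ → const 1ℤ) N ≈ const 1ℤ
prod-1 zero = ≈-refl
prod-1 (suc N) = ≈-trans (⊗-cong (prod-1 N) ≈-refl) (⊗-identityˡ (const 1ℤ))

-- The condition under which `lim` is the genuine infinite product: factor k leaves coefficients up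
-- to order k untouched, so partial products stabilise, and `lim` respects products, dilation and
-- regrouping.
Tame : (ℕ → PS) → Set
Tame F = ∀ k → F k ≈[ suc k ] const 1ℤ

lim≈[]prod : ∀ {F} → Tame F → ∀ N → lim F ≈[ N ] prod F N
lim≈[]prod {F} tame N = ⟪ (λ n l → trans (stable n (N ∸ suc n)) (cong (λ k → prod F k n) (ℕ.m∸n+n≡m l))) ⟫ₙ
  where
  stable : ∀ n d → prod F (suc n) n ≡ prod F (d ℕ.+ suc n) n
  stable n zero = refl
  stable n (suc d) = trans (stable n d) (sym (trans
    (⊗-cong-≤ n (λ m _ → refl) (λ m m≤n → at< (tame (d ℕ.+ suc n)) m
      (s≤s (ℕ.≤-trans m≤n (ℕ.≤-trans (ℕ.n≤1+n n) (ℕ.m≤n+m (suc n) d))))))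
    (at (⊗-identityʳ (prod F (d ℕ.+ suc n))) n)))

lim-cong : ∀ {F G} → (∀ k → F k ≈ G k) → lim F ≈ lim G
lim-cong e = ⟪ (λ n → at (prod-cong e (suc n)) n) ⟫

Tame-⊗ : ∀ {F G} → Tame F → Tame G → Tame (λ k → F k ⊗ G k)
Tame-⊗ s t k = ≈[]-trans (⊗-cong[] (s k) (t k)) (≈⇒≈[] _ (⊗-identityˡ (const 1ℤ)))

lim-⊗ : ∀ {F G} → Tame F → Tame G → lim (λ k → F k ⊗ G k) ≈ lim F ⊗ lim G
lim-⊗ {F} {G} s t = ≈[]⇒≈ (λ N → ≈[]-trans (lim≈[]prod (Tame-⊗ s t) N)
  (≈[]-trans (≈⇒≈[] N (prod-⊗ F G N)) (≈[]-sym (⊗-cong[] (lim≈[]prod s N) (lim≈[]prod t N)))))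

lim-head : ∀ {F} → Tame F → lim F 0 ≡ 1ℤ
lim-head {F} tame = trans (at< (lim≈[]prod tame 1) 0 (s≤s z≤n))
  (trans (at (⊗-identityˡ (F 0)) 0) (trans (at< (tame 0) 0 (s≤s z≤n)) (const-zero 1ℤ)))

prodUpTo≈prod : ∀ {F G} → (∀ k → F k ≈ G k) → ∀ N → prodUpTo F N ≈ prod G N
prodUpTo≈prod e zero = one≈const
prodUpTo≈prod {F} e (suc N) = ≈-trans (·≈⊗ (prodUpTo F N) (F N)) (⊗-cong (prodUpTo≈prod e N) (e N))

Tame-1-q^ : ∀ a d → Tame (λ k → 1-q^ (suc a ℕ.+ suc d ℕ.* k))
Tame-1-q^ a d k = ≈[]-trans (⊕-cong[] ≈[]-refl (⊝-cong[] (q^≈[]0 (suc a ℕ.+ suc d ℕ.* k) (s≤s (ℕ.≤-trans (ℕ.m≤m+n k (d ℕ.* k)) (ℕ.m≤n+m (suc d ℕ.* k) a))))))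
  (≈⇒≈[] _ (solve 0 (con 1ℤ :+ :- con 0ℤ := con 1ℤ) ≈-refl))
  where
  open Solver

Tame-inverse : ∀ {F G} → Tame F → (∀ k → F k ⊗ G k ≈ const 1ℤ) → Tame G
Tame-inverse {F} {G} t inv k = ≈[]-trans (≈[]-trans (≈⇒≈[] _ (≈-sym (⊗-identityˡ (G k)))) (⊗-cong[] (≈[]-sym (t k)) ≈[]-refl))
  (≈⇒≈[] _ (inv k))

-- Shifted indices: Π a d = (q^{a+1}; q^{d+1})_∞.
Π Π⁻¹ : ℕ → ℕ → PS
Π a d = lim (λ k → 1-q^ (suc a ℕ.+ suc d ℕ.* k))
Π⁻¹ a d = lim (λ k → geom (suc a ℕ.+ suc d ℕ.* k))

poch≈Π : ∀ a d → poch (suc a) (suc d) ≈ Π a d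
poch≈Π a d = ⟪ (λ n → at (prodUpTo≈prod (λ k → oneMinus≈ (a ℕ.+ suc d ℕ.* k)) (suc n)) n) ⟫

pochInv≈Π⁻¹ : ∀ a d → pochInv (suc a) (suc d) ≈ Π⁻¹ a d
pochInv≈Π⁻¹ a d = ⟪ (λ n → at (prodUpTo≈prod (λ k → ≈-refl) (suc n)) n) ⟫

Tame-geom : ∀ a d → Tame (λ k → geom (suc a ℕ.+ suc d ℕ.* k))
Tame-geom a d = Tame-inverse (Tame-1-q^ a d) (λ k → geom-inverse (a ℕ.+ suc d ℕ.* k))

Π-inverse : ∀ a d → Π a d ⊗ Π⁻¹ a d ≈ const 1ℤ
Π-inverse a d = ≈-trans (≈-sym (lim-⊗ (Tame-1-q^ a d) (Tame-geom a d)))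
  (≈-trans (lim-cong (λ k → geom-inverse (a ℕ.+ suc d ℕ.* k))) ⟪ (λ n → at (prod-1 (suc n)) n) ⟫)

-- The substitution q ↦ q⁵

opaque
  dil : PS → PS
  dil = dilate5

  dil≈dilate5 : ∀ f → dilate5 f ≈ dil f
  dil≈dilate5 f = ≈-refl

  dil-*5 : ∀ f n → dil f (n ℕ.* 5) ≡ f n
  dil-*5 f n with 5 ∣? n ℕ.* 5
  ... | yes _ = cong f (m*n/n≡m n 5)
  ... | no nd = ⊥-elim (nd (n∣m*n n))

  dil-∤ : ∀ f {n} → ¬ (5 ∣ n) → dil f n ≡ 0ℤ
  dil-∤ f {n} nd with 5 ∣? n
  ... | yes d = ⊥-elim (nd d)
  ... | no _ = refl

dil-cong[] : ∀ {N f g} → f ≈[ N ] g → dil f ≈[ N ] dil g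
dil-cong[] {N} {f} {g} e = ⟪ go ⟫ₙ
  where
  go : ∀ n → n ℕ.< N → dil f n ≡ dil g n
  go n l with 5 ∣? n
  ... | yes (divides m refl) = trans (dil-*5 f m) (trans (at< e m (ℕ.≤-<-trans (ℕ.m≤m*n m 5) l)) (sym (dil-*5 g m)))
  ... | no nd = trans (dil-∤ f nd) (sym (dil-∤ g nd))

dil-cong : ∀ {f g} → f ≈ g → dil f ≈ dil g
dil-cong e = ≈[]⇒≈ (λ N → dil-cong[] (≈⇒≈[] N e))

-- The defining property of f(q⁵); the linear compatibilities of `dil` are all checked against it.
dil-unique : ∀ {f g} → (∀ n → g (n ℕ.* 5) ≡ f n) → (∀ {n} → ¬ (5 ∣ n) → g n ≡ 0ℤ) → dil f ≈ g
dil-unique {f} {g} m z = ⟪ go ⟫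
  where
  go : ∀ n → dil f n ≡ g n
  go n with 5 ∣? n
  ... | yes (divides m′ refl) = trans (dil-*5 f m′) (sym (m m′))
  ... | no nd = trans (dil-∤ f nd) (sym (z nd))

dil-⊕ : ∀ f g → dil (f ⊕ g) ≈ dil f ⊕ dil g
dil-⊕ f g = dil-unique
  (λ n → trans (⊕-at (dil f) (dil g) (n ℕ.* 5)) (trans (cong₂ _+_ (dil-*5 f n) (dil-*5 g n)) (sym (⊕-at f g n))))
  (λ {n} nd → trans (⊕-at (dil f) (dil g) n) (cong₂ _+_ (dil-∤ f nd) (dil-∤ g nd)))

dil-⊝ : ∀ f → dil (⊝ f) ≈ ⊝ dil f
dil-⊝ f = dil-unique
  (λ n → trans (⊝-at (dil f) (n ℕ.* 5)) (trans (cong -_ (dil-*5 f n)) (sym (⊝-at f n))))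
  (λ {n} nd → trans (⊝-at (dil f) n) (cong -_ (dil-∤ f nd)))

dil-const : ∀ c → dil (const c) ≈ const c
dil-const c = dil-unique
  (λ { zero → refl ; (suc n) → trans (const-suc c (4 ℕ.+ n ℕ.* 5)) (sym (const-suc c n)) })
  (λ { {zero} nd → ⊥-elim (nd (5 ∣0)) ; {suc n} nd → const-suc c n })

dil-scale : ∀ c f → dil (const c ⊗ f) ≈ const c ⊗ dil f
dil-scale c f = dil-unique
  (λ n → trans (scale-at c (dil f) (n ℕ.* 5)) (trans (cong (c *_) (dil-*5 f n)) (sym (scale-at c f n))))
  (λ {n} nd → trans (scale-at c (dil f) n) (trans (cong (c *_) (dil-∤ f nd)) (ℤ.*-zeroʳ c)))

dil-q⊗ : ∀ f → dil (q ⊗ f) ≈ q ^ 5 ⊗ dil f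
dil-q⊗ f = dil-unique mult nonmult
  where
  mult : ∀ n → (q ^ 5 ⊗ dil f) (n ℕ.* 5) ≡ (q ⊗ f) n
  mult zero = trans (q^⊗-< 5 (dil f) (s≤s z≤n)) (sym (q⊗-zero f))
  mult (suc n) = trans (q^⊗-+ 5 (dil f) (n ℕ.* 5)) (trans (dil-*5 f n) (sym (q⊗-suc f n)))
  nonmult : ∀ {n} → ¬ (5 ∣ n) → (q ^ 5 ⊗ dil f) n ≡ 0ℤ
  nonmult {n} nd with ℕ.<-≤-connex n 5
  ... | inj₁ l = q^⊗-< 5 (dil f) l
  ... | inj₂ l = subst (λ k → (q ^ 5 ⊗ dil f) k ≡ 0ℤ) (ℕ.m+[n∸m]≡n l)
    (trans (q^⊗-+ 5 (dil f) (n ∸ 5)) (dil-∤ f (λ d → nd (subst (5 ∣_) (ℕ.m+[n∸m]≡n l) (∣m∣n⇒∣m+n ∣-refl d)))))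

dil-head-tail : ∀ f → dil f ≈ const (f 0) ⊕ q ^ 5 ⊗ dil (tail f)
dil-head-tail f = ≈-trans (dil-cong (head-tail f)) (≈-trans (dil-⊕ (const (f 0)) (q ⊗ tail f)) (⊕-cong (dil-const (f 0)) (dil-q⊗ (tail f))))

-- Induction on the precision: writing f as its constant term plus q times its tail, the tail
-- carries a factor q⁵ after dilation, so precision N for the tail is more than enough.
dil-⊗[] : ∀ N f g → dil (f ⊗ g) ≈[ N ] dil f ⊗ dil g
dil-⊗[] zero f g = ⟪ (λ n ()) ⟫ₙ
dil-⊗[] (suc N) f g = begin
  dil (f ⊗ g) ≈⟨ ≈⇒≈[] _ expand ⟩
  const (f 0) ⊗ dil g ⊕ q ^ 5 ⊗ dil (tail f ⊗ g)
    ≈⟨ ⊕-cong[] ≈[]-refl (≈[]-weaken (s≤s (ℕ.m≤n+m N 4)) (q^⊗-cong[] 5 (dil-⊗[] N (tail f) g))) ⟩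
  const (f 0) ⊗ dil g ⊕ q ^ 5 ⊗ (dil (tail f) ⊗ dil g)
    ≈⟨ ≈⇒≈[] _ (solve 4 (λ a b c d → a :* b :+ c :* (d :* b) := (a :+ c :* d) :* b) ≈-refl (const (f 0)) (dil g) (q ^ 5) (dil (tail f))) ⟩
  (const (f 0) ⊕ q ^ 5 ⊗ dil (tail f)) ⊗ dil g
    ≈⟨ ≈⇒≈[] _ (⊗-cong (≈-sym (dil-head-tail f)) ≈-refl) ⟩
  dil f ⊗ dil g ∎
  where
  open Mod (suc N)
  open Solver
  expand : dil (f ⊗ g) ≈ const (f 0) ⊗ dil g ⊕ q ^ 5 ⊗ dil (tail f ⊗ g)
  expand = ≈-trans (dil-cong (≈-trans (⊗-cong (head-tail f) ≈-refl)
      (≈-trans (⊗-distribʳ-⊕ g (const (f 0)) (q ⊗ tail f)) (⊕-cong ≈-refl (⊗-assoc q (tail f) g)))))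
    (≈-trans (dil-⊕ (const (f 0) ⊗ g) (q ⊗ (tail f ⊗ g))) (⊕-cong (dil-scale (f 0) g) (dil-q⊗ (tail f ⊗ g))))

dil-⊗ : ∀ f g → dil (f ⊗ g) ≈ dil f ⊗ dil g
dil-⊗ f g = ≈[]⇒≈ (λ N → dil-⊗[] N f g)

dil-^ : ∀ f n → dil (f ^ n) ≈ dil f ^ n
dil-^ f zero = dil-const 1ℤ
dil-^ f (suc n) = ≈-trans (dil-⊗ f (f ^ n)) (⊗-cong ≈-refl (dil-^ f n))

dil-q : dil q ≈ q ^ 5
dil-q = ≈-trans (dil-cong (≈-sym (⊗-identityʳ q))) (≈-trans (dil-q⊗ (const 1ℤ)) (≈-trans (⊗-cong ≈-refl (dil-const 1ℤ)) (⊗-identityʳ (q ^ 5))))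

dil-head : ∀ f → dil f 0 ≡ f 0
dil-head f = dil-*5 f 0

dil-prod : ∀ F N → dil (prod F N) ≈ prod (λ k → dil (F k)) N
dil-prod F zero = dil-const 1ℤ
dil-prod F (suc N) = ≈-trans (dil-⊗ (prod F N) (F N)) (⊗-cong (dil-prod F N) ≈-refl)

dil-lim : ∀ {F} → Tame F → dil (lim F) ≈ lim (λ k → dil (F k))
dil-lim {F} t = ≈[]⇒≈ (λ N → ≈[]-trans (dil-cong[] (lim≈[]prod t N))
  (≈[]-trans (≈⇒≈[] N (dil-prod F N)) (≈[]-sym (lim≈[]prod (λ k → ≈[]-trans (dil-cong[] (t k)) (≈⇒≈[] _ (dil-const 1ℤ))) N))))

-- Residue classes of exponents modulo 5

opaque
  comp : ℕ → PS → PS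
  comp r f n = f (r ℕ.+ n ℕ.* 5)

  comp-at : ∀ r f n → comp r f n ≡ f (r ℕ.+ n ℕ.* 5)
  comp-at r f n = refl

comp-cong : ∀ r {f g} → f ≈ g → comp r f ≈ comp r g
comp-cong r {f} {g} e = ⟪ (λ n → trans (comp-at r f n) (trans (at e _) (sym (comp-at r g n)))) ⟫

comp-⊕ : ∀ r f g → comp r (f ⊕ g) ≈ comp r f ⊕ comp r g
comp-⊕ r f g = ⟪ (λ n → trans (comp-at r (f ⊕ g) n) (trans (⊕-at f g _) (trans (cong₂ _+_ (sym (comp-at r f n)) (sym (comp-at r g n))) (sym (⊕-at (comp r f) (comp r g) n))))) ⟫

-- Series in q⁵ act as scalars on residue classes. The bound on r guarantees that the part of the
-- product carrying q⁵ does not reach the lowest coefficient of the class.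
comp-dil⊗ : ∀ {r} → r ℕ.< 5 → ∀ g f → comp r (dil g ⊗ f) ≈ g ⊗ comp r f
comp-dil⊗ {r} r<5 g f = ⟪ (λ n → trans (comp-at r (dil g ⊗ f) n) (go n g)) ⟫
  where
  open Solver
  expand : ∀ g → dil g ⊗ f ≈ const (g 0) ⊗ f ⊕ q ^ 5 ⊗ (dil (tail g) ⊗ f)
  expand g = ≈-trans (⊗-cong (dil-head-tail g) ≈-refl)
    (solve 4 (λ a b c d → (a :+ c :* d) :* b := a :* b :+ c :* (d :* b)) ≈-refl (const (g 0)) f (q ^ 5) (dil (tail g)))
  at-expand : ∀ g n → (dil g ⊗ f) n ≡ g 0 * f n + (q ^ 5 ⊗ (dil (tail g) ⊗ f)) n
  at-expand g n = trans (at (expand g) n) (trans (⊕-at _ _ n) (cong (_+ (q ^ 5 ⊗ (dil (tail g) ⊗ f)) n) (scale-at (g 0) f n)))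
  go : ∀ n g → (dil g ⊗ f) (r ℕ.+ n ℕ.* 5) ≡ (g ⊗ comp r f) n
  go zero g = trans (at-expand g (r ℕ.+ 0)) (trans
    (cong₂ (λ x y → g 0 * x + y) (sym (comp-at r f 0)) (q^⊗-< 5 _ (subst (ℕ._< 5) (sym (ℕ.+-identityʳ r)) r<5)))
    (trans (ℤ.+-identityʳ _) (sym (⊗-zero g (comp r f)))))
  go (suc n) g = trans (at-expand g (r ℕ.+ (5 ℕ.+ n ℕ.* 5))) (trans
    (cong₂ (λ x y → g 0 * x + y) (sym (comp-at r f (suc n)))
      (trans (cong (q ^ 5 ⊗ (dil (tail g) ⊗ f)) swap) (trans (q^⊗-+ 5 (dil (tail g) ⊗ f) (r ℕ.+ n ℕ.* 5)) (go n (tail g)))))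
    (sym (⊗-suc g (comp r f) n)))
    where
    swap : r ℕ.+ (5 ℕ.+ n ℕ.* 5) ≡ 5 ℕ.+ (r ℕ.+ n ℕ.* 5)
    swap = trans (sym (ℕ.+-assoc r 5 (n ℕ.* 5))) (trans (cong (ℕ._+ n ℕ.* 5) (ℕ.+-comm r 5)) (ℕ.+-assoc 5 r (n ℕ.* 5)))

dissection : (E : ℕ → PS) → PS
dissection E = dil (E 0) ⊗ q ^ 0 ⊕ dil (E 1) ⊗ q ^ 1 ⊕ dil (E 2) ⊗ q ^ 2 ⊕ dil (E 3) ⊗ q ^ 3 ⊕ dil (E 4) ⊗ q ^ 4

comp-dissection : ∀ {r} → r ℕ.< 5 → ∀ E → comp r (dissection E) ≈ E r
comp-dissection {r} r<5 E = ≈-trans expand (≈-trans (⊕-cong (⊕-cong (⊕-cong (⊕-cong (term 0) (term 1)) (term 2)) (term 3)) (term 4)) (select r r<5))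
  where
  open Solver
  expand : comp r (dissection E) ≈ comp r (dil (E 0) ⊗ q ^ 0) ⊕ comp r (dil (E 1) ⊗ q ^ 1) ⊕ comp r (dil (E 2) ⊗ q ^ 2) ⊕ comp r (dil (E 3) ⊗ q ^ 3) ⊕ comp r (dil (E 4) ⊗ q ^ 4)
  expand = ≈-trans (comp-⊕ r _ _) (⊕-cong (≈-trans (comp-⊕ r _ _) (⊕-cong (≈-trans (comp-⊕ r _ _) (⊕-cong (comp-⊕ r _ _) ≈-refl)) ≈-refl)) ≈-refl)
  δ : ℕ → PS
  δ s = const (kron s r)
  comp-q^ : ∀ s → s ℕ.< 5 → comp r (q ^ s) ≈ δ s
  comp-q^ s s<5 = ⟪ (λ n → trans (comp-at r (q ^ s) n) (trans (q^-at s (r ℕ.+ n ℕ.* 5)) (go n))) ⟫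
    where
    go : ∀ n → kron s (r ℕ.+ n ℕ.* 5) ≡ δ s n
    go zero = trans (cong (kron s) (ℕ.+-identityʳ r)) (sym (const-zero _))
    go (suc n) = trans (kron-≢ (λ e → ℕ.<⇒≱ s<5 (subst (5 ℕ.≤_) (sym e) (ℕ.≤-trans (ℕ.m≤m+n 5 (n ℕ.* 5)) (ℕ.m≤n+m (5 ℕ.+ n ℕ.* 5) r))))) (sym (const-suc _ n))
  term : ∀ s → {s<5 : True (s ℕ.<? 5)} → comp r (dil (E s) ⊗ q ^ s) ≈ E s ⊗ δ s
  term s {p} = ≈-trans (comp-dil⊗ r<5 (E s) (q ^ s)) (⊗-cong ≈-refl (comp-q^ s (toWitness p)))
  select : ∀ r → r ℕ.< 5 → E 0 ⊗ const (kron 0 r) ⊕ E 1 ⊗ const (kron 1 r) ⊕ E 2 ⊗ const (kron 2 r) ⊕ E 3 ⊗ const (kron 3 r) ⊕ E 4 ⊗ const (kron 4 r) ≈ E r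
  select 0 l = solve 5 (λ a b c d e → a :* con 1ℤ :+ b :* con 0ℤ :+ c :* con 0ℤ :+ d :* con 0ℤ :+ e :* con 0ℤ := a) ≈-refl (E 0) (E 1) (E 2) (E 3) (E 4)
  select 1 l = solve 5 (λ a b c d e → a :* con 0ℤ :+ b :* con 1ℤ :+ c :* con 0ℤ :+ d :* con 0ℤ :+ e :* con 0ℤ := b) ≈-refl (E 0) (E 1) (E 2) (E 3) (E 4)
  select 2 l = solve 5 (λ a b c d e → a :* con 0ℤ :+ b :* con 0ℤ :+ c :* con 1ℤ :+ d :* con 0ℤ :+ e :* con 0ℤ := c) ≈-refl (E 0) (E 1) (E 2) (E 3) (E 4)
  select 3 l = solve 5 (λ a b c d e → a :* con 0ℤ :+ b :* con 0ℤ :+ c :* con 0ℤ :+ d :* con 1ℤ :+ e :* con 0ℤ := d) ≈-refl (E 0) (E 1) (E 2) (E 3) (E 4)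
  select 4 l = solve 5 (λ a b c d e → a :* con 0ℤ :+ b :* con 0ℤ :+ c :* con 0ℤ :+ d :* con 0ℤ :+ e :* con 1ℤ := e) ≈-refl (E 0) (E 1) (E 2) (E 3) (E 4)
  select (suc (suc (suc (suc (suc r))))) (s≤s (s≤s (s≤s (s≤s (s≤s ())))))

-- The derivation q d/dq

opaque
  θ : PS → PS
  θ f n = + n * f n

  θ-at : ∀ f n → θ f n ≡ + n * f n
  θ-at f n = refl

θ-cong : ∀ {f g} → f ≈ g → θ f ≈ θ g
θ-cong {f} {g} e = ⟪ (λ n → trans (θ-at f n) (trans (cong (+ n *_) (at e n)) (sym (θ-at g n)))) ⟫

θ-cong[] : ∀ {N f g} → f ≈[ N ] g → θ f ≈[ N ] θ g
θ-cong[] {N} {f} {g} e = ⟪ (λ n l → trans (θ-at f n) (trans (cong (+ n *_) (at< e n l)) (sym (θ-at g n)))) ⟫ₙ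

θ-⊕ : ∀ f g → θ (f ⊕ g) ≈ θ f ⊕ θ g
θ-⊕ f g = ⟪ (λ n → trans (θ-at (f ⊕ g) n) (trans (cong (+ n *_) (⊕-at f g n)) (trans (ℤ.*-distribˡ-+ (+ n) (f n) (g n))
  (trans (cong₂ _+_ (sym (θ-at f n)) (sym (θ-at g n))) (sym (⊕-at (θ f) (θ g) n)))))) ⟫

θ-⊝ : ∀ f → θ (⊝ f) ≈ ⊝ θ f
θ-⊝ f = ⟪ (λ n → trans (θ-at (⊝ f) n) (trans (cong (+ n *_) (⊝-at f n)) (trans (sym (ℤ.neg-distribʳ-* (+ n) (f n)))
  (trans (cong -_ (sym (θ-at f n))) (sym (⊝-at (θ f) n)))))) ⟫

θ-const : ∀ c → θ (const c) ≈ const 0ℤ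
θ-const c = ⟪ (λ { zero → trans (θ-at (const c) 0) (sym (const-zero 0ℤ))
                 ; (suc n) → trans (θ-at (const c) (suc n)) (trans (cong (+ suc n *_) (const-suc c n)) (trans (ℤ.*-zeroʳ (+ suc n)) (sym (const-suc 0ℤ n)))) }) ⟫

tail-θ : ∀ f → tail (θ f) ≈ tail f ⊕ θ (tail f)
tail-θ f = ⟪ (λ n → trans (θ-at f (suc n)) (trans (split n (f (suc n)))
    (trans (cong (λ x → f (suc n) + x) (sym (θ-at (tail f) n))) (sym (⊕-at (tail f) (θ (tail f)) n))))) ⟫
  where
  split : ∀ n x → + suc n * x ≡ x + + n * x
  split n x = ℤ.suc-* (+ n) x

θ-⊗ : ∀ f g → θ (f ⊗ g) ≈ θ f ⊗ g ⊕ f ⊗ θ g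
θ-⊗ f g = ⟪ (λ n → trans (θ-at (f ⊗ g) n) (trans (go n f) (sym (⊕-at (θ f ⊗ g) (f ⊗ θ g) n)))) ⟫
  where
  θ-zero : ∀ f → θ f 0 ≡ 0ℤ
  θ-zero f = θ-at f 0
  go : ∀ n f → + n * (f ⊗ g) n ≡ (θ f ⊗ g) n + (f ⊗ θ g) n
  go zero f = sym (cong₂ _+_ (trans (⊗-zero (θ f) g) (cong (_* g 0) (θ-zero f)))
    (trans (⊗-zero f (θ g)) (trans (cong (f 0 *_) (θ-zero g)) (ℤ.*-zeroʳ (f 0)))))
  go (suc n) f = begin
      + suc n * (f ⊗ g) (suc n) ≡⟨ cong (+ suc n *_) (⊗-suc f g n) ⟩
      + suc n * (f 0 * g (suc n) + t) ≡⟨ expand (+ suc n) (f 0) (g (suc n)) t ⟩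
      f 0 * (+ suc n * g (suc n)) + + suc n * t ≡⟨ cong (λ x → f 0 * (+ suc n * g (suc n)) + x) (trans (ℤ.suc-* (+ n) t) (cong (λ y → t + y) (go n (tail f)))) ⟩
      f 0 * (+ suc n * g (suc n)) + (t + (u + v)) ≡⟨ rearrange (f 0 * (+ suc n * g (suc n))) t u v ⟩
      (t + u) + (f 0 * (+ suc n * g (suc n)) + v)
        ≡⟨ cong₂ _+_ (sym first) (trans (cong (λ x → f 0 * x + v) (sym (θ-at g (suc n)))) (sym (⊗-suc f (θ g) n))) ⟩
      (θ f ⊗ g) (suc n) + (f ⊗ θ g) (suc n) ∎
    where
    open ≡.≡-Reasoning
    t = (tail f ⊗ g) n
    u = (θ (tail f) ⊗ g) n
    v = (tail f ⊗ θ g) n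
    expand : ∀ s a b c → s * (a * b + c) ≡ a * (s * b) + s * c
    expand = solve-∀
    rearrange : ∀ a t u v → a + (t + (u + v)) ≡ (t + u) + (a + v)
    rearrange = solve-∀
    first : (θ f ⊗ g) (suc n) ≡ t + u
    first = trans (⊗-suc (θ f) g n) (trans (cong₂ (λ x y → x * g (suc n) + y) (θ-zero f)
      (trans (at (⊗-cong (tail-θ f) ≈-refl) n) (trans (at (⊗-distribʳ-⊕ g (tail f) (θ (tail f))) n) (⊕-at _ _ n))))
      (ℤ.+-identityˡ (t + u)))

θ-dil : ∀ f → θ (dil f) ≈ const (+ 5) ⊗ dil (θ f)
θ-dil f = ≈-trans (≈-sym (dil-unique mult nonmult)) (dil-scale (+ 5) (θ f))
  where
  assoc : ∀ n x → n * + 5 * x ≡ + 5 * (n * x)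
  assoc = solve-∀
  mult : ∀ n → θ (dil f) (n ℕ.* 5) ≡ (const (+ 5) ⊗ θ f) n
  mult n = trans (θ-at (dil f) (n ℕ.* 5)) (trans (cong₂ _*_ (ℤ.pos-* n 5) (dil-*5 f n))
    (trans (assoc (+ n) (f n)) (trans (cong (+ 5 *_) (sym (θ-at f n))) (sym (scale-at (+ 5) (θ f) n)))))
  nonmult : ∀ {n} → ¬ (5 ∣ n) → θ (dil f) n ≡ 0ℤ
  nonmult {n} nd = trans (θ-at (dil f) n) (trans (cong (+ n *_) (dil-∤ f nd)) (ℤ.*-zeroʳ (+ n)))

θ-q^ : ∀ e → θ (q ^ e) ≈ const (+ e) ⊗ q ^ e
θ-q^ e = ⟪ (λ n → trans (θ-at (q ^ e) n) (trans (trans (cong (+ n *_) (q^-at e n)) (trans (go n) (cong (+ e *_) (sym (q^-at e n))))) (sym (scale-at (+ e) (q ^ e) n)))) ⟫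
  where
  go : ∀ n → + n * kron e n ≡ + e * kron e n
  go n with e ℕ.≟ n
  ... | yes refl = refl
  ... | no ne = trans (trans (cong (+ n *_) (kron-≢ ne)) (ℤ.*-zeroʳ (+ n))) (sym (trans (cong (+ e *_) (kron-≢ ne)) (ℤ.*-zeroʳ (+ e))))

-- Finite sums of power series

∑ : ℕ → (ℕ → PS) → PS
∑ zero    F = const 0ℤ
∑ (suc n) F = ∑ n F ⊕ F n

∑-cong[] : ∀ {N} n {F G} → (∀ i → i ℕ.< n → F i ≈[ N ] G i) → ∑ n F ≈[ N ] ∑ n G
∑-cong[] zero e = ≈[]-refl
∑-cong[] (suc n) e = ⊕-cong[] (∑-cong[] n (λ i l → e i (ℕ.m<n⇒m<1+n l))) (e n ℕ.≤-refl)

∑-cong : ∀ n {F G} → (∀ i → i ℕ.< n → F i ≈ G i) → ∑ n F ≈ ∑ n G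
∑-cong n e = ≈[]⇒≈ (λ N → ∑-cong[] n (λ i l → ≈⇒≈[] N (e i l)))

∑-⊕ : ∀ n F G → ∑ n (λ i → F i ⊕ G i) ≈ ∑ n F ⊕ ∑ n G
∑-⊕ zero F G = ≈-sym (⊕-identityˡ (const 0ℤ))
∑-⊕ (suc n) F G = ≈-trans (⊕-cong (∑-⊕ n F G) ≈-refl)
  (solve 4 (λ a b c d → (a :+ b) :+ (c :+ d) := (a :+ c) :+ (b :+ d)) ≈-refl (∑ n F) (∑ n G) (F n) (G n))
  where
  open Solver

∑-⊗ˡ : ∀ n c F → ∑ n (λ i → c ⊗ F i) ≈ c ⊗ ∑ n F
∑-⊗ˡ zero c F = ≈-sym (⊗-zeroʳ c)
∑-⊗ˡ (suc n) c F = ≈-trans (⊕-cong (∑-⊗ˡ n c F) ≈-refl) (≈-sym (⊗-distribˡ-⊕ c (∑ n F) (F n)))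

∑-head : ∀ n F → ∑ (suc n) F ≈ F 0 ⊕ ∑ n (λ i → F (suc i))
∑-head zero F = ⊕-comm (const 0ℤ) (F 0)
∑-head (suc n) F = ≈-trans (⊕-cong (∑-head n F) ≈-refl) (⊕-assoc (F 0) (∑ n (λ i → F (suc i))) (F (suc n)))

-- Finite form of the Jacobi triple product, with base Q = q^{d+1}

module Gauss (d : ℕ) where

  open Solver

  Q : PS
  Q = q ^ suc d

  -- (x; Q)_N
  P : PS → ℕ → PS
  P x = prod (λ k → const 1ℤ ⊕ ⊝ (x ⊗ Q ^ k))

  Q! : ℕ → PS
  Q! = prod (λ k → const 1ℤ ⊕ ⊝ Q ^ suc k)

  -- The Gaussian binomial coefficients in base Q, generated by one q-Pascal rule. Where the
  -- subtraction is truncated, i > M, it multiplies a vanishing coefficient.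
  bin : ℕ → ℕ → PS
  bin M       zero    = const 1ℤ
  bin zero    (suc i) = const 0ℤ
  bin (suc M) (suc i) = bin M (suc i) ⊕ Q ^ (M ∸ i) ⊗ bin M i

  bin-> : ∀ {M i} → M ℕ.< i → bin M i ≈ const 0ℤ
  bin-> {zero} {suc i} l = ≈-refl
  bin-> {suc M} {suc i} (s≤s l) = ≈-trans (⊕-cong (bin-> (ℕ.m<n⇒m<1+n l)) (⊗-cong ≈-refl (bin-> l)))
    (solve 1 (λ x → con 0ℤ :+ x :* con 0ℤ := con 0ℤ) ≈-refl (Q ^ (M ∸ i)))

  bin-diag : ∀ i → bin i i ≈ const 1ℤ
  bin-diag zero = ≈-refl
  bin-diag (suc i) = ≈-trans (⊕-cong (bin-> (ℕ.n<1+n i)) (⊗-cong (≡⇒≈ (cong (Q ^_) (ℕ.n∸n≡0 i))) (bin-diag i)))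
    (solve 0 (con 0ℤ :+ con 1ℤ :* con 1ℤ := con 1ℤ) ≈-refl)

  -- The factorial formula without division. It yields the second Pascal rule and, for large i and
  -- j, the limit 1/(Q; Q)_∞.
  bin-Q! : ∀ i j → bin (i ℕ.+ j) i ⊗ (Q! i ⊗ Q! j) ≈ Q! (i ℕ.+ j)
  bin-Q! zero j = solve 1 (λ x → con 1ℤ :* (con 1ℤ :* x) := x) ≈-refl (Q! j)
  bin-Q! (suc i) zero rewrite ℕ.+-identityʳ i = ≈-trans (⊗-cong (bin-diag (suc i)) ≈-refl)
    (solve 1 (λ x → con 1ℤ :* (x :* con 1ℤ) := x) ≈-refl (Q! (suc i)))
  bin-Q! (suc i) (suc j) = begin
      (b₁ ⊕ Q ^ (i ℕ.+ suc j ∸ i) ⊗ b₂) ⊗ ((Q! i ⊗ (const 1ℤ ⊕ ⊝ Qi)) ⊗ (Q! j ⊗ (const 1ℤ ⊕ ⊝ Qj)))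
        ≡⟨ cong (λ e → (b₁ ⊕ Q ^ e ⊗ b₂) ⊗ ((Q! i ⊗ (const 1ℤ ⊕ ⊝ Qi)) ⊗ (Q! j ⊗ (const 1ℤ ⊕ ⊝ Qj)))) (ℕ.m+n∸m≡n i (suc j)) ⟩
      (b₁ ⊕ Qj ⊗ b₂) ⊗ ((Q! i ⊗ (const 1ℤ ⊕ ⊝ Qi)) ⊗ (Q! j ⊗ (const 1ℤ ⊕ ⊝ Qj)))
        ≈⟨ solve 6 (λ b c x y s t → (b :+ y :* c) :* ((s :* (con 1ℤ :+ :- x)) :* (t :* (con 1ℤ :+ :- y)))
             := (b :* ((s :* (con 1ℤ :+ :- x)) :* t)) :* (con 1ℤ :+ :- y) :+ y :* (c :* (s :* (t :* (con 1ℤ :+ :- y)))) :* (con 1ℤ :+ :- x))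
             ≈-refl b₁ b₂ Qi Qj (Q! i) (Q! j) ⟩
      (b₁ ⊗ (Q! (suc i) ⊗ Q! j)) ⊗ (const 1ℤ ⊕ ⊝ Qj) ⊕ Qj ⊗ (b₂ ⊗ (Q! i ⊗ Q! (suc j))) ⊗ (const 1ℤ ⊕ ⊝ Qi)
        ≈⟨ ⊕-cong (⊗-cong ih₁ ≈-refl) (⊗-cong (⊗-cong ≈-refl (bin-Q! i (suc j))) ≈-refl) ⟩
      K ⊗ (const 1ℤ ⊕ ⊝ Qj) ⊕ Qj ⊗ K ⊗ (const 1ℤ ⊕ ⊝ Qi)
        ≈⟨ solve 3 (λ k x y → k :* (con 1ℤ :+ :- y) :+ y :* k :* (con 1ℤ :+ :- x) := k :* (con 1ℤ :+ :- (x :* y))) ≈-refl K Qi Qj ⟩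
      K ⊗ (const 1ℤ ⊕ ⊝ (Qi ⊗ Qj)) ≈⟨ ⊗-cong ≈-refl (⊕-cong ≈-refl (⊝-cong (≈-sym (^-homo-* Q (suc i) (suc j))))) ⟩
      K ⊗ (const 1ℤ ⊕ ⊝ Q ^ suc (i ℕ.+ suc j)) ∎
    where
    open ≈-Reasoning
    Qi = Q ^ suc i
    Qj = Q ^ suc j
    K = Q! (i ℕ.+ suc j)
    b₁ = bin (i ℕ.+ suc j) (suc i)
    b₂ = bin (i ℕ.+ suc j) i
    ih₁ : b₁ ⊗ (Q! (suc i) ⊗ Q! j) ≈ K
    ih₁ = subst (λ m → bin m (suc i) ⊗ (Q! (suc i) ⊗ Q! j) ≈ Q! m) (sym (ℕ.+-suc i j)) (bin-Q! (suc i) j)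

  Q!-factor-head : ∀ k → (const 1ℤ ⊕ ⊝ Q ^ suc k) 0 ≡ 1ℤ
  Q!-factor-head k = trans (⊕-at _ _ 0) (cong₂ _+_ (const-zero 1ℤ)
    (trans (⊝-at _ 0) (cong -_ (trans (at (^-assocʳ q (suc d) (suc k)) 0) (q^-at (suc d ℕ.* suc k) 0)))))

  Q!-head : ∀ n → Q! n 0 ≡ 1ℤ
  Q!-head zero = const-zero 1ℤ
  Q!-head (suc n) = ⊗-head1 (Q!-head n) (Q!-factor-head n)

  -- Multiplied by the two factorials, both Pascal rules become the same identity 1 - xy = x(1 - y)
  -- + (1 - x) up to exchanging x and y.
  bin-pascal′ : ∀ i j → bin (suc (i ℕ.+ j)) (suc i) ≈ Q ^ suc i ⊗ bin (i ℕ.+ j) (suc i) ⊕ bin (i ℕ.+ j) i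
  bin-pascal′ i zero rewrite ℕ.+-identityʳ i = ≈-trans (bin-diag (suc i))
    (≈-sym (≈-trans (⊕-cong (⊗-cong ≈-refl (bin-> (ℕ.n<1+n i))) (bin-diag i)) (solve 1 (λ x → x :* con 0ℤ :+ con 1ℤ := con 1ℤ) ≈-refl (Q ^ suc i))))
  bin-pascal′ i (suc j) = ⊗-cancelʳ (Q! (suc i) ⊗ Q! (suc j)) (⊗-head1 (Q!-head (suc i)) (Q!-head (suc j)))
    (≈-trans (bin-Q! (suc i) (suc j)) (≈-sym (begin
      (Qi ⊗ b₁ ⊕ b₂) ⊗ ((Q! i ⊗ (const 1ℤ ⊕ ⊝ Qi)) ⊗ (Q! j ⊗ (const 1ℤ ⊕ ⊝ Qj)))
        ≈⟨ solve 6 (λ b c x y s t → (x :* b :+ c) :* ((s :* (con 1ℤ :+ :- x)) :* (t :* (con 1ℤ :+ :- y)))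
             := x :* (b :* ((s :* (con 1ℤ :+ :- x)) :* t)) :* (con 1ℤ :+ :- y) :+ (c :* (s :* (t :* (con 1ℤ :+ :- y)))) :* (con 1ℤ :+ :- x))
             ≈-refl b₁ b₂ Qi Qj (Q! i) (Q! j) ⟩
      Qi ⊗ (b₁ ⊗ (Q! (suc i) ⊗ Q! j)) ⊗ (const 1ℤ ⊕ ⊝ Qj) ⊕ (b₂ ⊗ (Q! i ⊗ Q! (suc j))) ⊗ (const 1ℤ ⊕ ⊝ Qi)
        ≈⟨ ⊕-cong (⊗-cong (⊗-cong ≈-refl ih₁) ≈-refl) (⊗-cong (bin-Q! i (suc j)) ≈-refl) ⟩
      Qi ⊗ K ⊗ (const 1ℤ ⊕ ⊝ Qj) ⊕ K ⊗ (const 1ℤ ⊕ ⊝ Qi)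
        ≈⟨ solve 3 (λ k x y → x :* k :* (con 1ℤ :+ :- y) :+ k :* (con 1ℤ :+ :- x) := k :* (con 1ℤ :+ :- (x :* y))) ≈-refl K Qi Qj ⟩
      K ⊗ (const 1ℤ ⊕ ⊝ (Qi ⊗ Qj)) ≈⟨ ⊗-cong ≈-refl (⊕-cong ≈-refl (⊝-cong (≈-sym (^-homo-* Q (suc i) (suc j))))) ⟩
      K ⊗ (const 1ℤ ⊕ ⊝ Q ^ suc (i ℕ.+ suc j)) ∎)))
    where
    open ≈-Reasoning
    Qi = Q ^ suc i
    Qj = Q ^ suc j
    K = Q! (i ℕ.+ suc j)
    b₁ = bin (i ℕ.+ suc j) (suc i)
    b₂ = bin (i ℕ.+ suc j) i
    ih₁ : b₁ ⊗ (Q! (suc i) ⊗ Q! j) ≈ K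
    ih₁ = subst (λ m → bin m (suc i) ⊗ (Q! (suc i) ⊗ Q! j) ≈ Q! m) (sym (ℕ.+-suc i j)) (bin-Q! (suc i) j)

  bsum : ℕ → (ℕ → PS) → PS
  bsum M τ = ∑ (suc M) (λ i → bin M i ⊗ τ i)

  bsum-cong : ∀ M {τ τ′} → (∀ i → i ℕ.≤ M → τ i ≈ τ′ i) → bsum M τ ≈ bsum M τ′
  bsum-cong M e = ∑-cong (suc M) (λ { i (s≤s l) → ⊗-cong ≈-refl (e i l) })

  bsum-⊗⊕⊗ : ∀ M c τ c′ τ′ → bsum M (λ i → c ⊗ τ i ⊕ c′ ⊗ τ′ i) ≈ c ⊗ bsum M τ ⊕ c′ ⊗ bsum M τ′
  bsum-⊗⊕⊗ M c τ c′ τ′ = ≈-trans (∑-cong (suc M) (λ i _ → solve 5 (λ b c x c′ x′ → b :* (c :* x :+ c′ :* x′) := c :* (b :* x) :+ c′ :* (b :* x′)) ≈-refl (bin M i) c (τ i) c′ (τ′ i)))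
    (≈-trans (∑-⊕ (suc M) (λ i → c ⊗ (bin M i ⊗ τ i)) (λ i → c′ ⊗ (bin M i ⊗ τ′ i)))
      (⊕-cong (∑-⊗ˡ (suc M) c (λ i → bin M i ⊗ τ i)) (∑-⊗ˡ (suc M) c′ (λ i → bin M i ⊗ τ′ i))))

  bsum-right : ∀ M τ → bsum (suc M) τ ≈ bsum M (λ i → τ i ⊕ Q ^ (M ∸ i) ⊗ τ (suc i))
  bsum-right M τ = begin
    bsum (suc M) τ ≈⟨ ∑-head (suc M) (λ i → bin (suc M) i ⊗ τ i) ⟩
    const 1ℤ ⊗ τ 0 ⊕ ∑ (suc M) (λ i → (bin M (suc i) ⊕ Q ^ (M ∸ i) ⊗ bin M i) ⊗ τ (suc i))
      ≈⟨ ⊕-cong ≈-refl (≈-trans (∑-cong (suc M) (λ i _ → solve 4 (λ b p c t → (b :+ p :* c) :* t := b :* t :+ c :* (p :* t)) ≈-refl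
           (bin M (suc i)) (Q ^ (M ∸ i)) (bin M i) (τ (suc i))))
           (∑-⊕ (suc M) (λ i → bin M (suc i) ⊗ τ (suc i)) (λ i → bin M i ⊗ (Q ^ (M ∸ i) ⊗ τ (suc i))))) ⟩
    const 1ℤ ⊗ τ 0 ⊕ (S ⊕ T) ≈⟨ ⊕-assoc (const 1ℤ ⊗ τ 0) S T ⟨
    (const 1ℤ ⊗ τ 0 ⊕ S) ⊕ T ≈⟨ ⊕-cong (≈-sym (∑-head (suc M) (λ i → bin M i ⊗ τ i))) ≈-refl ⟩
    (bsum M τ ⊕ bin M (suc M) ⊗ τ (suc M)) ⊕ T
      ≈⟨ ⊕-cong (≈-trans (⊕-cong ≈-refl (≈-trans (⊗-cong (bin-> (ℕ.n<1+n M)) ≈-refl) (⊗-zeroˡ (τ (suc M))))) (⊕-identityʳ (bsum M τ))) ≈-refl ⟩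
    bsum M τ ⊕ T ≈⟨ ∑-⊕ (suc M) (λ i → bin M i ⊗ τ i) (λ i → bin M i ⊗ (Q ^ (M ∸ i) ⊗ τ (suc i))) ⟨
    ∑ (suc M) (λ i → bin M i ⊗ τ i ⊕ bin M i ⊗ (Q ^ (M ∸ i) ⊗ τ (suc i)))
      ≈⟨ ∑-cong (suc M) (λ i _ → ⊗-distribˡ-⊕ (bin M i) (τ i) (Q ^ (M ∸ i) ⊗ τ (suc i))) ⟨
    bsum M (λ i → τ i ⊕ Q ^ (M ∸ i) ⊗ τ (suc i)) ∎
    where
    open ≈-Reasoning
    S = ∑ (suc M) (λ i → bin M (suc i) ⊗ τ (suc i))
    T = ∑ (suc M) (λ i → bin M i ⊗ (Q ^ (M ∸ i) ⊗ τ (suc i)))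

  -- The second Pascal rule serves a new factor at the left end, where the origin of the two-sided
  -- sequence moves; `bsum-right` serves the right end.
  bsum-left : ∀ M τ → bsum (suc M) τ ≈ bsum M (λ i → Q ^ i ⊗ τ i ⊕ τ (suc i))
  bsum-left M τ = begin
    bsum (suc M) τ ≈⟨ ∑-head (suc M) (λ i → bin (suc M) i ⊗ τ i) ⟩
    const 1ℤ ⊗ τ 0 ⊕ ∑ (suc M) (λ i → bin (suc M) (suc i) ⊗ τ (suc i))
      ≈⟨ ⊕-cong ≈-refl (≈-trans (∑-cong (suc M) (λ { i (s≤s l) → ≈-trans (⊗-cong (pascal i l) ≈-refl)
           (solve 4 (λ b p c t → (p :* b :+ c) :* t := b :* (p :* t) :+ c :* t) ≈-refl (bin M (suc i)) (Q ^ suc i) (bin M i) (τ (suc i))) }))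
           (∑-⊕ (suc M) (λ i → bin M (suc i) ⊗ (Q ^ suc i ⊗ τ (suc i))) (λ i → bin M i ⊗ τ (suc i)))) ⟩
    const 1ℤ ⊗ τ 0 ⊕ (S ⊕ T) ≈⟨ solve 3 (λ t s u → con 1ℤ :* t :+ (s :+ u) := (con 1ℤ :* (con 1ℤ :* t) :+ s) :+ u) ≈-refl (τ 0) S T ⟩
    (const 1ℤ ⊗ (const 1ℤ ⊗ τ 0) ⊕ S) ⊕ T ≈⟨ ⊕-cong (≈-sym (∑-head (suc M) (λ i → bin M i ⊗ (Q ^ i ⊗ τ i)))) ≈-refl ⟩
    (bsum M (λ i → Q ^ i ⊗ τ i) ⊕ bin M (suc M) ⊗ (Q ^ suc M ⊗ τ (suc M))) ⊕ T
      ≈⟨ ⊕-cong (≈-trans (⊕-cong ≈-refl (≈-trans (⊗-cong (bin-> (ℕ.n<1+n M)) ≈-refl) (⊗-zeroˡ _))) (⊕-identityʳ _)) ≈-refl ⟩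
    bsum M (λ i → Q ^ i ⊗ τ i) ⊕ T ≈⟨ ∑-⊕ (suc M) (λ i → bin M i ⊗ (Q ^ i ⊗ τ i)) (λ i → bin M i ⊗ τ (suc i)) ⟨
    ∑ (suc M) (λ i → bin M i ⊗ (Q ^ i ⊗ τ i) ⊕ bin M i ⊗ τ (suc i))
      ≈⟨ ∑-cong (suc M) (λ i _ → ⊗-distribˡ-⊕ (bin M i) (Q ^ i ⊗ τ i) (τ (suc i))) ⟨
    bsum M (λ i → Q ^ i ⊗ τ i ⊕ τ (suc i)) ∎
    where
    open ≈-Reasoning
    S = ∑ (suc M) (λ i → bin M (suc i) ⊗ (Q ^ suc i ⊗ τ (suc i)))
    T = ∑ (suc M) (λ i → bin M i ⊗ τ (suc i))
    pascal : ∀ i → i ℕ.≤ M → bin (suc M) (suc i) ≈ Q ^ suc i ⊗ bin M (suc i) ⊕ bin M i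
    pascal i l = subst (λ m → bin (suc m) (suc i) ≈ Q ^ suc i ⊗ bin m (suc i) ⊕ bin m i) (ℕ.m+[n∸m]≡n l) (bin-pascal′ i (M ∸ i))

  -- The two-sided sequence …, v 2, v 1, u 0, u 1, u 2, … seen from position −n.
  σ : (ℕ → PS) → (ℕ → PS) → ℕ → ℕ → PS
  σ u v zero    i       = u i
  σ u v (suc n) zero    = v (suc n)
  σ u v (suc n) (suc i) = σ u v n i

  σ-right : ∀ u v n i → σ u v n (n ℕ.+ i) ≡ u i
  σ-right u v zero i = refl
  σ-right u v (suc n) i = σ-right u v n i

  σ-left : ∀ u v {n i} → i ℕ.< n → σ u v n i ≡ v (n ∸ i)
  σ-left u v {suc n} {zero} l = refl
  σ-left u v {suc n} {suc i} (s≤s l) = σ-left u v l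

  ∑-σ : ∀ u v n m → ∑ (n ℕ.+ m) (σ u v n) ≈ ∑ m u ⊕ ∑ n (λ i → v (suc i))
  ∑-σ u v zero m = ≈-sym (⊕-identityʳ (∑ m u))
  ∑-σ u v (suc n) m = ≈-trans (∑-head (n ℕ.+ m) (σ u v (suc n))) (≈-trans (⊕-cong ≈-refl (∑-σ u v n m))
    (solve 3 (λ a b c → a :+ (b :+ c) := b :+ (c :+ a)) ≈-refl (v (suc n)) (∑ m u) (∑ n (λ i → v (suc i)))))

  Q!∞ : PS
  Q!∞ = Π d d

  Q!∞≈[]Q! : ∀ N → Q!∞ ≈[ N ] Q! N
  Q!∞≈[]Q! N = ≈[]-trans (lim≈[]prod (Tame-1-q^ d d) N) (≈⇒≈[] N (prod-cong (λ k → ⊕-cong ≈-refl (⊝-cong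
    (≈-sym (≈-trans (^-assocʳ q (suc d) (suc k)) (≡⇒≈ (cong (q ^_) (ℕ.*-suc (suc d) k))))))) N))

  Q!∞-head : Q!∞ 0 ≡ 1ℤ
  Q!∞-head = lim-head (Tame-1-q^ d d)

  bin-limit : ∀ {K} i j → K ℕ.≤ i → K ℕ.≤ j → bin (i ℕ.+ j) i ⊗ Q!∞ ≈[ K ] const 1ℤ
  bin-limit {K} i j ki kj = ⊗-cancelʳ[] K Q!∞ Q!∞-head (begin
    (bin (i ℕ.+ j) i ⊗ Q!∞) ⊗ Q!∞ ≈⟨ ≈⇒≈[] K (⊗-assoc _ _ _) ⟩
    bin (i ℕ.+ j) i ⊗ (Q!∞ ⊗ Q!∞) ≈⟨ ⊗-cong[] ≈[]-refl (⊗-cong[] (≈[]-weaken ki (Q!∞≈[]Q! i)) (≈[]-weaken kj (Q!∞≈[]Q! j))) ⟩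
    bin (i ℕ.+ j) i ⊗ (Q! i ⊗ Q! j) ≈⟨ ≈⇒≈[] K (bin-Q! i j) ⟩
    Q! (i ℕ.+ j) ≈⟨ ≈[]-weaken (ℕ.≤-trans ki (ℕ.m≤m+n i j)) (≈[]-sym (Q!∞≈[]Q! (i ℕ.+ j))) ⟩
    Q!∞ ≈⟨ ≈⇒≈[] K (≈-sym (⊗-identityˡ Q!∞)) ⟩
    const 1ℤ ⊗ Q!∞ ∎)
    where
    open Mod K

  -- With N = 2K + 1 every index is either at distance at least K from both ends, where `bin-limit`
  -- replaces the binomial times `Q!∞` by 1, or more than K away from the origin, where the term
  -- vanishes modulo q^K.
  bsum-limit : ∀ K u v → (∀ i → K ℕ.< i → u i ≈[ K ] const 0ℤ) → (∀ i → K ℕ.< i → v i ≈[ K ] const 0ℤ) →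
    let N = suc (K ℕ.+ K) in Q!∞ ⊗ bsum (N ℕ.+ N) (σ u v N) ≈[ K ] ∑ N u ⊕ ∑ N (λ i → v (suc i))
  bsum-limit K u v uz vz = begin
    Q!∞ ⊗ bsum (N ℕ.+ N) (σ u v N) ≈⟨ ≈⇒≈[] K (∑-⊗ˡ (suc (N ℕ.+ N)) Q!∞ _) ⟨
    ∑ (suc (N ℕ.+ N)) (λ i → Q!∞ ⊗ (bin (N ℕ.+ N) i ⊗ σ u v N i)) ≈⟨ ∑-cong[] (suc (N ℕ.+ N)) (λ { i (s≤s l) → term i l }) ⟩
    ∑ (suc (N ℕ.+ N)) (σ u v N) ≡⟨ cong (λ m → ∑ m (σ u v N)) (ℕ.+-suc N N) ⟨
    ∑ (N ℕ.+ suc N) (σ u v N) ≈⟨ ≈⇒≈[] K (∑-σ u v N (suc N)) ⟩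
    (∑ N u ⊕ u N) ⊕ ∑ N (λ i → v (suc i)) ≈⟨ ⊕-cong[] (⊕-cong[] ≈[]-refl (uz N (s≤s (ℕ.m≤m+n K K)))) ≈[]-refl ⟩
    (∑ N u ⊕ const 0ℤ) ⊕ ∑ N (λ i → v (suc i)) ≈⟨ ≈⇒≈[] K (⊕-cong (⊕-identityʳ (∑ N u)) ≈-refl) ⟩
    ∑ N u ⊕ ∑ N (λ i → v (suc i)) ∎
    where
    open Mod K
    N = suc (K ℕ.+ K)
    main : ∀ i → i ℕ.≤ N ℕ.+ N → K ℕ.≤ i → K ℕ.≤ N ℕ.+ N ∸ i → Q!∞ ⊗ (bin (N ℕ.+ N) i ⊗ σ u v N i) ≈[ K ] σ u v N i
    main i l k₁ k₂ = ≈[]-trans (≈⇒≈[] K (solve 3 (λ a b c → a :* (b :* c) := (b :* a) :* c) ≈-refl Q!∞ (bin (N ℕ.+ N) i) (σ u v N i)))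
      (≈[]-trans (⊗-cong[] (subst (λ m → bin m i ⊗ Q!∞ ≈[ K ] const 1ℤ) (ℕ.m+[n∸m]≡n l) (bin-limit i (N ℕ.+ N ∸ i) k₁ k₂)) ≈[]-refl)
        (≈⇒≈[] K (⊗-identityˡ (σ u v N i))))
    small : ∀ i → σ u v N i ≈[ K ] const 0ℤ → Q!∞ ⊗ (bin (N ℕ.+ N) i ⊗ σ u v N i) ≈[ K ] σ u v N i
    small i z = ≈[]-trans (⊗-cong[] ≈[]-refl (⊗-cong[] ≈[]-refl z))
      (≈[]-trans (≈⇒≈[] K (solve 2 (λ a b → a :* (b :* con 0ℤ) := con 0ℤ) ≈-refl Q!∞ (bin (N ℕ.+ N) i))) (≈[]-sym z))
    term : ∀ i → i ℕ.≤ N ℕ.+ N → Q!∞ ⊗ (bin (N ℕ.+ N) i ⊗ σ u v N i) ≈[ K ] σ u v N i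
    term i l with ℕ.<-≤-connex i K
    ... | inj₁ i<K = small i (subst (_≈[ K ] const 0ℤ) (sym (σ-left u v (ℕ.<-trans i<K (s≤s (ℕ.m≤m+n K K)))))
        (vz (N ∸ i) (ℕ.≤-trans (ℕ.≤-reflexive (sym (ℕ.m+n∸n≡m (suc K) K))) (ℕ.∸-monoʳ-≤ N (ℕ.<⇒≤ i<K)))))
    ... | inj₂ K≤i with ℕ.<-≤-connex (N ℕ.+ K) i
    ...   | inj₂ i≤N+K = main i l K≤i (ℕ.≤-trans (ℕ.≤-trans (ℕ.n≤1+n K) (ℕ.≤-reflexive (sym eq))) (ℕ.∸-monoʳ-≤ (N ℕ.+ N) i≤N+K))
        where
        eq : (N ℕ.+ N) ∸ (N ℕ.+ K) ≡ suc K
        eq = trans (ℕ.[m+n]∸[m+o]≡n∸o N N K) (ℕ.m+n∸n≡m (suc K) K)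
    ...   | inj₁ N+K<i = small i (subst (_≈[ K ] const 0ℤ) (trans (sym (σ-right u v N (i ∸ N))) (cong (σ u v N) (ℕ.m+[n∸m]≡n N≤i)))
        (uz (i ∸ N) (ℕ.≤-trans (ℕ.≤-reflexive (sym (ℕ.m+n∸m≡n N (suc K)))) (ℕ.∸-monoˡ-≤ N (subst (ℕ._≤ i) (sym (ℕ.+-suc N K)) N+K<i)))))
        where
        N≤i : N ℕ.≤ i
        N≤i = ℕ.≤-trans (ℕ.m≤m+n N K) (ℕ.<⇒≤ N+K<i)

  module TripleProduct (z w : PS) (zw : z ⊗ w ≈ Q) where

    -- The terms (-1)ⁱ zⁱ Q^{i(i-1)/2} of the theta series and their mirror images in w. The
    -- recursive form makes the exchange relations with powers of Q immediate.
    u v : ℕ → PS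
    u zero    = const 1ℤ
    u (suc i) = ⊝ (z ⊗ Q ^ i ⊗ u i)
    v zero    = const 1ℤ
    v (suc i) = ⊝ (w ⊗ Q ^ i ⊗ v i)

    s : ℕ → ℕ → PS
    s = σ u v

    s-left : ∀ n i → Q ^ i ⊗ s (suc n) i ≈ ⊝ (w ⊗ Q ^ n) ⊗ s n i
    s-left zero zero = solve 1 (λ w → con 1ℤ :* (:- (w :* con 1ℤ :* con 1ℤ)) := :- (w :* con 1ℤ) :* con 1ℤ) ≈-refl w
    s-left (suc n) zero = solve 3 (λ w p x → con 1ℤ :* (:- (w :* p :* x)) := :- (w :* p) :* x) ≈-refl w (Q ^ suc n) (v (suc n))
    -- The sequence passes here from its w-side to its z-side, which is where z w = Q enters.
    s-left zero (suc i) = ≈-trans (⊗-cong (⊗-cong (≈-sym zw) ≈-refl) ≈-refl)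
      (solve 4 (λ z w p x → ((z :* w) :* p) :* x := :- (w :* con 1ℤ) :* (:- (z :* p :* x))) ≈-refl z w (Q ^ i) (u i))
    s-left (suc n) (suc i) = ≈-trans (⊗-assoc Q (Q ^ i) (s (suc n) i)) (≈-trans (⊗-cong ≈-refl (s-left n i))
      (solve 4 (λ q w p x → q :* (:- (w :* p) :* x) := :- (w :* (q :* p)) :* x) ≈-refl Q w (Q ^ n) (s n i)))

    u-right : ∀ m i → i ℕ.≤ m → Q ^ (m ∸ i) ⊗ u (suc i) ≈ ⊝ (z ⊗ Q ^ m) ⊗ u i
    u-right m i l = begin
      Q ^ (m ∸ i) ⊗ ⊝ (z ⊗ Q ^ i ⊗ u i)
        ≈⟨ solve 4 (λ a z b x → a :* (:- (z :* b :* x)) := :- (z :* (a :* b)) :* x) ≈-refl (Q ^ (m ∸ i)) z (Q ^ i) (u i) ⟩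
      ⊝ (z ⊗ (Q ^ (m ∸ i) ⊗ Q ^ i)) ⊗ u i ≈⟨ ⊗-cong (⊝-cong (⊗-cong ≈-refl (^-homo-* Q (m ∸ i) i))) ≈-refl ⟨
      ⊝ (z ⊗ Q ^ (m ∸ i ℕ.+ i)) ⊗ u i ≡⟨ cong (λ e → ⊝ (z ⊗ Q ^ e) ⊗ u i) (ℕ.m∸n+n≡m l) ⟩
      ⊝ (z ⊗ Q ^ m) ⊗ u i ∎
      where
      open ≈-Reasoning

    -- Each Pascal rule, combined with the exchange relation at its end, multiplies the sum by one
    -- linear factor: z-factors are added while n = 0, w-factors afterwards.
    tripleProduct : ∀ n m → bsum (n ℕ.+ m) (s n) ≈ P w n ⊗ P z m
    tripleProduct zero zero = solve 0 (con 0ℤ :+ con 1ℤ :* con 1ℤ := con 1ℤ :* con 1ℤ) ≈-refl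
    tripleProduct zero (suc m) = begin
      bsum (suc m) u ≈⟨ bsum-right m u ⟩
      bsum m (λ i → u i ⊕ Q ^ (m ∸ i) ⊗ u (suc i))
        ≈⟨ bsum-cong m (λ i l → ⊕-cong (≈-sym (⊗-identityˡ (u i))) (u-right m i l)) ⟩
      bsum m (λ i → const 1ℤ ⊗ u i ⊕ ⊝ (z ⊗ Q ^ m) ⊗ u i) ≈⟨ bsum-⊗⊕⊗ m (const 1ℤ) u (⊝ (z ⊗ Q ^ m)) u ⟩
      const 1ℤ ⊗ bsum m u ⊕ ⊝ (z ⊗ Q ^ m) ⊗ bsum m u ≈⟨ ⊕-cong (⊗-cong ≈-refl (tripleProduct zero m)) (⊗-cong ≈-refl (tripleProduct zero m)) ⟩
      const 1ℤ ⊗ (const 1ℤ ⊗ P z m) ⊕ ⊝ (z ⊗ Q ^ m) ⊗ (const 1ℤ ⊗ P z m)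
        ≈⟨ solve 2 (λ x p → con 1ℤ :* (con 1ℤ :* p) :+ :- x :* (con 1ℤ :* p) := con 1ℤ :* (p :* (con 1ℤ :+ :- x))) ≈-refl (z ⊗ Q ^ m) (P z m) ⟩
      const 1ℤ ⊗ (P z m ⊗ (const 1ℤ ⊕ ⊝ (z ⊗ Q ^ m))) ∎
      where
      open ≈-Reasoning
    tripleProduct (suc n) m = begin
      bsum (suc (n ℕ.+ m)) (s (suc n)) ≈⟨ bsum-left (n ℕ.+ m) (s (suc n)) ⟩
      bsum (n ℕ.+ m) (λ i → Q ^ i ⊗ s (suc n) i ⊕ s n i)
        ≈⟨ bsum-cong (n ℕ.+ m) (λ i _ → ⊕-cong (s-left n i) (≈-sym (⊗-identityˡ (s n i)))) ⟩
      bsum (n ℕ.+ m) (λ i → ⊝ (w ⊗ Q ^ n) ⊗ s n i ⊕ const 1ℤ ⊗ s n i) ≈⟨ bsum-⊗⊕⊗ (n ℕ.+ m) (⊝ (w ⊗ Q ^ n)) (s n) (const 1ℤ) (s n) ⟩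
      ⊝ (w ⊗ Q ^ n) ⊗ bsum (n ℕ.+ m) (s n) ⊕ const 1ℤ ⊗ bsum (n ℕ.+ m) (s n)
        ≈⟨ ⊕-cong (⊗-cong ≈-refl (tripleProduct n m)) (⊗-cong ≈-refl (tripleProduct n m)) ⟩
      ⊝ (w ⊗ Q ^ n) ⊗ (P w n ⊗ P z m) ⊕ const 1ℤ ⊗ (P w n ⊗ P z m)
        ≈⟨ solve 3 (λ x a b → :- x :* (a :* b) :+ con 1ℤ :* (a :* b) := a :* (con 1ℤ :+ :- x) :* b) ≈-refl (w ⊗ Q ^ n) (P w n) (P z m) ⟩
      P w n ⊗ (const 1ℤ ⊕ ⊝ (w ⊗ Q ^ n)) ⊗ P z m ∎
      where
      open ≈-Reasoning

    -- The terms after applying z d/dz with w = Q/z, which weights a term by its signed index.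
    u′ v′ : ℕ → PS
    u′ i = const (+ i) ⊗ u i
    v′ i = const (- + i) ⊗ v i

    s′ : ℕ → ℕ → PS
    s′ = σ u′ v′

    s′-left : ∀ n i → Q ^ i ⊗ s′ (suc n) i ≈ ⊝ (w ⊗ Q ^ n) ⊗ s′ n i ⊕ (w ⊗ Q ^ n) ⊗ s n i
    s′-left zero zero = solve 1 (λ w → con 1ℤ :* (con (- + 1) :* (:- (w :* con 1ℤ :* con 1ℤ)))
      := :- (w :* con 1ℤ) :* (con 0ℤ :* con 1ℤ) :+ (w :* con 1ℤ) :* con 1ℤ) ≈-refl w
    s′-left (suc n) zero = ≈-trans (⊗-cong ≈-refl (⊗-cong neg-suc ≈-refl))
      (solve 4 (λ c w p x → con 1ℤ :* ((c :+ :- con 1ℤ) :* (:- (w :* p :* x))) := :- (w :* p) :* (c :* x) :+ (w :* p) :* x) ≈-refl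
        (const (- + suc n)) w (Q ^ suc n) (v (suc n)))
      where
      neg-suc : const (- + suc (suc n)) ≈ const (- + suc n) ⊕ ⊝ const 1ℤ
      neg-suc = ≈-trans (≡⇒≈ (cong const (trans (cong -_ (ℤ.+-comm 1ℤ (+ suc n))) (ℤ.neg-distrib-+ (+ suc n) 1ℤ))))
        (≈-trans (const-⊕ (- + suc n) (- 1ℤ)) (⊕-cong ≈-refl (const-⊝ 1ℤ)))
    s′-left zero (suc i) = ≈-trans (⊗-cong (⊗-cong (≈-sym zw) ≈-refl) ≈-refl)
      (≈-trans (solve 5 (λ z w p c x → ((z :* w) :* p) :* (c :* x) := :- (w :* con 1ℤ) :* ((con 1ℤ :+ c) :* (:- (z :* p :* x))) :+ (w :* con 1ℤ) :* (:- (z :* p :* x))) ≈-refl z w (Q ^ i) (const (+ i)) (u i))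
        (⊕-cong (⊗-cong ≈-refl (⊗-cong (≈-sym (const-⊕ 1ℤ (+ i))) ≈-refl)) ≈-refl))
    s′-left (suc n) (suc i) = ≈-trans (⊗-assoc Q (Q ^ i) (s′ (suc n) i)) (≈-trans (⊗-cong ≈-refl (s′-left n i))
      (solve 5 (λ q w p x y → q :* (:- (w :* p) :* x :+ (w :* p) :* y) := :- (w :* (q :* p)) :* x :+ (w :* (q :* p)) :* y) ≈-refl Q w (Q ^ n) (s′ n i) (s n i)))

    -- The Leibniz rule for the new factor 1 - wQⁿ: as w = Q/z, applying z d/dz to that factor gives
    -- + wQⁿ.
    bsum-s′-left : ∀ n m → bsum (suc n ℕ.+ m) (s′ (suc n)) ≈ (const 1ℤ ⊕ ⊝ (w ⊗ Q ^ n)) ⊗ bsum (n ℕ.+ m) (s′ n) ⊕ (w ⊗ Q ^ n) ⊗ (P w n ⊗ P z m)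
    bsum-s′-left n m = begin
      bsum (suc (n ℕ.+ m)) (s′ (suc n)) ≈⟨ bsum-left (n ℕ.+ m) (s′ (suc n)) ⟩
      bsum (n ℕ.+ m) (λ i → Q ^ i ⊗ s′ (suc n) i ⊕ s′ n i)
        ≈⟨ bsum-cong (n ℕ.+ m) (λ i _ → ≈-trans (⊕-cong (s′-left n i) ≈-refl)
             (solve 3 (λ x a b → (:- x :* a :+ x :* b) :+ a := (con 1ℤ :+ :- x) :* a :+ x :* b) ≈-refl (w ⊗ Q ^ n) (s′ n i) (s n i))) ⟩
      bsum (n ℕ.+ m) (λ i → (const 1ℤ ⊕ ⊝ (w ⊗ Q ^ n)) ⊗ s′ n i ⊕ (w ⊗ Q ^ n) ⊗ s n i)
        ≈⟨ bsum-⊗⊕⊗ (n ℕ.+ m) (const 1ℤ ⊕ ⊝ (w ⊗ Q ^ n)) (s′ n) (w ⊗ Q ^ n) (s n) ⟩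
      (const 1ℤ ⊕ ⊝ (w ⊗ Q ^ n)) ⊗ bsum (n ℕ.+ m) (s′ n) ⊕ (w ⊗ Q ^ n) ⊗ bsum (n ℕ.+ m) (s n)
        ≈⟨ ⊕-cong ≈-refl (⊗-cong ≈-refl (tripleProduct n m)) ⟩
      (const 1ℤ ⊕ ⊝ (w ⊗ Q ^ n)) ⊗ bsum (n ℕ.+ m) (s′ n) ⊕ (w ⊗ Q ^ n) ⊗ (P w n ⊗ P z m) ∎
      where
      open ≈-Reasoning

    bsum-u′-right : ∀ m → bsum (suc m) u′ ≈ (const 1ℤ ⊕ ⊝ (z ⊗ Q ^ m)) ⊗ bsum m u′ ⊕ ⊝ (z ⊗ Q ^ m) ⊗ P z m
    bsum-u′-right m = begin
      bsum (suc m) u′ ≈⟨ bsum-right m u′ ⟩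
      bsum m (λ i → u′ i ⊕ Q ^ (m ∸ i) ⊗ u′ (suc i)) ≈⟨ bsum-cong m step ⟩
      bsum m (λ i → (const 1ℤ ⊕ ⊝ (z ⊗ Q ^ m)) ⊗ u′ i ⊕ ⊝ (z ⊗ Q ^ m) ⊗ u i)
        ≈⟨ bsum-⊗⊕⊗ m (const 1ℤ ⊕ ⊝ (z ⊗ Q ^ m)) u′ (⊝ (z ⊗ Q ^ m)) u ⟩
      (const 1ℤ ⊕ ⊝ (z ⊗ Q ^ m)) ⊗ bsum m u′ ⊕ ⊝ (z ⊗ Q ^ m) ⊗ bsum m u
        ≈⟨ ⊕-cong ≈-refl (⊗-cong ≈-refl (≈-trans (tripleProduct zero m) (⊗-identityˡ (P z m)))) ⟩
      (const 1ℤ ⊕ ⊝ (z ⊗ Q ^ m)) ⊗ bsum m u′ ⊕ ⊝ (z ⊗ Q ^ m) ⊗ P z m ∎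
      where
      open ≈-Reasoning
      step : ∀ i → i ℕ.≤ m → u′ i ⊕ Q ^ (m ∸ i) ⊗ u′ (suc i) ≈ (const 1ℤ ⊕ ⊝ (z ⊗ Q ^ m)) ⊗ u′ i ⊕ ⊝ (z ⊗ Q ^ m) ⊗ u i
      step i l = begin
        u′ i ⊕ Q ^ (m ∸ i) ⊗ (const (+ suc i) ⊗ u (suc i))
          ≈⟨ ⊕-cong ≈-refl (⊗-cong ≈-refl (⊗-cong (const-⊕ 1ℤ (+ i)) ≈-refl)) ⟩
        u′ i ⊕ Q ^ (m ∸ i) ⊗ ((const 1ℤ ⊕ const (+ i)) ⊗ u (suc i))
          ≈⟨ solve 4 (λ a p c x → a :+ p :* ((con 1ℤ :+ c) :* x) := a :+ (con 1ℤ :+ c) :* (p :* x)) ≈-refl (u′ i) (Q ^ (m ∸ i)) (const (+ i)) (u (suc i)) ⟩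
        u′ i ⊕ (const 1ℤ ⊕ const (+ i)) ⊗ (Q ^ (m ∸ i) ⊗ u (suc i)) ≈⟨ ⊕-cong ≈-refl (⊗-cong ≈-refl (u-right m i l)) ⟩
        const (+ i) ⊗ u i ⊕ (const 1ℤ ⊕ const (+ i)) ⊗ (⊝ (z ⊗ Q ^ m) ⊗ u i)
          ≈⟨ solve 3 (λ c y x → c :* x :+ (con 1ℤ :+ c) :* (:- y :* x) := (con 1ℤ :+ :- y) :* (c :* x) :+ :- y :* x) ≈-refl (const (+ i)) (z ⊗ Q ^ m) (u i) ⟩
        (const 1ℤ ⊕ ⊝ (z ⊗ Q ^ m)) ⊗ u′ i ⊕ ⊝ (z ⊗ Q ^ m) ⊗ u i ∎

-- Sums over intervals of ℕ and ℤ

Σ< : ℕ → (ℕ → ℤ) → ℤ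
Σ< zero    f = 0ℤ
Σ< (suc n) f = Σ< n f + f n

Σ<-cong : ∀ n {f g} → (∀ i → f i ≡ g i) → Σ< n f ≡ Σ< n g
Σ<-cong zero e = refl
Σ<-cong (suc n) e = cong₂ _+_ (Σ<-cong n e) (e n)

Σ<-0 : ∀ n → Σ< n (λ _ → 0ℤ) ≡ 0ℤ
Σ<-0 zero = refl
Σ<-0 (suc n) = trans (ℤ.+-identityʳ _) (Σ<-0 n)

interchange : ∀ a b c d → (a + b) + (c + d) ≡ (a + c) + (b + d)
interchange = solve-∀

Σ<-+ : ∀ n f g → Σ< n (λ i → f i + g i) ≡ Σ< n f + Σ< n g
Σ<-+ zero f g = refl
Σ<-+ (suc n) f g = trans (cong (_+ (f n + g n)) (Σ<-+ n f g)) (interchange (Σ< n f) (Σ< n g) (f n) (g n))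

Σ<-* : ∀ n c f → Σ< n (λ i → c * f i) ≡ c * Σ< n f
Σ<-* zero c f = sym (ℤ.*-zeroʳ c)
Σ<-* (suc n) c f = trans (cong (_+ c * f n) (Σ<-* n c f)) (sym (ℤ.*-distribˡ-+ c (Σ< n f) (f n)))

Σ<-swap : ∀ m n (f : ℕ → ℕ → ℤ) → Σ< m (λ i → Σ< n (f i)) ≡ Σ< n (λ j → Σ< m (λ i → f i j))
Σ<-swap zero n f = sym (Σ<-0 n)
Σ<-swap (suc m) n f = trans (cong (_+ Σ< n (f m)) (Σ<-swap m n f)) (sym (Σ<-+ n (λ j → Σ< m (λ i → f i j)) (f m)))

Σ<-ext : ∀ B d f → (∀ i → B ℕ.≤ i → f i ≡ 0ℤ) → Σ< (d ℕ.+ B) f ≡ Σ< B f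
Σ<-ext B zero f z = refl
Σ<-ext B (suc d) f z = trans (cong₂ _+_ (Σ<-ext B d f z) (z (d ℕ.+ B) (ℕ.m≤n+m B d))) (ℤ.+-identityʳ _)

Σ<-head : ∀ n f → Σ< (suc n) f ≡ f 0 + Σ< n (λ i → f (suc i))
Σ<-head zero f = ℤ.+-comm 0ℤ (f 0)
Σ<-head (suc n) f = trans (cong (_+ f (suc n)) (Σ<-head n f)) (ℤ.+-assoc (f 0) (Σ< n (λ i → f (suc i))) (f (suc n)))

Σ<-split5 : ∀ n f → Σ< (n ℕ.* 5) f ≡ Σ< n (λ i → f (0 ℕ.+ i ℕ.* 5)) + Σ< n (λ i → f (1 ℕ.+ i ℕ.* 5)) + Σ< n (λ i → f (2 ℕ.+ i ℕ.* 5)) + Σ< n (λ i → f (3 ℕ.+ i ℕ.* 5)) + Σ< n (λ i → f (4 ℕ.+ i ℕ.* 5))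
Σ<-split5 zero f = refl
Σ<-split5 (suc n) f = trans (cong (λ s → s + f (n ℕ.* 5) + f (1 ℕ.+ n ℕ.* 5) + f (2 ℕ.+ n ℕ.* 5) + f (3 ℕ.+ n ℕ.* 5) + f (4 ℕ.+ n ℕ.* 5)) (Σ<-split5 n f))
  (rearrange (Σ< n (λ i → f (0 ℕ.+ i ℕ.* 5))) (Σ< n (λ i → f (1 ℕ.+ i ℕ.* 5))) (Σ< n (λ i → f (2 ℕ.+ i ℕ.* 5))) (Σ< n (λ i → f (3 ℕ.+ i ℕ.* 5))) (Σ< n (λ i → f (4 ℕ.+ i ℕ.* 5)))
    (f (n ℕ.* 5)) (f (1 ℕ.+ n ℕ.* 5)) (f (2 ℕ.+ n ℕ.* 5)) (f (3 ℕ.+ n ℕ.* 5)) (f (4 ℕ.+ n ℕ.* 5)))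
  where
  rearrange : ∀ a b c d e a′ b′ c′ d′ e′ → a + b + c + d + e + a′ + b′ + c′ + d′ + e′
    ≡ (a + a′) + (b + b′) + (c + c′) + (d + d′) + (e + e′)
  rearrange = solve-∀

-- The range -M ≤ k < M is stable under k ↦ -1 - k, the reflection through which the later
-- symmetries are expressed.
sumℤ : ℕ → (ℤ → ℤ) → ℤ
sumℤ M f = Σ< M (λ i → f (+ i)) + Σ< M (λ i → f -[1+ i ])

sumℤ-cong : ∀ M {f g} → (∀ k → f k ≡ g k) → sumℤ M f ≡ sumℤ M g
sumℤ-cong M e = cong₂ _+_ (Σ<-cong M (λ i → e (+ i))) (Σ<-cong M (λ i → e -[1+ i ]))

sumℤ-zero : ∀ M {f} → (∀ k → f k ≡ 0ℤ) → sumℤ M f ≡ 0ℤ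
sumℤ-zero M z = trans (sumℤ-cong M z) (cong₂ _+_ (Σ<-0 M) (Σ<-0 M))

sumℤ-+ : ∀ M f g → sumℤ M (λ k → f k + g k) ≡ sumℤ M f + sumℤ M g
sumℤ-+ M f g = trans (cong₂ _+_ (Σ<-+ M (λ i → f (+ i)) (λ i → g (+ i))) (Σ<-+ M (λ i → f -[1+ i ]) (λ i → g -[1+ i ])))
  (interchange (Σ< M (λ i → f (+ i))) (Σ< M (λ i → g (+ i))) (Σ< M (λ i → f -[1+ i ])) (Σ< M (λ i → g -[1+ i ])))

sumℤ-* : ∀ M c f → sumℤ M (λ k → c * f k) ≡ c * sumℤ M f
sumℤ-* M c f = trans (cong₂ _+_ (Σ<-* M c (λ i → f (+ i))) (Σ<-* M c (λ i → f -[1+ i ]))) (sym (ℤ.*-distribˡ-+ c (Σ< M (λ i → f (+ i))) (Σ< M (λ i → f -[1+ i ]))))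

sumℤ-neg : ∀ M f → sumℤ M (λ k → - f k) ≡ - sumℤ M f
sumℤ-neg M f = trans (sumℤ-cong M (λ k → sym (ℤ.-1*i≡-i (f k)))) (trans (sumℤ-* M -1ℤ f) (ℤ.-1*i≡-i (sumℤ M f)))

sumℤ-Σ< : ∀ m M (f : ℕ → ℤ → ℤ) → Σ< m (λ i → sumℤ M (f i)) ≡ sumℤ M (λ k → Σ< m (λ i → f i k))
sumℤ-Σ< m M f = trans (Σ<-+ m (λ i → Σ< M (λ j → f i (+ j))) (λ i → Σ< M (λ j → f i -[1+ j ])))
  (cong₂ _+_ (Σ<-swap m M (λ i j → f i (+ j))) (Σ<-swap m M (λ i j → f i -[1+ j ])))

sumℤ-swap : ∀ M N (f : ℤ → ℤ → ℤ) → sumℤ M (λ x → sumℤ N (λ y → f x y)) ≡ sumℤ N (λ y → sumℤ M (λ x → f x y))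
sumℤ-swap M N f = trans (cong₂ _+_ (sumℤ-Σ< M N (λ i y → f (+ i) y)) (sumℤ-Σ< M N (λ i y → f -[1+ i ] y)))
  (sym (sumℤ-+ N (λ y → Σ< M (λ i → f (+ i) y)) (λ y → Σ< M (λ i → f -[1+ i ] y))))

sumℤ-reflect : ∀ M f → sumℤ M (λ k → f (-1ℤ - k)) ≡ sumℤ M f
sumℤ-reflect M f = trans (cong₂ _+_ (Σ<-cong M (λ { zero → refl ; (suc i) → refl })) (Σ<-cong M (λ i → refl)))
  (ℤ.+-comm (Σ< M (λ i → f -[1+ i ])) (Σ< M (λ i → f (+ i))))

sumℤ-odd : ∀ M f → (∀ k → f (-1ℤ - k) ≡ - f k) → sumℤ M f ≡ 0ℤ
sumℤ-odd M f odd = i≡-i⇒i≡0 (trans (sym (sumℤ-reflect M f)) (trans (sumℤ-cong M odd) (sumℤ-neg M f)))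
  where
  i≡-i⇒i≡0 : ∀ {i} → i ≡ - i → i ≡ 0ℤ
  i≡-i⇒i≡0 {+ zero} e = refl
  i≡-i⇒i≡0 {+ suc n} ()
  i≡-i⇒i≡0 { -[1+ n ] } ()

Supp : ℕ → (ℤ → ℤ) → Set
Supp B f = ∀ k → B ℕ.≤ ∣ k ∣ → f k ≡ 0ℤ

sumℤ-ext : ∀ {B M} f → Supp B f → B ℕ.≤ M → sumℤ M f ≡ sumℤ B f
sumℤ-ext {B} {M} f z le = trans (cong (λ m → sumℤ m f) (sym (ℕ.m∸n+n≡m le)))
  (cong₂ _+_ (Σ<-ext B (M ∸ B) (λ i → f (+ i)) (λ i l → z (+ i) l)) (Σ<-ext B (M ∸ B) (λ i → f -[1+ i ]) (λ i l → z -[1+ i ] (ℕ.m≤n⇒m≤1+n l))))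

∣k∣≤∣a∣+∣a+k∣ : ∀ a k → ∣ k ∣ ℕ.≤ ∣ a ∣ ℕ.+ ∣ a + k ∣
∣k∣≤∣a∣+∣a+k∣ a k = ℕ.≤-trans (ℕ.≤-reflexive (cong ∣_∣ (sym (cancel a k))))
    (ℕ.≤-trans (ℤ.∣i+j∣≤∣i∣+∣j∣ (- a) (a + k)) (ℕ.≤-reflexive (cong (ℕ._+ ∣ a + k ∣) (ℤ.∣-i∣≡∣i∣ a))))
  where
  cancel : ∀ a k → - a + (a + k) ≡ k
  cancel = solve-∀

Supp-shift : ∀ {B f} a → Supp B f → Supp (∣ a ∣ ℕ.+ B) (λ k → f (a + k))
Supp-shift {B} a z k l = z (a + k) (ℕ.+-cancelˡ-≤ (∣ a ∣) B (∣ a + k ∣) (ℕ.≤-trans l (∣k∣≤∣a∣+∣a+k∣ a k)))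

sumℤ-shift1 : ∀ {B M} f → Supp B f → B ℕ.≤ M → sumℤ M (λ k → f (1ℤ + k)) ≡ sumℤ M f
sumℤ-shift1 {B} {M} f z le = begin
    Σ< M (λ i → f (+ suc i)) + Σ< M (λ i → f (1ℤ + -[1+ i ]))
      ≡⟨ cong (λ s → Σ< M (λ i → f (+ suc i)) + s) (Σ<-cong M (λ { zero → refl ; (suc i) → refl })) ⟩
    a + b ≡⟨ shuffle a b (f 0ℤ) (f (- (+ M))) ⟩
    (f 0ℤ + a) + (b + f (- (+ M)) - f 0ℤ) - f (- (+ M))
      ≡⟨ cong₂ (λ x y → x + (y - f 0ℤ) - f (- (+ M))) (sym (Σ<-head M (λ i → f (+ i)))) (Σ<-head M (λ i → f (- (+ i)))) ⟩
    (Σ< M (λ i → f (+ i)) + f (+ M)) + ((f 0ℤ + Σ< M (λ i → f -[1+ i ])) - f 0ℤ) - f (- (+ M))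
      ≡⟨ cong₂ (λ x y → (Σ< M (λ i → f (+ i)) + x) + ((f 0ℤ + Σ< M (λ i → f -[1+ i ])) - f 0ℤ) - y) (z (+ M) le) (z (- (+ M)) (ℕ.≤-trans le (ℕ.≤-reflexive (sym (ℤ.∣-i∣≡∣i∣ (+ M)))))) ⟩
    (Σ< M (λ i → f (+ i)) + 0ℤ) + ((f 0ℤ + Σ< M (λ i → f -[1+ i ])) - f 0ℤ) - 0ℤ
      ≡⟨ cancel (Σ< M (λ i → f (+ i))) (f 0ℤ) (Σ< M (λ i → f -[1+ i ])) ⟩
    Σ< M (λ i → f (+ i)) + Σ< M (λ i → f -[1+ i ]) ∎
  where
  open ≡.≡-Reasoning
  a = Σ< M (λ i → f (+ suc i))
  b = Σ< M (λ i → f (- (+ i)))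
  shuffle : ∀ a b c d → a + b ≡ (c + a) + (b + d - c) - d
  shuffle = solve-∀
  cancel : ∀ a b c → (a + 0ℤ) + ((b + c) - b) - 0ℤ ≡ a + c
  cancel = solve-∀

sumℤ-shift⁺ : ∀ n {B M} f → Supp B f → n ℕ.+ B ℕ.≤ M → sumℤ M (λ k → f (+ n + k)) ≡ sumℤ M f
sumℤ-shift⁺ zero {M = M} f z le = sumℤ-cong M (λ k → cong f (ℤ.+-identityˡ k))
sumℤ-shift⁺ (suc n) {B} {M} f z le = trans (sumℤ-cong M (λ k → cong f (ℤ.+-assoc 1ℤ (+ n) k)))
  (trans (sumℤ-shift⁺ n (λ k → f (1ℤ + k)) (Supp-shift 1ℤ z) (ℕ.≤-trans (ℕ.≤-reflexive (ℕ.+-suc n B)) le))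
    (sumℤ-shift1 f z (ℕ.≤-trans (ℕ.m≤n+m B (suc n)) le)))

sumℤ-shift : ∀ a {B M} f → Supp B f → ∣ a ∣ ℕ.+ (∣ a ∣ ℕ.+ B) ℕ.≤ M → sumℤ M (λ k → f (a + k)) ≡ sumℤ M f
sumℤ-shift (+ n) {B} f z le = sumℤ-shift⁺ n f z (ℕ.≤-trans (ℕ.m≤n+m (n ℕ.+ B) n) le)
sumℤ-shift -[1+ n ] {B} {M} f z le = sym (trans (sumℤ-cong M (λ k → cong f (sym (cancel (+ suc n) k))))
    (sumℤ-shift⁺ (suc n) (λ k → f (-[1+ n ] + k)) (Supp-shift -[1+ n ] z) le))
  where
  cancel : ∀ a k → - a + (a + k) ≡ k
  cancel = solve-∀

sumℤ-flip : ∀ a {B M} f → Supp B f → ∣ 1ℤ + a ∣ ℕ.+ (∣ 1ℤ + a ∣ ℕ.+ B) ℕ.≤ M → sumℤ M (λ k → f (a - k)) ≡ sumℤ M f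
sumℤ-flip a {M = M} f z le = trans (sumℤ-cong M (λ k → cong f (eq a k)))
    (trans (sumℤ-reflect M (λ k → f ((1ℤ + a) + k))) (sumℤ-shift (1ℤ + a) f z le))
  where
  eq : ∀ a k → a - k ≡ (1ℤ + a) + (-1ℤ - k)
  eq = solve-∀

sum5 : (ℕ → ℤ) → ℤ
sum5 g = g 0 + g 1 + g 2 + g 3 + g 4

sum5-cong : ∀ {g h} → (∀ c → c ℕ.≤ 4 → g c ≡ h c) → sum5 g ≡ sum5 h
sum5-cong e = cong₂ _+_ (cong₂ _+_ (cong₂ _+_ (cong₂ _+_ (e 0 z≤n) (e 1 (s≤s z≤n))) (e 2 (s≤s (s≤s z≤n)))) (e 3 (s≤s (s≤s (s≤s z≤n))))) (e 4 (s≤s (s≤s (s≤s (s≤s z≤n)))))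

sumℤ-sum5 : ∀ M (f : ℕ → ℤ → ℤ) → sumℤ M (λ k → sum5 (λ c → f c k)) ≡ sum5 (λ c → sumℤ M (f c))
sumℤ-sum5 M f = trans (sumℤ-+ M (λ k → f 0 k + f 1 k + f 2 k + f 3 k) (f 4)) (cong (_+ sumℤ M (f 4)) (trans (sumℤ-+ M (λ k → f 0 k + f 1 k + f 2 k) (f 3)) (cong (_+ sumℤ M (f 3))
  (trans (sumℤ-+ M (λ k → f 0 k + f 1 k) (f 2)) (cong (_+ sumℤ M (f 2)) (sumℤ-+ M (f 0) (f 1)))))))

-- A negative index -1 - (c + 5i) equals (4 - c) + 5(-1 - i), so residue c on the negative half
-- joins residue 4 - c on the other; `pm` performs this pairing.
sumℤ-split5 : ∀ M f → sumℤ (M ℕ.* 5) f ≡ sum5 (λ c → sumℤ M (λ t → f (+ c + t * + 5)))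
sumℤ-split5 M f = trans (cong₂ _+_ (Σ<-split5 M (λ i → f (+ i))) (Σ<-split5 M (λ i → f -[1+ i ])))
  (trans (regroup (p 0) (p 1) (p 2) (p 3) (p 4) (m 0) (m 1) (m 2) (m 3) (m 4))
    (cong₂ _+_ (cong₂ _+_ (cong₂ _+_ (cong₂ _+_ (pm 0 4 refl) (pm 1 3 refl)) (pm 2 2 refl)) (pm 3 1 refl)) (pm 4 0 refl)))
  where
  p m : ℕ → ℤ
  p c = Σ< M (λ i → f (+ (c ℕ.+ i ℕ.* 5)))
  m c = Σ< M (λ i → f -[1+ (c ℕ.+ i ℕ.* 5) ])
  regroup : ∀ a b c d e a′ b′ c′ d′ e′ → (a + b + c + d + e) + (a′ + b′ + c′ + d′ + e′)
    ≡ (a + e′) + (b + d′) + (c + c′) + (d + b′) + (e + a′)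
  regroup = solve-∀
  neg : ∀ c i d → c + (- (1ℤ + i)) * (1ℤ + (c + d)) ≡ - (1ℤ + (d + i * (1ℤ + (c + d))))
  neg = solve-∀
  pm : ∀ c c′ → c ℕ.+ c′ ≡ 4 → p c + m c′ ≡ sumℤ M (λ t → f (+ c + t * + 5))
  pm c c′ e = cong₂ _+_
    (Σ<-cong M (λ i → cong f (trans (ℤ.pos-+ c (i ℕ.* 5)) (cong (λ x → + c + x) (ℤ.pos-* i 5)))))
    (Σ<-cong M (λ i → cong f (sym (trans (cong (λ n → + c + -[1+ i ] * (1ℤ + n)) (trans (cong +_ (sym e)) (ℤ.pos-+ c c′)))
      (trans (neg (+ c) (+ i) (+ c′)) (cong (λ n → - (1ℤ + n)) (trans (cong (λ n → + c′ + + i * (1ℤ + n)) (trans (sym (ℤ.pos-+ c c′)) (cong +_ e)))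
        (trans (cong (λ x → + c′ + x) (sym (ℤ.pos-* i 5))) (sym (ℤ.pos-+ c′ (i ℕ.* 5)))))))))))

sumℤ² : ℕ → (ℤ → ℤ → ℤ) → ℤ
sumℤ² M f = sumℤ M (λ x → sumℤ M (f x))

sumℤ²-cong : ∀ M {f g} → (∀ x y → f x y ≡ g x y) → sumℤ² M f ≡ sumℤ² M g
sumℤ²-cong M e = sumℤ-cong M (λ x → sumℤ-cong M (e x))

sumℤ²-swap : ∀ M f → sumℤ² M f ≡ sumℤ² M (λ x y → f y x)
sumℤ²-swap M f = sumℤ-swap M M f

sumℤ²-+ : ∀ M f g → sumℤ² M (λ x y → f x y + g x y) ≡ sumℤ² M f + sumℤ² M g
sumℤ²-+ M f g = trans (sumℤ-cong M (λ x → sumℤ-+ M (f x) (g x))) (sumℤ-+ M (λ x → sumℤ M (f x)) (λ x → sumℤ M (g x)))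

sumℤ²-* : ∀ M c f → sumℤ² M (λ x y → c * f x y) ≡ c * sumℤ² M f
sumℤ²-* M c f = trans (sumℤ-cong M (λ x → sumℤ-* M c (f x))) (sumℤ-* M c (λ x → sumℤ M (f x)))

Supp² : ℕ → (ℤ → ℤ → ℤ) → Set
Supp² B f = ∀ x y → B ℕ.≤ ∣ x ∣ ⊎ B ℕ.≤ ∣ y ∣ → f x y ≡ 0ℤ

-- The substitution has determinant 1 and is carried out one variable at a time: the shift y = u -
-- x, followed by the flip x = 2u - w. With B = C + 1, nonzero terms have |u| < 2B, so the flip
-- displaces by at most 1 + 4B; room for twice this plus B stays below 11B.
sumℤ²-shear : ∀ {C M} g → Supp² (suc C) g → 11 ℕ.* suc C ℕ.≤ M →
  sumℤ² M g ≡ sumℤ² M (λ u w → g (+ 2 * u - w) (w - u))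
sumℤ²-shear {C} {M} g z le = begin
    sumℤ² M g ≡⟨ sumℤ-cong M inner ⟩
    sumℤ M (λ x → sumℤ M (λ u → g x (- x + u))) ≡⟨ sumℤ-swap M M (λ x u → g x (- x + u)) ⟩
    sumℤ M (λ u → sumℤ M (λ x → g x (- x + u))) ≡⟨ sumℤ-cong M outer ⟩
    sumℤ² M (λ u w → g (+ 2 * u - w) (w - u)) ∎
  where
  open ≡.≡-Reasoning
  B = suc C
  inner : ∀ x → sumℤ M (g x) ≡ sumℤ M (λ u → g x (- x + u))
  inner x with ℕ.<-≤-connex (∣ x ∣) B
  ... | inj₂ big = trans (sumℤ-zero M (λ y → z x y (inj₁ big))) (sym (sumℤ-zero M (λ y → z x (- x + y) (inj₁ big))))
  ... | inj₁ small = sym (sumℤ-shift (- x) (g x) (λ y l → z x y (inj₂ l)) bound)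
    where
    bound : ∣ - x ∣ ℕ.+ (∣ - x ∣ ℕ.+ B) ℕ.≤ M
    bound rewrite ℤ.∣-i∣≡∣i∣ x = ℕ.≤-trans (ℕ.+-mono-≤ (ℕ.<⇒≤ small) (ℕ.+-monoˡ-≤ B (ℕ.<⇒≤ small)))
      (ℕ.≤-trans (ℕ.+-monoʳ-≤ B (ℕ.+-monoʳ-≤ B (ℕ.m≤m+n B (8 ℕ.* B)))) le)
  outer : ∀ u → sumℤ M (λ x → g x (- x + u)) ≡ sumℤ M (λ w → g (+ 2 * u - w) (w - u))
  outer u = trans (main (ℕ.<-≤-connex (∣ u ∣) (B ℕ.+ B))) (sumℤ-cong M (λ w → cong (g (+ 2 * u - w)) (eq u w)))
    where
    eq : ∀ u w → - (+ 2 * u - w) + u ≡ w - u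
    eq = solve-∀
    h : ℤ → ℤ
    h x = g x (- x + u)
    h-supp : Supp B h
    h-supp x l = z x (- x + u) (inj₁ l)
    main : ∣ u ∣ ℕ.< B ℕ.+ B ⊎ B ℕ.+ B ℕ.≤ ∣ u ∣ → sumℤ M h ≡ sumℤ M (λ w → h (+ 2 * u - w))
    main (inj₁ small) = sym (sumℤ-flip (+ 2 * u) h h-supp
        (ℕ.≤-trans (ℕ.+-mono-≤ b (ℕ.+-monoˡ-≤ B b)) (ℕ.≤-trans (ℕ.≤-trans (ℕ.m≤m+n _ (2 ℕ.* C)) (ℕ.≤-reflexive (count C))) le)))
      where
      b : ∣ 1ℤ + + 2 * u ∣ ℕ.≤ 1 ℕ.+ 2 ℕ.* (B ℕ.+ B)
      b = ℕ.≤-trans (ℤ.∣i+j∣≤∣i∣+∣j∣ 1ℤ (+ 2 * u)) (ℕ.+-monoʳ-≤ 1 (ℕ.≤-trans (ℕ.≤-reflexive (ℤ.abs-* (+ 2) u)) (ℕ.*-monoʳ-≤ 2 (ℕ.<⇒≤ small))))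
      count : ∀ C → (1 ℕ.+ 2 ℕ.* (suc C ℕ.+ suc C)) ℕ.+ ((1 ℕ.+ 2 ℕ.* (suc C ℕ.+ suc C)) ℕ.+ suc C) ℕ.+ 2 ℕ.* C ≡ 11 ℕ.* suc C
      count = solveℕ-∀
    main (inj₂ big) = trans (sumℤ-zero M hz) (sym (sumℤ-zero M (λ w → hz (+ 2 * u - w))))
      where
      hz : ∀ x → h x ≡ 0ℤ
      hz x with ℕ.<-≤-connex (∣ x ∣) B
      ... | inj₂ l = h-supp x l
      ... | inj₁ l = z x (- x + u) (inj₂ (ℕ.+-cancelˡ-≤ B B _ (ℕ.≤-trans big (ℕ.≤-trans (∣k∣≤∣a∣+∣a+k∣ (- x) u)
        (ℕ.+-monoˡ-≤ (∣ - x + u ∣) (ℕ.≤-trans (ℕ.≤-reflexive (ℤ.∣-i∣≡∣i∣ x)) (ℕ.<⇒≤ l)))))))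

-- Controls the support after the substitution y = 3x + c + 5t: here 5|t| is at least 10B + 10,
-- while |3x + c| is at most 3B + 4.
far : ∀ {B x t c} → ∣ x ∣ ℕ.≤ B → c ℕ.≤ 4 → suc (suc (B ℕ.+ B)) ℕ.≤ ∣ t ∣ → suc B ℕ.≤ ∣ + 3 * x + (+ c + t * + 5) ∣
far {B} {x} {t} {c} small c≤4 l = ℕ.+-cancelˡ-≤ (3 ℕ.* B ℕ.+ 4) (suc B) (∣ y ∣) (begin
    3 ℕ.* B ℕ.+ 4 ℕ.+ suc B ≤⟨ ℕ.m≤m+n _ (5 ℕ.+ 6 ℕ.* B) ⟩
    3 ℕ.* B ℕ.+ 4 ℕ.+ suc B ℕ.+ (5 ℕ.+ 6 ℕ.* B) ≡⟨ count B ⟩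
    suc (suc (B ℕ.+ B)) ℕ.* 5 ≤⟨ ℕ.*-monoˡ-≤ 5 l ⟩
    ∣ t ∣ ℕ.* 5 ≡⟨ ℤ.abs-* t (+ 5) ⟨
    ∣ t * + 5 ∣ ≤⟨ ∣k∣≤∣a∣+∣a+k∣ a (t * + 5) ⟩
    ∣ a ∣ ℕ.+ ∣ a + t * + 5 ∣ ≡⟨ cong (λ y → ∣ a ∣ ℕ.+ ∣ y ∣) (ℤ.+-assoc (+ 3 * x) (+ c) (t * + 5)) ⟩
    ∣ a ∣ ℕ.+ ∣ y ∣ ≤⟨ ℕ.+-monoˡ-≤ (∣ y ∣) (ℕ.≤-trans (ℤ.∣i+j∣≤∣i∣+∣j∣ (+ 3 * x) (+ c))
      (ℕ.+-mono-≤ (ℕ.≤-trans (ℕ.≤-reflexive (ℤ.abs-* (+ 3) x)) (ℕ.*-monoʳ-≤ 3 small)) c≤4)) ⟩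
    3 ℕ.* B ℕ.+ 4 ℕ.+ ∣ y ∣ ∎)
  where
  open ℕ.≤-Reasoning
  a = + 3 * x + + c
  y = + 3 * x + (+ c + t * + 5)
  count : ∀ B → (3 ℕ.* B ℕ.+ 4 ℕ.+ suc B) ℕ.+ (5 ℕ.+ 6 ℕ.* B) ≡ suc (suc (B ℕ.+ B)) ℕ.* 5
  count = solveℕ-∀

-- Multiplication by 2 + i maps the Gaussian integers onto a sublattice of index 5.
lattice : ∀ {B M} f → Supp² (suc B) f → 22 ℕ.* suc B ℕ.≤ M →
  sumℤ² (M ℕ.* 5) f ≡ sum5 (λ c → sumℤ² M (λ u w → f (+ 2 * u - w) (u + + 2 * w + + c)))
lattice {B₀} {M} f z le = begin
    sumℤ² (M ℕ.* 5) f ≡⟨ trans (sumℤ-ext (λ x → sumℤ (M ℕ.* 5) (f x)) rows B≤5M) (sym (sumℤ-ext (λ x → sumℤ (M ℕ.* 5) (f x)) rows B≤M)) ⟩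
    sumℤ M (λ x → sumℤ (M ℕ.* 5) (f x)) ≡⟨ sumℤ-cong M inner ⟩
    sumℤ M (λ x → sumℤ (M ℕ.* 5) (λ y → f x (+ 3 * x + y))) ≡⟨ sumℤ-cong M (λ x → sumℤ-split5 M (λ y → f x (+ 3 * x + y))) ⟩
    sumℤ M (λ x → sum5 (λ c → sumℤ M (g c x))) ≡⟨ sumℤ-sum5 M (λ c x → sumℤ M (g c x)) ⟩
    sum5 (λ c → sumℤ² M (g c)) ≡⟨ sum5-cong (λ c c≤4 → trans (sumℤ²-shear (g c) (g-supp c c≤4) (ℕ.≤-trans (ℕ.≤-reflexive (count B₀)) le))
        (sumℤ²-cong M (λ u w → cong (f (+ 2 * u - w)) (eq u w (+ c))))) ⟩
    sum5 (λ c → sumℤ² M (λ u w → f (+ 2 * u - w) (u + + 2 * w + + c))) ∎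
  where
  open ≡.≡-Reasoning
  B = suc B₀
  -- A point x + iy lies in ci + (2 + i)ℤ[i] exactly when y ≡ 3x + c modulo 5. In the coordinates x
  -- = 2u - w, y = u + 2w + c one has t = w - u, which leaves the unimodular substitution of
  -- `sumℤ²-shear`.
  g : ℕ → ℤ → ℤ → ℤ
  g c x t = f x (+ 3 * x + (+ c + t * + 5))
  eq : ∀ u w c → + 3 * (+ 2 * u - w) + (c + (w - u) * + 5) ≡ u + + 2 * w + c
  eq = solve-∀
  count : ∀ B₀ → 11 ℕ.* suc (suc (B₀ ℕ.+ B₀)) ≡ 22 ℕ.* suc B₀
  count = solveℕ-∀
  rows : Supp B (λ x → sumℤ (M ℕ.* 5) (f x))
  rows x l = sumℤ-zero (M ℕ.* 5) (λ y → z x y (inj₁ l))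
  B≤M : B ℕ.≤ M
  B≤M = ℕ.≤-trans (ℕ.m≤m+n B (21 ℕ.* B)) le
  B≤5M : B ℕ.≤ M ℕ.* 5
  B≤5M = ℕ.≤-trans B≤M (ℕ.m≤m*n M 5)
  inner : ∀ x → sumℤ (M ℕ.* 5) (f x) ≡ sumℤ (M ℕ.* 5) (λ y → f x (+ 3 * x + y))
  inner x with ℕ.<-≤-connex (∣ x ∣) B
  ... | inj₂ big = trans (sumℤ-zero (M ℕ.* 5) (λ y → z x y (inj₁ big))) (sym (sumℤ-zero (M ℕ.* 5) (λ y → z x (+ 3 * x + y) (inj₁ big))))
  ... | inj₁ small = sym (sumℤ-shift (+ 3 * x) (f x) (λ y l → z x y (inj₂ l))
      (ℕ.≤-trans (ℕ.+-mono-≤ b (ℕ.+-monoˡ-≤ B b)) (ℕ.≤-trans (ℕ.≤-trans (ℕ.m≤m+n _ (15 ℕ.* B)) (ℕ.≤-reflexive (count′ B))) (ℕ.≤-trans le (ℕ.m≤m*n M 5)))))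
    where
    b : ∣ + 3 * x ∣ ℕ.≤ 3 ℕ.* B
    b = ℕ.≤-trans (ℕ.≤-reflexive (ℤ.abs-* (+ 3) x)) (ℕ.*-monoʳ-≤ 3 (ℕ.<⇒≤ small))
    count′ : ∀ B → 3 ℕ.* B ℕ.+ (3 ℕ.* B ℕ.+ B) ℕ.+ 15 ℕ.* B ≡ 22 ℕ.* B
    count′ = solveℕ-∀
  g-supp : ∀ c → c ℕ.≤ 4 → Supp² (suc (suc (B₀ ℕ.+ B₀))) (g c)
  g-supp c c≤4 x t (inj₁ l) = z x (+ 3 * x + (+ c + t * + 5)) (inj₁ (ℕ.≤-trans (s≤s (ℕ.≤-trans (ℕ.m≤m+n B₀ B₀) (ℕ.n≤1+n _))) l))
  g-supp c c≤4 x t (inj₂ l) with ℕ.<-≤-connex (∣ x ∣) B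
  ... | inj₂ big = z x (+ 3 * x + (+ c + t * + 5)) (inj₁ big)
  ... | inj₁ (s≤s small) = z x (+ 3 * x + (+ c + t * + 5)) (inj₂ (far {B₀} {x} {t} {c} small c≤4 l))

-- The sign (-1)ᵏ for integers k

sgℕ : ℕ → ℤ
sgℕ zero    = 1ℤ
sgℕ (suc n) = - sgℕ n

sg : ℤ → ℤ
sg (+ n)    = sgℕ n
sg -[1+ n ] = sgℕ (suc n)

sg-suc : ∀ k → sg (1ℤ + k) ≡ - sg k
sg-suc (+ n) = refl
sg-suc -[1+ zero ] = refl
sg-suc -[1+ suc n ] = sym (ℤ.neg-involutive (sgℕ (suc n)))

sg-+ : ∀ a b → sg (a + b) ≡ sg a * sg b
sg-+ (+ zero) b = trans (cong sg (ℤ.+-identityˡ b)) (sym (ℤ.*-identityˡ (sg b)))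
sg-+ (+ suc n) b = trans (cong sg (ℤ.+-assoc 1ℤ (+ n) b)) (trans (sg-suc (+ n + b))
  (trans (cong -_ (sg-+ (+ n) b)) (ℤ.neg-distribˡ-* (sgℕ n) (sg b))))
sg-+ -[1+ zero ] b = trans (sym (ℤ.neg-involutive _)) (trans (cong -_ (sym (sg-suc (-1ℤ + b))))
  (trans (cong (λ x → - sg x) (sym (ℤ.+-assoc 1ℤ -1ℤ b))) (trans (cong (λ x → - sg x) (ℤ.+-identityˡ b)) (sym (ℤ.-1*i≡-i (sg b))))))
sg-+ -[1+ suc n ] b = trans (sym (ℤ.neg-involutive _)) (trans (cong -_ (sym (sg-suc (-[1+ suc n ] + b))))
  (trans (cong (λ x → - sg x) (sym (ℤ.+-assoc 1ℤ -[1+ suc n ] b))) (trans (cong -_ (sg-+ -[1+ n ] b)) (ℤ.neg-distribˡ-* (sg -[1+ n ]) (sg b)))))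

sg-neg : ∀ k → sg (- k) ≡ sg k
sg-neg (+ zero) = refl
sg-neg (+ suc n) = refl
sg-neg -[1+ n ] = refl

sg-sq : ∀ k → sg k * sg k ≡ 1ℤ
sg-sq k = trans (cong (_* sg k) (sym (sg-neg k))) (trans (sym (sg-+ (- k) k)) (cong sg (ℤ.+-inverseˡ k)))

sg-2* : ∀ k → sg (+ 2 * k) ≡ 1ℤ
sg-2* k = trans (cong sg (double k)) (trans (sg-+ k k) (sg-sq k))
  where
  double : ∀ k → + 2 * k ≡ k + k
  double = solve-∀

-- ex a b k = ((a + b) k² + (a − b) k) / 2

tri : ℕ → ℕ
tri zero    = 0
tri (suc n) = n ℕ.+ tri n

ex : ℕ → ℕ → ℤ → ℕ
ex a b (+ i)    = a ℕ.* i ℕ.+ (a ℕ.+ b) ℕ.* tri i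
ex a b -[1+ i ] = b ℕ.* suc i ℕ.+ (a ℕ.+ b) ℕ.* tri (suc i)

2*tri : ∀ n → + 2 * + tri n ≡ + n * + n - + n
2*tri zero = refl
2*tri (suc n) = begin
    + 2 * + (n ℕ.+ tri n) ≡⟨ cong (+ 2 *_) (ℤ.pos-+ n (tri n)) ⟩
    + 2 * (+ n + + tri n) ≡⟨ ℤ.*-distribˡ-+ (+ 2) (+ n) (+ tri n) ⟩
    + 2 * + n + + 2 * + tri n ≡⟨ cong (λ x → + 2 * + n + x) (2*tri n) ⟩
    + 2 * + n + (+ n * + n - + n) ≡⟨ step (+ n) ⟩
    (1ℤ + + n) * (1ℤ + + n) - (1ℤ + + n) ∎
  where
  open ≡.≡-Reasoning
  step : ∀ n → + 2 * n + (n * n - n) ≡ (1ℤ + n) * (1ℤ + n) - (1ℤ + n)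
  step = solve-∀

2*ex : ∀ a b k → + 2 * + ex a b k ≡ (+ a + + b) * k * k + (+ a - + b) * k
2*ex a b k = go k
  where
  open ≡.≡-Reasoning
  pos : ∀ c i → + (c ℕ.* i ℕ.+ (a ℕ.+ b) ℕ.* tri i) ≡ + c * + i + (+ a + + b) * + tri i
  pos c i = trans (ℤ.pos-+ (c ℕ.* i) _) (cong₂ _+_ (ℤ.pos-* c i) (trans (ℤ.pos-* (a ℕ.+ b) (tri i)) (cong (_* + tri i) (ℤ.pos-+ a b))))
  expand : ∀ c i s t → + 2 * (c * i + s * t) ≡ + 2 * c * i + s * (+ 2 * t)
  expand = solve-∀
  doubled : ∀ c i → + 2 * + (c ℕ.* i ℕ.+ (a ℕ.+ b) ℕ.* tri i) ≡ + 2 * + c * + i + (+ a + + b) * (+ i * + i - + i)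
  doubled c i = trans (cong (+ 2 *_) (pos c i)) (trans (expand (+ c) (+ i) (+ a + + b) (+ tri i)) (cong (λ t → + 2 * + c * + i + (+ a + + b) * t) (2*tri i)))
  fin⁺ : ∀ a b i → + 2 * a * i + (a + b) * (i * i - i) ≡ (a + b) * i * i + (a - b) * i
  fin⁺ = solve-∀
  fin⁻ : ∀ a b i → + 2 * b * i + (a + b) * (i * i - i) ≡ (a + b) * (- i) * (- i) + (a - b) * (- i)
  fin⁻ = solve-∀
  go : ∀ k → + 2 * + ex a b k ≡ (+ a + + b) * k * k + (+ a - + b) * k
  go (+ i) = trans (doubled a i) (fin⁺ (+ a) (+ b) (+ i))
  go -[1+ i ] = trans (doubled b (suc i)) (fin⁻ (+ a) (+ b) (+ suc i))

n≤1+tri : ∀ n → n ℕ.≤ suc (tri n)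
n≤1+tri zero = z≤n
n≤1+tri (suc n) = s≤s (ℕ.m≤m+n n (tri n))

∣k∣≤1+ex : ∀ a b → 1 ℕ.≤ a ℕ.+ b → ∀ k → ∣ k ∣ ℕ.≤ suc (ex a b k)
∣k∣≤1+ex a b pos k = go k
  where
  bound : ∀ c i → i ℕ.≤ suc (c ℕ.+ (a ℕ.+ b) ℕ.* tri i)
  bound c i = ℕ.≤-trans (n≤1+tri i) (s≤s (ℕ.≤-trans (ℕ.≤-trans (ℕ.≤-reflexive (sym (ℕ.*-identityˡ (tri i)))) (ℕ.*-monoˡ-≤ (tri i) pos)) (ℕ.m≤n+m _ c)))
  go : ∀ k → ∣ k ∣ ℕ.≤ suc (ex a b k)
  go (+ i) = bound (a ℕ.* i) i
  go -[1+ i ] = bound (b ℕ.* suc i) (suc i)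

-- f = Σ_{k ∈ ℤ} c k q^{e k}; the bound makes the sum over ∣k∣ ≤ n + 2 exact at order n.
record Theta (f : PS) (c : ℤ → ℤ) (e : ℤ → ℕ) : Set where
  field
    bound : ∀ k → ∣ k ∣ ℕ.≤ suc (e k)
    coef  : ∀ n {M} → suc (suc n) ℕ.≤ M → f n ≡ sumℤ M (λ k → c k * kron (e k) n)
open Theta

kron-supp : ∀ (c : ℤ → ℤ) (e : ℤ → ℕ) → (∀ k → ∣ k ∣ ℕ.≤ suc (e k)) → ∀ n → Supp (suc (suc n)) (λ k → c k * kron (e k) n)
kron-supp c e b n k l = trans (cong (c k *_) (kron-≢ (λ eq → ℕ.<⇒≱ l (ℕ.≤-trans (b k) (s≤s (ℕ.≤-reflexive eq)))))) (ℤ.*-zeroʳ (c k))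

Theta-cong : ∀ {f f′ c c′ e e′} → f ≈ f′ → (∀ k → c k ≡ c′ k) → (∀ k → e k ≡ e′ k) → Theta f c e → Theta f′ c′ e′
Theta-cong {e′ = e′} ff cc ee t = record
  { bound = λ k → subst (λ x → ∣ k ∣ ℕ.≤ suc x) (ee k) (bound t k)
  ; coef = λ n {M} l → trans (sym (at ff n)) (trans (coef t n l) (sumℤ-cong M (λ k → cong₂ (λ x y → x * kron y n) (cc k) (ee k)))) }

Theta-⊕ : ∀ {f g c c′ e} → Theta f c e → Theta g c′ e → Theta (f ⊕ g) (λ k → c k + c′ k) e
Theta-⊕ {f} {g} {c} {c′} {e} s t = record
  { bound = bound s
  ; coef = λ n {M} l → trans (⊕-at f g n) (trans (cong₂ _+_ (coef s n l) (coef t n l))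
      (trans (sym (sumℤ-+ M (λ k → c k * kron (e k) n) (λ k → c′ k * kron (e k) n))) (sumℤ-cong M (λ k → sym (ℤ.*-distribʳ-+ (kron (e k) n) (c k) (c′ k)))))) }

Theta-scale : ∀ {f c e} a → Theta f c e → Theta (const a ⊗ f) (λ k → a * c k) e
Theta-scale {f} {c} {e} a t = record
  { bound = bound t
  ; coef = λ n {M} l → trans (scale-at a f n) (trans (cong (a *_) (coef t n l))
      (trans (sym (sumℤ-* M a (λ k → c k * kron (e k) n))) (sumℤ-cong M (λ k → sym (ℤ.*-assoc a (c k) (kron (e k) n)))))) }

Theta-θ : ∀ {f c e} → Theta f c e → Theta (θ f) (λ k → c k * + e k) e
Theta-θ {f} {c} {e} t = record
  { bound = bound t
  ; coef = λ n {M} l → trans (θ-at f n) (trans (cong (+ n *_) (coef t n l))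
      (trans (sym (sumℤ-* M (+ n) (λ k → c k * kron (e k) n))) (sumℤ-cong M (λ k → move n k)))) }
  where
  move : ∀ n k → + n * (c k * kron (e k) n) ≡ c k * + e k * kron (e k) n
  move n k with e k ℕ.≟ n
  ... | yes refl = assoc (+ e k) (c k) (kron (e k) (e k))
    where
    assoc : ∀ a b d → a * (b * d) ≡ b * a * d
    assoc = solve-∀
  ... | no ne = trans (cong (λ x → + n * (c k * x)) (kron-≢ ne)) (trans (trans (cong (+ n *_) (ℤ.*-zeroʳ (c k))) (ℤ.*-zeroʳ (+ n)))
      (sym (trans (cong (c k * + e k *_) (kron-≢ ne)) (ℤ.*-zeroʳ (c k * + e k)))))

kron-*5 : ∀ m n → kron (m ℕ.* 5) (n ℕ.* 5) ≡ kron m n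
kron-*5 zero zero = refl
kron-*5 zero (suc n) = refl
kron-*5 (suc m) zero = refl
kron-*5 (suc m) (suc n) = kron-*5 m n

Theta-dil : ∀ {f c e} → Theta f c e → Theta (dil f) c (λ k → e k ℕ.* 5)
Theta-dil {f} {c} {e} t = record
  { bound = λ k → ℕ.≤-trans (bound t k) (s≤s (ℕ.m≤m*n (e k) 5))
  ; coef = go }
  where
  go : ∀ n {M} → suc (suc n) ℕ.≤ M → dil f n ≡ sumℤ M (λ k → c k * kron (e k ℕ.* 5) n)
  go n {M} l with 5 ∣? n
  ... | yes (divides m refl) = trans (dil-*5 f m) (trans (coef t m (ℕ.≤-trans (s≤s (s≤s (ℕ.m≤m*n m 5))) l))
      (sumℤ-cong M (λ k → cong (c k *_) (sym (kron-*5 (e k) m)))))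
  ... | no nd = trans (dil-∤ f nd) (sym (sumℤ-zero M (λ k → trans (cong (c k *_) (kron-≢ (λ eq → nd (subst (5 ∣_) eq (n∣m*n (e k)))))) (ℤ.*-zeroʳ (c k)))))

kron-+ : ∀ r m n → kron (r ℕ.+ m) (r ℕ.+ n) ≡ kron m n
kron-+ zero m n = refl
kron-+ (suc r) m n = kron-+ r m n

Theta-q^ : ∀ {f c e} r → Theta f c e → Theta (q ^ r ⊗ f) c (λ k → r ℕ.+ e k)
Theta-q^ {f} {c} {e} r t = record
  { bound = λ k → ℕ.≤-trans (bound t k) (s≤s (ℕ.m≤n+m (e k) r))
  ; coef = go }
  where
  go : ∀ n {M} → suc (suc n) ℕ.≤ M → (q ^ r ⊗ f) n ≡ sumℤ M (λ k → c k * kron (r ℕ.+ e k) n)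
  go n {M} l with ℕ.<-≤-connex n r
  ... | inj₁ n<r = trans (q^⊗-< r f n<r) (sym (sumℤ-zero M (λ k → trans (cong (c k *_) (kron-≢ (λ eq → ℕ.<⇒≱ n<r (ℕ.≤-trans (ℕ.m≤m+n r (e k)) (ℕ.≤-reflexive eq))))) (ℤ.*-zeroʳ (c k)))))
  ... | inj₂ r≤n = subst (λ m → (q ^ r ⊗ f) m ≡ sumℤ M (λ k → c k * kron (r ℕ.+ e k) m)) (ℕ.m+[n∸m]≡n r≤n)
      (trans (q^⊗-+ r f (n ∸ r)) (trans (coef t (n ∸ r) (ℕ.≤-trans (s≤s (s≤s (ℕ.m∸n≤m n r))) l))
        (sumℤ-cong M (λ k → cong (c k *_) (sym (kron-+ r (e k) (n ∸ r)))))))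

Theta-shift : ∀ {f c e} → (∀ k → ∣ k ∣ ℕ.≤ suc (e (1ℤ + k))) → Theta f c e → Theta f (λ k → c (1ℤ + k)) (λ k → e (1ℤ + k))
Theta-shift {f} {c} {e} b t = record
  { bound = b
  ; coef = λ n {M} l → trans (coef t n l) (sym (sumℤ-shift1 {suc (suc n)} (λ k → c k * kron (e k) n) (kron-supp c e (bound t) n) l)) }

∑ℤ : ℕ → (ℤ → PS) → PS
∑ℤ M F = ∑ M (λ i → F (+ i)) ⊕ ∑ M (λ i → F -[1+ i ])

∑-at : ∀ M F n → ∑ M F n ≡ Σ< M (λ i → F i n)
∑-at zero F n = const0-at n
∑-at (suc M) F n = trans (⊕-at (∑ M F) (F M) n) (cong (_+ F M n) (∑-at M F n))

∑ℤ-at : ∀ M F n → ∑ℤ M F n ≡ sumℤ M (λ k → F k n)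
∑ℤ-at M F n = trans (⊕-at _ _ n) (cong₂ _+_ (∑-at M (λ i → F (+ i)) n) (∑-at M (λ i → F -[1+ i ]) n))

∑ℤ-⊗ˡ : ∀ M g F → g ⊗ ∑ℤ M F ≈ ∑ℤ M (λ k → g ⊗ F k)
∑ℤ-⊗ˡ M g F = ≈-trans (⊗-distribˡ-⊕ g _ _) (⊕-cong (≈-sym (∑-⊗ˡ M g (λ i → F (+ i)))) (≈-sym (∑-⊗ˡ M g (λ i → F -[1+ i ]))))

∑ℤ-cong : ∀ M {F G} → (∀ k → F k ≈ G k) → ∑ℤ M F ≈ ∑ℤ M G
∑ℤ-cong M e = ⊕-cong (∑-cong M (λ i _ → e (+ i))) (∑-cong M (λ i _ → e -[1+ i ]))

mono : ℤ → ℕ → PS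
mono c e = const c ⊗ q ^ e

mono-at : ∀ c e n → mono c e n ≡ c * kron e n
mono-at c e n = trans (scale-at c (q ^ e) n) (cong (c *_) (q^-at e n))

mono-⊗ : ∀ c e c′ e′ → mono c e ⊗ mono c′ e′ ≈ mono (c * c′) (e ℕ.+ e′)
mono-⊗ c e c′ e′ = ≈-trans (solve 4 (λ a b x y → (a :* x) :* (b :* y) := (a :* b) :* (x :* y)) ≈-refl (const c) (const c′) (q ^ e) (q ^ e′))
  (⊗-cong (≈-sym (const-⊗ c c′)) (≈-sym (^-homo-* q e e′)))
  where
  open Solver

-- Up to order n both factors agree with finite sums of monomials, which can be multiplied term by
-- term.
Theta-⊗ : ∀ {f g c c′ e e′} → Theta f c e → Theta g c′ e′ → ∀ n {M} → suc (suc n) ℕ.≤ M →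
  (f ⊗ g) n ≡ sumℤ² M (λ k l → c k * c′ l * kron (e k ℕ.+ e′ l) n)
Theta-⊗ {f} {g} {c} {c′} {e} {e′} s t n {M} le = begin
    (f ⊗ g) n ≡⟨ ⊗-cong-≤ n (approx s) (approx t) ⟩
    (∑ℤ M F ⊗ ∑ℤ M G) n ≡⟨ at (≈-trans (⊗-comm (∑ℤ M F) (∑ℤ M G)) (∑ℤ-⊗ˡ M (∑ℤ M G) F)) n ⟩
    ∑ℤ M (λ k → ∑ℤ M G ⊗ F k) n ≡⟨ ∑ℤ-at M (λ k → ∑ℤ M G ⊗ F k) n ⟩
    sumℤ M (λ k → (∑ℤ M G ⊗ F k) n) ≡⟨ sumℤ-cong M (λ k → trans (at (≈-trans (⊗-comm (∑ℤ M G) (F k)) (≈-trans (∑ℤ-⊗ˡ M (F k) G) (∑ℤ-cong M (λ l → mono-⊗ (c k) (e k) (c′ l) (e′ l))))) n)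
         (trans (∑ℤ-at M (λ l → mono (c k * c′ l) (e k ℕ.+ e′ l)) n) (sumℤ-cong M (λ l → mono-at (c k * c′ l) (e k ℕ.+ e′ l) n)))) ⟩
    sumℤ² M (λ k l → c k * c′ l * kron (e k ℕ.+ e′ l) n) ∎
  where
  open ≡.≡-Reasoning
  F G : ℤ → PS
  F k = mono (c k) (e k)
  G k = mono (c′ k) (e′ k)
  approx : ∀ {f c e} → Theta f c e → ∀ m → m ℕ.≤ n → f m ≡ ∑ℤ M (λ k → mono (c k) (e k)) m
  approx {f} {c} {e} t m m≤n = trans (coef t m (ℕ.≤-trans (s≤s (s≤s m≤n)) le)) (sym (trans (∑ℤ-at M (λ k → mono (c k) (e k)) m) (sumℤ-cong M (λ k → mono-at (c k) (e k) m))))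

-- From the finite triple product to theta series

module ThetaLimit (d : ℕ) (c : ℤ → ℤ) (e : ℤ → ℕ) (b : ∀ k → ∣ k ∣ ℕ.≤ suc (e k))
    (u v : ℕ → PS) (u≈ : ∀ i → u i ≈ mono (c (+ i)) (e (+ i))) (v≈ : ∀ i → v (suc i) ≈ mono (c -[1+ i ]) (e -[1+ i ])) where

  open Gauss d

  mono≈[]0 : ∀ K c e → K ℕ.< suc e → mono c e ≈[ K ] const 0ℤ
  mono≈[]0 K c e (s≤s l) = ≈[]-trans (⊗-cong[] ≈[]-refl (q^≈[]0 e l)) (≈⇒≈[] K (⊗-zeroʳ (const c)))

  limit : ∀ K → let N = suc (K ℕ.+ K) in Q!∞ ⊗ bsum (N ℕ.+ N) (σ u v N) ≈[ K ] ∑ℤ N (λ k → mono (c k) (e k))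
  limit K = ≈[]-trans (bsum-limit K u v
      (λ i l → ≈[]-trans (≈⇒≈[] K (u≈ i)) (mono≈[]0 K _ _ (ℕ.<-≤-trans l (b (+ i)))))
      (λ { (suc i) l → ≈[]-trans (≈⇒≈[] K (v≈ i)) (mono≈[]0 K _ _ (ℕ.<-≤-trans l (b -[1+ i ]))) }))
    (≈⇒≈[] K (⊕-cong (∑-cong N (λ i _ → u≈ i)) (∑-cong N (λ i _ → v≈ i))))
    where N = suc (K ℕ.+ K)

  theta : ∀ f → (∀ K → let N = suc (K ℕ.+ K) in f ≈[ K ] Q!∞ ⊗ bsum (N ℕ.+ N) (σ u v N)) → Theta f c e
  theta f lim = record { bound = b ; coef = go }
    where
    go : ∀ n {M} → suc (suc n) ℕ.≤ M → f n ≡ sumℤ M (λ k → c k * kron (e k) n)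
    go n {M} l = begin
        f n ≡⟨ at< (≈[]-trans (lim K) (limit K)) n ℕ.≤-refl ⟩
        ∑ℤ N (λ k → mono (c k) (e k)) n ≡⟨ ∑ℤ-at N (λ k → mono (c k) (e k)) n ⟩
        sumℤ N (λ k → mono (c k) (e k) n) ≡⟨ sumℤ-cong N (λ k → mono-at (c k) (e k) n) ⟩
        sumℤ N t ≡⟨ sumℤ-ext {suc (suc n)} t (kron-supp c e b n) (s≤s (ℕ.m≤m+n K K)) ⟩
        sumℤ (suc (suc n)) t ≡⟨ sumℤ-ext {suc (suc n)} t (kron-supp c e b n) l ⟨
        sumℤ M t ∎
      where
      open ≡.≡-Reasoning
      K = suc n
      N = suc (K ℕ.+ K)
      t : ℤ → ℤ
      t k = c k * kron (e k) n

-- Only the sum of the exponents of z and w has to be positive: Jacobi's cube takes a = 0, that is z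
-- = 1.
module Sides (d a b : ℕ) (a+b : a ℕ.+ b ≡ suc d) where

  open Gauss d
  open Solver

  zw : q ^ a ⊗ q ^ b ≈ Q
  zw = ≈-trans (≈-sym (^-homo-* q a b)) (≡⇒≈ (cong (q ^_) a+b))

  open TripleProduct (q ^ a) (q ^ b) zw

  closed : ∀ c (t : ℕ → PS) → t 0 ≈ const 1ℤ → (∀ i → t (suc i) ≈ ⊝ (q ^ c ⊗ Q ^ i ⊗ t i)) →
    ∀ i → t i ≈ mono (sgℕ i) (c ℕ.* i ℕ.+ (a ℕ.+ b) ℕ.* tri i)
  closed c t t0 ts zero = ≈-trans t0 (≈-trans (solve 0 (con 1ℤ := con 1ℤ :* con 1ℤ) ≈-refl) (⊗-cong ≈-refl (≡⇒≈ (cong (q ^_) (sym (cong₂ ℕ._+_ (ℕ.*-zeroʳ c) (ℕ.*-zeroʳ (a ℕ.+ b))))))))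
  closed c t t0 ts (suc i) = begin
      t (suc i) ≈⟨ ts i ⟩
      ⊝ (q ^ c ⊗ Q ^ i ⊗ t i) ≈⟨ ⊝-cong (⊗-cong (⊗-cong ≈-refl (≈-trans (^-assocʳ q (suc d) i) (≡⇒≈ (cong (λ m → q ^ (m ℕ.* i)) (sym a+b))))) (closed c t t0 ts i)) ⟩
      ⊝ (q ^ c ⊗ q ^ (m ℕ.* i) ⊗ (const (sgℕ i) ⊗ q ^ e)) ≈⟨ solve 4 (λ x y s z → :- (x :* y :* (s :* z)) := :- s :* (x :* y :* z)) ≈-refl (q ^ c) (q ^ (m ℕ.* i)) (const (sgℕ i)) (q ^ e) ⟩
      ⊝ const (sgℕ i) ⊗ (q ^ c ⊗ q ^ (m ℕ.* i) ⊗ q ^ e)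
        ≈⟨ ⊗-cong (≈-sym (const-⊝ (sgℕ i))) (≈-trans (⊗-cong (≈-sym (^-homo-* q c (m ℕ.* i))) ≈-refl) (≈-trans (≈-sym (^-homo-* q (c ℕ.+ m ℕ.* i) e)) (≡⇒≈ (cong (q ^_) (arith c m i (tri i)))))) ⟩
      mono (sgℕ (suc i)) (c ℕ.* suc i ℕ.+ m ℕ.* tri (suc i)) ∎
    where
    open ≈-Reasoning
    m = a ℕ.+ b
    e = c ℕ.* i ℕ.+ m ℕ.* tri i
    arith : ∀ c m i t → c ℕ.+ m ℕ.* i ℕ.+ (c ℕ.* i ℕ.+ m ℕ.* t) ≡ c ℕ.* suc i ℕ.+ m ℕ.* (i ℕ.+ t)
    arith = solveℕ-∀

  u≈ : ∀ i → u i ≈ mono (sg (+ i)) (ex a b (+ i))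
  u≈ = closed a u ≈-refl (λ i → ≈-refl)

  v≈ : ∀ i → v (suc i) ≈ mono (sg -[1+ i ]) (ex a b -[1+ i ])
  v≈ i = closed b v ≈-refl (λ i → ≈-refl) (suc i)

  bnd : ∀ k → ∣ k ∣ ℕ.≤ suc (ex a b k)
  bnd = ∣k∣≤1+ex a b (ℕ.≤-trans (s≤s z≤n) (ℕ.≤-reflexive (sym a+b)))

module JacobiTripleProduct (a b : ℕ) where

  d : ℕ
  d = a ℕ.+ suc b

  open Gauss d
  open Sides d (suc a) (suc b) refl
  open TripleProduct (q ^ suc a) (q ^ suc b) zw

  Π≈[]P : ∀ c N → Π c d ≈[ N ] P (q ^ suc c) N
  Π≈[]P c N = ≈[]-trans (lim≈[]prod (Tame-1-q^ c d) N) (≈⇒≈[] N (prod-cong (λ k → ⊕-cong ≈-refl (⊝-cong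
    (≈-trans (^-homo-* q (suc c) (suc d ℕ.* k)) (⊗-cong ≈-refl (≈-sym (^-assocʳ q (suc d) k)))))) N))

  jacobi : Theta (Q!∞ ⊗ (Π b d ⊗ Π a d)) sg (ex (suc a) (suc b))
  jacobi = ThetaLimit.theta d sg (ex (suc a) (suc b)) bnd u v u≈ v≈ _ (λ K → let N = suc (K ℕ.+ K) in
    ⊗-cong[] ≈[]-refl (≈[]-trans (≈[]-weaken (ℕ.≤-trans (ℕ.m≤m+n K K) (ℕ.n≤1+n _)) (⊗-cong[] (Π≈[]P b N) (Π≈[]P a N)))
      (≈⇒≈[] K (≈-sym (tripleProduct N N)))))

-- Jacobi's identity for the cube of Euler's product, by differentiating the triple product at z = 1

module JacobiCube where

  open Gauss 0
  open Sides 0 0 1 refl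
  open TripleProduct (q ^ 0) (q ^ 1) zw
  open Solver

  -- At z = 1 the factor 1 - z vanishes.
  P1≈0 : ∀ m → P (q ^ 0) (suc m) ≈ const 0ℤ
  P1≈0 zero = solve 0 (con 1ℤ :* (con 1ℤ :+ :- (con 1ℤ :* con 1ℤ)) := con 0ℤ) ≈-refl
  P1≈0 (suc m) = ≈-trans (⊗-cong (P1≈0 m) ≈-refl) (⊗-zeroˡ _)

  -- Applying z d/dz at z = 1 leaves only the term in which the vanishing factor 1 - z is
  -- differentiated: minus the product of the other factors.
  bsum-u′ : ∀ m → bsum (suc m) u′ ≈ ⊝ Q! m
  bsum-u′ zero = ≈-trans (bsum-u′-right 0) (solve 1 (λ x → (con 1ℤ :+ :- (con 1ℤ :* con 1ℤ)) :* x :+ :- (con 1ℤ :* con 1ℤ) :* con 1ℤ := :- con 1ℤ) ≈-refl (bsum 0 u′))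
  bsum-u′ (suc m) = ≈-trans (bsum-u′-right (suc m)) (≈-trans (⊕-cong (⊗-cong ≈-refl (bsum-u′ m)) (⊗-cong ≈-refl (P1≈0 m)))
    (solve 2 (λ y x → (con 1ℤ :+ :- (con 1ℤ :* y)) :* (:- x) :+ :- (con 1ℤ :* y) :* con 0ℤ := :- (x :* (con 1ℤ :+ :- y))) ≈-refl (Q ^ suc m) (Q! m)))

  bsum-s′ : ∀ n m → bsum (n ℕ.+ suc m) (s′ n) ≈ ⊝ (Q! n ⊗ Q! m)
  bsum-s′ zero m = ≈-trans (bsum-u′ m) (⊝-cong (≈-sym (⊗-identityˡ (Q! m))))
  bsum-s′ (suc n) m = ≈-trans (bsum-s′-left n (suc m)) (≈-trans (⊕-cong (⊗-cong ≈-refl (bsum-s′ n m)) (⊗-cong ≈-refl (⊗-cong ≈-refl (P1≈0 m))))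
    (solve 4 (λ y a b c → (con 1ℤ :+ :- y) :* (:- (a :* b)) :+ y :* (c :* con 0ℤ) := :- ((a :* (con 1ℤ :+ :- y)) :* b)) ≈-refl (Q ^ suc n) (Q! n) (Q! m) (P (q ^ 1) n)))

  -- The undifferentiated series at z = 1. Being zero, it may be added freely to change the weight k
  -- into an affine function of k.
  theta₀ : Theta (const 0ℤ) sg (ex 0 1)
  theta₀ = ThetaLimit.theta 0 sg (ex 0 1) bnd u v u≈ v≈ _ (λ K → let N = suc (K ℕ.+ K) in ≈⇒≈[] K (≈-sym
    (≈-trans (⊗-cong ≈-refl (≈-trans (tripleProduct N N) (≈-trans (⊗-cong ≈-refl (P1≈0 (K ℕ.+ K))) (⊗-zeroʳ _)))) (⊗-zeroʳ _))))

  scaled : ∀ c s e {t} → t ≈ mono s e → const c ⊗ t ≈ mono (c * s) e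
  scaled c s e p = ≈-trans (⊗-cong ≈-refl p) (≈-trans (≈-sym (⊗-assoc (const c) (const s) (q ^ e))) (⊗-cong (≈-sym (const-⊗ c s)) ≈-refl))

  theta₁ : Theta (⊝ (Q!∞ ⊗ (Q!∞ ⊗ Q!∞))) (λ k → k * sg k) (ex 0 1)
  theta₁ = ThetaLimit.theta 0 (λ k → k * sg k) (ex 0 1) bnd u′ v′ (λ i → scaled (+ i) (sg (+ i)) (ex 0 1 (+ i)) (u≈ i))
    (λ i → scaled -[1+ i ] (sg -[1+ i ]) (ex 0 1 -[1+ i ]) (v≈ i)) _ limit
    where
    limit : ∀ K → let N = suc (K ℕ.+ K) in ⊝ (Q!∞ ⊗ (Q!∞ ⊗ Q!∞)) ≈[ K ] Q!∞ ⊗ bsum (N ℕ.+ N) (s′ N)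
    limit K = begin
      ⊝ (Q!∞ ⊗ (Q!∞ ⊗ Q!∞)) ≈⟨ ≈⇒≈[] K (solve 2 (λ x y → :- (x :* y) := x :* (:- y)) ≈-refl Q!∞ (Q!∞ ⊗ Q!∞)) ⟩
      Q!∞ ⊗ ⊝ (Q!∞ ⊗ Q!∞) ≈⟨ ⊗-cong[] ≈[]-refl (⊝-cong[] (⊗-cong[] (≈[]-weaken (ℕ.≤-trans (ℕ.m≤m+n K K) (ℕ.n≤1+n _)) (Q!∞≈[]Q! N)) (≈[]-weaken (ℕ.m≤m+n K K) (Q!∞≈[]Q! (K ℕ.+ K))))) ⟩
      Q!∞ ⊗ ⊝ (Q! N ⊗ Q! (K ℕ.+ K)) ≈⟨ ≈⇒≈[] K (⊗-cong ≈-refl (≈-sym (bsum-s′ N (K ℕ.+ K)))) ⟩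
      Q!∞ ⊗ bsum (N ℕ.+ N) (s′ N) ∎
      where
      open Mod K
      N = suc (K ℕ.+ K)

  ex-shift : ∀ k → ex 0 1 (1ℤ + k) ≡ ex 1 0 k
  ex-shift k = ℤ.+-injective (ℤ.*-cancelˡ-≡ (+ 2) (+ ex 0 1 (1ℤ + k)) (+ ex 1 0 k) (trans (2*ex 0 1 (1ℤ + k)) (trans (eq k) (sym (2*ex 1 0 k)))))
    where
    eq : ∀ k → (+ 0 + + 1) * (1ℤ + k) * (1ℤ + k) + (+ 0 - + 1) * (1ℤ + k) ≡ (+ 1 + + 0) * k * k + (+ 1 - + 0) * k
    eq = solve-∀

  -- The combination -2 `theta₁` + `theta₀`, shifted by one, has the antisymmetric weight 2k + 1.
  -- The factor 2 appears because k and -1 - k contribute equally to the two-sided sum.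
  cube : Theta (const (+ 2) ⊗ Q!∞ ^ 3) (λ k → (+ 2 * k + 1ℤ) * sg k) (ex 1 0)
  cube = Theta-cong (solve 1 (λ x → con (- + 2) :* (:- (x :* (x :* x))) :+ con 0ℤ := con (+ 2) :* x :^ 3) ≈-refl Q!∞)
      (λ k → trans (cong (λ s → - + 2 * ((1ℤ + k) * s) + s) (sg-suc k)) (weights k (sg k))) ex-shift
      (Theta-shift (λ k → subst (λ x → ∣ k ∣ ℕ.≤ suc x) (sym (ex-shift k)) (∣k∣≤1+ex 1 0 (s≤s z≤n) k)) (Theta-⊕ (Theta-scale (- + 2) theta₁) theta₀))
    where
    weights : ∀ k s → - + 2 * ((1ℤ + k) * (- s)) + (- s) ≡ (+ 2 * k + 1ℤ) * s
    weights = solve-∀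

-- The theta series X and Y

f₁ f₅ X Y : PS
f₁ = Π 0 0
f₅ = Π 4 4
X = f₅ ⊗ (Π 1 4 ⊗ Π 2 4)
Y = f₅ ⊗ (Π 0 4 ⊗ Π 3 4)

eX eY eT : ℤ → ℕ
eX = ex 3 2
eY = ex 4 1
eT = ex 1 0

X-theta : Theta X sg eX
X-theta = JacobiTripleProduct.jacobi 2 1

Y-theta : Theta Y sg eY
Y-theta = JacobiTripleProduct.jacobi 3 0

-- Exponents are natural numbers that are halves of integral quadratic forms. Carrying the doubled
-- value reduces equality of exponents to polynomial identities over ℤ.
record Half (m : ℕ) (x : ℤ) : Set where
  constructor half
  field doubled : + 2 * + m ≡ x
open Half

half-+ : ∀ {m n x y} → Half m x → Half n y → Half (m ℕ.+ n) (x + y)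
half-+ {m} {n} p r = half (trans (cong (+ 2 *_) (ℤ.pos-+ m n)) (trans (ℤ.*-distribˡ-+ (+ 2) (+ m) (+ n)) (cong₂ _+_ (doubled p) (doubled r))))

half-≡ : ∀ {m x y} → x ≡ y → Half m x → Half m y
half-≡ e p = half (trans (doubled p) e)

half-*5 : ∀ {m x} → Half m x → Half (m ℕ.* 5) (x * + 5)
half-*5 {m} p = half (trans (cong (+ 2 *_) (ℤ.pos-* m 5)) (trans (sym (ℤ.*-assoc (+ 2) (+ m) (+ 5))) (cong (_* + 5) (doubled p))))

half-unique : ∀ {m n x y} → Half m x → Half n y → x ≡ y → m ≡ n
half-unique {m} {n} p r e = ℤ.+-injective (ℤ.*-cancelˡ-≡ (+ 2) (+ m) (+ n) (trans (doubled p) (trans e (sym (doubled r)))))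

half-eX : ∀ k → Half (eX k) (+ 5 * k * k + k)
half-eX k = half (trans (2*ex 3 2 k) (eq k))
  where
  eq : ∀ k → (+ 3 + + 2) * k * k + (+ 3 - + 2) * k ≡ + 5 * k * k + k
  eq = solve-∀

half-eY : ∀ k → Half (eY k) (+ 5 * k * k + + 3 * k)
half-eY k = half (trans (2*ex 4 1 k) (eq k))
  where
  eq : ∀ k → (+ 4 + + 1) * k * k + (+ 4 - + 1) * k ≡ + 5 * k * k + + 3 * k
  eq = solve-∀

half-eT : ∀ k → Half (eT k) (k * k + k)
half-eT k = half (trans (2*ex 1 0 k) (eq k))
  where
  eq : ∀ k → (+ 1 + + 0) * k * k + (+ 1 - + 0) * k ≡ k * k + k
  eq = solve-∀

kron-supp² : ∀ (c : ℤ → ℤ → ℤ) (e e′ : ℤ → ℕ) → (∀ k → ∣ k ∣ ℕ.≤ suc (e k)) → (∀ k → ∣ k ∣ ℕ.≤ suc (e′ k)) →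
  ∀ n → Supp² (suc (suc n)) (λ k l → c k l * kron (e k ℕ.+ e′ l) n)
kron-supp² c e e′ b b′ n k l s = trans (cong (c k l *_) (kron-≢ (λ eq → ℕ.<⇒≱ (big s) (s≤s (ℕ.≤-reflexive eq))))) (ℤ.*-zeroʳ (c k l))
  where
  big : suc (suc n) ℕ.≤ ∣ k ∣ ⊎ suc (suc n) ℕ.≤ ∣ l ∣ → suc n ℕ.< suc (e k ℕ.+ e′ l)
  big (inj₁ p) = ℕ.≤-trans p (ℕ.≤-trans (b k) (s≤s (ℕ.m≤m+n (e k) (e′ l))))
  big (inj₂ p) = ℕ.≤-trans p (ℕ.≤-trans (b′ l) (s≤s (ℕ.m≤n+m (e′ l) (e k))))

-- Modulo 2, multiplication by 2 + i merely exchanges the coordinates, so the sign character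
-- survives the change of lattice.
sg-rotate : ∀ u w c → sg (+ 2 * u - w) * sg (u + + 2 * w + + c) ≡ sg u * sg w * sgℕ c
sg-rotate u w c = begin
    sg (+ 2 * u - w) * sg (u + + 2 * w + + c)
      ≡⟨ cong₂ _*_ (trans (sg-+ (+ 2 * u) (- w)) (cong₂ _*_ (sg-2* u) (sg-neg w)))
           (trans (sg-+ (u + + 2 * w) (+ c)) (cong (_* sgℕ c) (trans (sg-+ u (+ 2 * w)) (cong (sg u *_) (sg-2* w))))) ⟩
    1ℤ * sg w * (sg u * 1ℤ * sgℕ c) ≡⟨ eq (sg w) (sg u) (sgℕ c) ⟩
    sg u * sg w * sgℕ c ∎
  where
  open ≡.≡-Reasoning
  eq : ∀ a b c → 1ℤ * a * (b * 1ℤ * c) ≡ b * a * c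
  eq = solve-∀

sg-reflect : ∀ k → sg (-1ℤ - k) ≡ - sg k
sg-reflect k = trans (sg-+ -1ℤ (- k)) (trans (cong (-1ℤ *_) (sg-neg k)) (ℤ.-1*i≡-i (sg k)))

sg-reflect₂ : ∀ k → sg (-[1+ 1 ] - k) ≡ sg k
sg-reflect₂ k = trans (sg-+ -[1+ 1 ] (- k)) (trans (ℤ.*-identityˡ (sg (- k))) (sg-neg k))

-- The 5-dissection of f₁ f₅ = X Y.  Writing x = 10k+1, y = 10l+3, the exponents are (x² + y² − 10)/40,
-- and x + iy = (2 + i)(U + iW) with U = 10u + 2c + 1, W = 10w + 4c + 1 in the coset c.
module XY-coefficient (n M : ℕ) (le : 22 ℕ.* suc (suc n) ℕ.≤ M) where

  n+2≤M : suc (suc n) ℕ.≤ M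
  n+2≤M = ℕ.≤-trans (ℕ.m≤m+n (suc (suc n)) _) le

  n+4≤M : suc (suc (suc (suc n))) ℕ.≤ M
  n+4≤M = ℕ.≤-trans (ℕ.≤-trans (s≤s (s≤s (ℕ.m≤n+m (suc (suc n)) n))) (ℕ.+-monoʳ-≤ (suc (suc n)) (ℕ.m≤m+n (suc (suc n)) (20 ℕ.* suc (suc n))))) le

  E : ℤ → ℤ → ℕ
  E k l = eX k ℕ.+ eY l

  f : ℤ → ℤ → ℤ
  f k l = sg k * sg l * kron (E k l) n

  rot : ℕ → ℤ → ℤ → ℕ
  rot c u w = E (+ 2 * u - w) (u + + 2 * w + + c)

  half-rot : ∀ c u w → Half (rot c u w) (+ 25 * u * u + + 25 * w * w + (+ 5 + + 10 * + c) * u + (+ 5 + + 20 * + c) * w + (+ 5 * + c * + c + + 3 * + c))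
  half-rot c u w = half-≡ (expand u w (+ c)) (half-+ (half-eX (+ 2 * u - w)) (half-eY (u + + 2 * w + + c)))
    where
    expand : ∀ u w c → (+ 5 * (+ 2 * u - w) * (+ 2 * u - w) + (+ 2 * u - w)) + (+ 5 * (u + + 2 * w + c) * (u + + 2 * w + c) + + 3 * (u + + 2 * w + c))
      ≡ + 25 * u * u + + 25 * w * w + (+ 5 + + 10 * c) * u + (+ 5 + + 20 * c) * w + (+ 5 * c * c + + 3 * c)
    expand = solve-∀

  g : ℕ → ℤ → ℤ → ℤ
  g c u w = sg u * sg w * sgℕ c * kron (rot c u w) n

  xx yy xy : ℤ → ℤ → ℤ
  xx u w = sg u * sg w * kron (eX u ℕ.* 5 ℕ.+ eX w ℕ.* 5) n
  yy u w = sg u * sg w * kron (2 ℕ.+ eY u ℕ.* 5 ℕ.+ eY w ℕ.* 5) n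
  xy u w = sg u * sg w * kron (1 ℕ.+ eX u ℕ.* 5 ℕ.+ eY w ℕ.* 5) n

  case₀ : sumℤ² M (g 0) ≡ sumℤ² M xx
  case₀ = sumℤ²-cong M (λ u w → cong₂ _*_ (ℤ.*-identityʳ (sg u * sg w))
      (cong (λ m → kron m n) (half-unique (half-rot 0 u w) (half-+ (half-*5 (half-eX u)) (half-*5 (half-eX w))) (eq u w))))
    where
    eq : ∀ u w → + 25 * u * u + + 25 * w * w + (+ 5 + + 10 * + 0) * u + (+ 5 + + 20 * + 0) * w + (+ 5 * + 0 * + 0 + + 3 * + 0)
      ≡ (+ 5 * u * u + u) * + 5 + (+ 5 * w * w + w) * + 5
    eq = solve-∀

  -- Here W = 10w + 5, and w ↦ -1 - w sends W to -W: the exponent is fixed and the sign is reversed.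
  case₁ : sumℤ² M (g 1) ≡ 0ℤ
  case₁ = sumℤ-zero M (λ u → sumℤ-odd M (g 1 u) (λ w → trans
      (cong₂ (λ s m → sg u * s * sgℕ 1 * kron m n) (sg-reflect w) (half-unique (half-rot 1 u (-1ℤ - w)) (half-rot 1 u w) (eq u w)))
      (neg (sg u) (sg w) (kron (rot 1 u w) n))))
    where
    eq : ∀ u w → + 25 * u * u + + 25 * (-1ℤ - w) * (-1ℤ - w) + (+ 5 + + 10 * + 1) * u + (+ 5 + + 20 * + 1) * (-1ℤ - w) + (+ 5 * + 1 * + 1 + + 3 * + 1)
      ≡ + 25 * u * u + + 25 * w * w + (+ 5 + + 10 * + 1) * u + (+ 5 + + 20 * + 1) * w + (+ 5 * + 1 * + 1 + + 3 * + 1)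
    eq = solve-∀
    neg : ∀ a b d → a * (- b) * -1ℤ * d ≡ - (a * b * -1ℤ * d)
    neg = solve-∀

  -- Here U = 10u + 5, and u ↦ -1 - u plays the role that the reflection of w plays in `case₁`.
  case₂ : sumℤ² M (g 2) ≡ 0ℤ
  case₂ = trans (sumℤ²-swap M (g 2)) (sumℤ-zero M (λ w → sumℤ-odd M (λ u → g 2 u w) (λ u → trans
      (cong₂ (λ s m → s * sg w * sgℕ 2 * kron m n) (sg-reflect u) (half-unique (half-rot 2 (-1ℤ - u) w) (half-rot 2 u w) (eq u w)))
      (neg (sg u) (sg w) (kron (rot 2 u w) n)))))
    where
    eq : ∀ u w → + 25 * (-1ℤ - u) * (-1ℤ - u) + + 25 * w * w + (+ 5 + + 10 * + 2) * (-1ℤ - u) + (+ 5 + + 20 * + 2) * w + (+ 5 * + 2 * + 2 + + 3 * + 2)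
      ≡ + 25 * u * u + + 25 * w * w + (+ 5 + + 10 * + 2) * u + (+ 5 + + 20 * + 2) * w + (+ 5 * + 2 * + 2 + + 3 * + 2)
    eq = solve-∀
    neg : ∀ a b d → (- a) * b * 1ℤ * d ≡ - (a * b * 1ℤ * d)
    neg = solve-∀

  yy-supp : Supp² (suc (suc n)) yy
  yy-supp = kron-supp² (λ u w → sg u * sg w) (λ k → 2 ℕ.+ eY k ℕ.* 5) (λ k → eY k ℕ.* 5) (bound (Theta-q^ 2 (Theta-dil Y-theta))) (bound (Theta-dil Y-theta)) n

  xy-supp : Supp² (suc (suc n)) xy
  xy-supp = kron-supp² (λ u w → sg u * sg w) (λ k → 1 ℕ.+ eX k ℕ.* 5) (λ k → eY k ℕ.* 5) (bound (Theta-q^ 1 (Theta-dil X-theta))) (bound (Theta-dil Y-theta)) n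

  -- Here U = -(10(-1 - u) + 3) and W = 10(w + 1) + 3, both of the shape belonging to Y up to sign.
  -- The power q² comes from (9 + 9 - 2)/8 = 2.
  case₃ : sumℤ² M (g 3) ≡ - sumℤ² M yy
  case₃ = begin
      sumℤ² M (g 3) ≡⟨ sumℤ²-cong M term ⟩
      sumℤ² M (λ u w → -1ℤ * yy (-1ℤ - u) (1ℤ + w)) ≡⟨ sumℤ²-* M -1ℤ (λ u w → yy (-1ℤ - u) (1ℤ + w)) ⟩
      -1ℤ * sumℤ² M (λ u w → yy (-1ℤ - u) (1ℤ + w)) ≡⟨ ℤ.-1*i≡-i _ ⟩
      - sumℤ² M (λ u w → yy (-1ℤ - u) (1ℤ + w))
        ≡⟨ cong -_ (sumℤ-cong M (λ u → sumℤ-shift1 (yy (-1ℤ - u)) (λ w l → yy-supp (-1ℤ - u) w (inj₂ l)) n+2≤M)) ⟩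
      - sumℤ M (λ u → sumℤ M (yy (-1ℤ - u))) ≡⟨ cong -_ (sumℤ-reflect M (λ u → sumℤ M (yy u))) ⟩
      - sumℤ² M yy ∎
    where
    open ≡.≡-Reasoning
    eq : ∀ u w → + 25 * u * u + + 25 * w * w + (+ 5 + + 10 * + 3) * u + (+ 5 + + 20 * + 3) * w + (+ 5 * + 3 * + 3 + + 3 * + 3)
      ≡ (+ 4 + (+ 5 * (-1ℤ - u) * (-1ℤ - u) + + 3 * (-1ℤ - u)) * + 5) + (+ 5 * (1ℤ + w) * (1ℤ + w) + + 3 * (1ℤ + w)) * + 5
    eq = solve-∀
    signs : ∀ a b d → a * b * -1ℤ * d ≡ -1ℤ * ((- a) * (- b) * d)
    signs = solve-∀
    term : ∀ u w → g 3 u w ≡ -1ℤ * yy (-1ℤ - u) (1ℤ + w)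
    term u w = trans (signs (sg u) (sg w) (kron (rot 3 u w) n)) (cong₂ (λ s d → -1ℤ * (s * d)) (cong₂ _*_ (sym (sg-reflect u)) (sym (sg-suc w)))
      (cong (λ m → kron m n) (half-unique (half-rot 3 u w) (half-+ (half-+ {2} (half refl) (half-*5 (half-eY (-1ℤ - u)))) (half-*5 (half-eY (1ℤ + w)))) (eq u w))))

  -- Here U = -(10(-1 - u) + 1) and W = -(10(-2 - w) + 3), one shape of X and one of Y. The power q
  -- comes from (1 + 9 - 2)/8 = 1.
  case₄ : sumℤ² M (g 4) ≡ - sumℤ² M xy
  case₄ = begin
      sumℤ² M (g 4) ≡⟨ sumℤ²-cong M term ⟩
      sumℤ² M (λ u w → -1ℤ * xy (-1ℤ - u) (-[1+ 1 ] - w)) ≡⟨ sumℤ²-* M -1ℤ (λ u w → xy (-1ℤ - u) (-[1+ 1 ] - w)) ⟩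
      -1ℤ * sumℤ² M (λ u w → xy (-1ℤ - u) (-[1+ 1 ] - w)) ≡⟨ ℤ.-1*i≡-i _ ⟩
      - sumℤ² M (λ u w → xy (-1ℤ - u) (-[1+ 1 ] - w))
        ≡⟨ cong -_ (sumℤ-cong M (λ u → sumℤ-flip -[1+ 1 ] (xy (-1ℤ - u)) (λ w l → xy-supp (-1ℤ - u) w (inj₂ l)) n+4≤M)) ⟩
      - sumℤ M (λ u → sumℤ M (xy (-1ℤ - u))) ≡⟨ cong -_ (sumℤ-reflect M (λ u → sumℤ M (xy u))) ⟩
      - sumℤ² M xy ∎
    where
    open ≡.≡-Reasoning
    eq : ∀ u w → + 25 * u * u + + 25 * w * w + (+ 5 + + 10 * + 4) * u + (+ 5 + + 20 * + 4) * w + (+ 5 * + 4 * + 4 + + 3 * + 4)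
      ≡ (+ 2 + (+ 5 * (-1ℤ - u) * (-1ℤ - u) + (-1ℤ - u)) * + 5) + (+ 5 * (-[1+ 1 ] - w) * (-[1+ 1 ] - w) + + 3 * (-[1+ 1 ] - w)) * + 5
    eq = solve-∀
    signs : ∀ a b d → a * b * 1ℤ * d ≡ -1ℤ * ((- a) * b * d)
    signs = solve-∀
    term : ∀ u w → g 4 u w ≡ -1ℤ * xy (-1ℤ - u) (-[1+ 1 ] - w)
    term u w = trans (signs (sg u) (sg w) (kron (rot 4 u w) n)) (cong₂ (λ s d → -1ℤ * (s * d)) (cong₂ _*_ (sym (sg-reflect u)) (sym (sg-reflect₂ w)))
      (cong (λ m → kron m n) (half-unique (half-rot 4 u w) (half-+ (half-+ {1} (half refl) (half-*5 (half-eX (-1ℤ - u)))) (half-*5 (half-eY (-[1+ 1 ] - w)))) (eq u w))))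

  coefficient : (X ⊗ Y) n ≡ (dil X ⊗ dil X ⊕ ⊝ ((q ^ 2 ⊗ dil Y) ⊗ dil Y) ⊕ ⊝ ((q ^ 1 ⊗ dil X) ⊗ dil Y)) n
  coefficient = begin
      (X ⊗ Y) n ≡⟨ Theta-⊗ X-theta Y-theta n (ℕ.≤-trans n+2≤M (ℕ.m≤m*n M 5)) ⟩
      sumℤ² (M ℕ.* 5) f ≡⟨ lattice {suc n} {M} f (kron-supp² (λ u w → sg u * sg w) eX eY (bound X-theta) (bound Y-theta) n) le ⟩
      sum5 (λ c → sumℤ² M (λ u w → f (+ 2 * u - w) (u + + 2 * w + + c)))
        ≡⟨ sum5-cong (λ c _ → sumℤ²-cong M (λ u w → cong (_* kron (rot c u w) n) (sg-rotate u w c))) ⟩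
      sum5 (λ c → sumℤ² M (g c)) ≡⟨ cong₂ _+_ (cong₂ _+_ (cong₂ _+_ (cong₂ _+_ case₀ case₁) case₂) case₃) case₄ ⟩
      sumℤ² M xx + 0ℤ + 0ℤ - sumℤ² M yy - sumℤ² M xy
        ≡⟨ zeros (sumℤ² M xx) (sumℤ² M yy) (sumℤ² M xy) ⟩
      sumℤ² M xx - sumℤ² M yy - sumℤ² M xy
        ≡⟨ cong₂ _-_ (cong₂ _-_ (Theta-⊗ X₅ X₅ n n+2≤M) (Theta-⊗ (Theta-q^ 2 Y₅) Y₅ n n+2≤M)) (Theta-⊗ (Theta-q^ 1 X₅) Y₅ n n+2≤M) ⟨
      (dil X ⊗ dil X) n - ((q ^ 2 ⊗ dil Y) ⊗ dil Y) n - ((q ^ 1 ⊗ dil X) ⊗ dil Y) n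
        ≡⟨ trans (⊕-at _ _ n) (cong₂ _+_ (trans (⊕-at _ _ n) (cong (λ x → (dil X ⊗ dil X) n + x) (⊝-at _ n))) (⊝-at _ n)) ⟨
      (dil X ⊗ dil X ⊕ ⊝ ((q ^ 2 ⊗ dil Y) ⊗ dil Y) ⊕ ⊝ ((q ^ 1 ⊗ dil X) ⊗ dil Y)) n ∎
    where
    open ≡.≡-Reasoning
    zeros : ∀ a b c → a + 0ℤ + 0ℤ - b - c ≡ a - b - c
    zeros = solve-∀
    X₅ = Theta-dil X-theta
    Y₅ = Theta-dil Y-theta

XY-dissection : X ⊗ Y ≈ dil X ⊗ dil X ⊕ ⊝ ((q ^ 2 ⊗ dil Y) ⊗ dil Y) ⊕ ⊝ ((q ^ 1 ⊗ dil X) ⊗ dil Y)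
XY-dissection = ⟪ (λ n → XY-coefficient.coefficient n _ ℕ.≤-refl) ⟫

-- 8 (X Y + 5 (X θY − θX Y)) = Σ ± (y² − x²) q^{(x² + y² − 10)/40} with x = 10k+1, y = 10l+3, while
-- f₁⁶ = ¼ Σ ± uw q^{(u² + w² − 2)/8} over odd u = 2U+1, w = 2W+1.  For x + iy = (2 + i)(u + iw) one has
-- y² − x² = 8uw + 3w² − 3u², whose last two terms cancel by symmetry.
module Wronskian-coefficient (n M : ℕ) (le : 22 ℕ.* suc (suc n) ℕ.≤ M) where

  open ≡.≡-Reasoning

  n+2≤M : suc (suc n) ℕ.≤ M
  n+2≤M = ℕ.≤-trans (ℕ.m≤m+n (suc (suc n)) _) le

  n+4≤M : suc (suc (suc (suc n))) ℕ.≤ M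
  n+4≤M = ℕ.≤-trans (ℕ.≤-trans (s≤s (s≤s (ℕ.m≤n+m (suc (suc n)) n))) (ℕ.+-monoʳ-≤ (suc (suc n)) (ℕ.m≤m+n (suc (suc n)) (20 ℕ.* suc (suc n))))) le

  Δ : ℤ → ℤ → ℤ
  Δ k l = (+ 10 * l + + 3) * (+ 10 * l + + 3) - (+ 10 * k + + 1) * (+ 10 * k + + 1)

  h : ℤ → ℤ → ℤ
  h k l = sg k * sg l * Δ k l * kron (eX k ℕ.+ eY l) n

  W : PS
  W = X ⊗ Y ⊕ const (+ 5) ⊗ (X ⊗ θ Y ⊕ ⊝ (θ X ⊗ Y))

  -- The exponents satisfy 40 `eX` = x² - 1 and 40 `eY` = y² - 9, so eight times the weight 1 +
  -- 5(`eY` - `eX`) is y² - x².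
  8W≡ : + 8 * W n ≡ sumℤ² M h
  8W≡ = begin
      + 8 * W n ≡⟨ cong (+ 8 *_) (trans (⊕-at _ _ n) (cong (λ x → (X ⊗ Y) n + x) (trans (scale-at (+ 5) _ n) (cong (+ 5 *_) (trans (⊕-at _ _ n) (cong (λ x → (X ⊗ θ Y) n + x) (⊝-at _ n))))))) ⟩
      + 8 * ((X ⊗ Y) n + + 5 * ((X ⊗ θ Y) n - (θ X ⊗ Y) n))
        ≡⟨ cong₂ (λ a d → + 8 * (a + + 5 * d)) (Theta-⊗ X-theta Y-theta n n+2≤M)
             (cong₂ _-_ (Theta-⊗ X-theta (Theta-θ Y-theta) n n+2≤M) (Theta-⊗ (Theta-θ X-theta) Y-theta n n+2≤M)) ⟩
      + 8 * (sumℤ² M a + + 5 * (sumℤ² M b - sumℤ² M c)) ≡⟨ expand (sumℤ² M a) (sumℤ² M b) (sumℤ² M c) ⟩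
      + 8 * sumℤ² M a + (+ 40 * sumℤ² M b + - (+ 40) * sumℤ² M c)
        ≡⟨ cong₂ _+_ (sumℤ²-* M (+ 8) a) (cong₂ _+_ (sumℤ²-* M (+ 40) b) (sumℤ²-* M (- (+ 40)) c)) ⟨
      sumℤ² M (λ k l → + 8 * a k l) + (sumℤ² M (λ k l → + 40 * b k l) + sumℤ² M (λ k l → - (+ 40) * c k l))
        ≡⟨ trans (sumℤ²-+ M (λ k l → + 8 * a k l) (λ k l → + 40 * b k l + - (+ 40) * c k l))
             (cong (λ x → sumℤ² M (λ k l → + 8 * a k l) + x) (sumℤ²-+ M (λ k l → + 40 * b k l) (λ k l → - (+ 40) * c k l))) ⟨
      sumℤ² M (λ k l → + 8 * a k l + (+ 40 * b k l + - (+ 40) * c k l)) ≡⟨ sumℤ²-cong M term ⟩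
      sumℤ² M h ∎
    where
    a b c : ℤ → ℤ → ℤ
    a k l = sg k * sg l * kron (eX k ℕ.+ eY l) n
    b k l = sg k * (sg l * + eY l) * kron (eX k ℕ.+ eY l) n
    c k l = sg k * + eX k * sg l * kron (eX k ℕ.+ eY l) n
    expand : ∀ a b c → + 8 * (a + + 5 * (b - c)) ≡ + 8 * a + (+ 40 * b + - (+ 40) * c)
    expand = solve-∀
    collect : ∀ s t x y d → + 8 * (s * t * d) + (+ 40 * (s * (t * y) * d) + - (+ 40) * (s * x * t * d))
      ≡ s * t * (+ 8 + + 20 * (+ 2 * y) - + 20 * (+ 2 * x)) * d
    collect = solve-∀
    weight : ∀ k l → + 8 + + 20 * (+ 5 * l * l + + 3 * l) - + 20 * (+ 5 * k * k + k)
      ≡ (+ 10 * l + + 3) * (+ 10 * l + + 3) - (+ 10 * k + + 1) * (+ 10 * k + + 1)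
    weight = solve-∀
    term : ∀ k l → + 8 * a k l + (+ 40 * b k l + - (+ 40) * c k l) ≡ h k l
    term k l = trans (collect (sg k) (sg l) (+ eX k) (+ eY l) (kron (eX k ℕ.+ eY l) n))
      (cong (λ x → sg k * sg l * x * kron (eX k ℕ.+ eY l) n)
        (trans (cong₂ (λ y x → + 8 + + 20 * y - + 20 * x) (doubled (half-eY l)) (doubled (half-eX k))) (weight k l)))

  odd : ℤ → ℤ
  odd k = + 2 * k + 1ℤ

  ω : ℤ → ℤ → ℤ
  ω w u = + 8 * u * w + + 3 * w * w - + 3 * u * u

  f : ℤ → ℤ → ℤ
  f k l = sg k * sg l * ω (odd k) (odd l) * kron (eT k ℕ.+ eT l) n

  f₁³ : PS
  f₁³ = const (+ 2) ⊗ f₁ ^ 3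

  f-sum : ∀ {N} → suc (suc n) ℕ.≤ N → sumℤ² N f ≡ + 8 * (f₁³ ⊗ f₁³) n
  f-sum {N} l = begin
      sumℤ² N f ≡⟨ sumℤ²-cong N split ⟩
      sumℤ² N (λ k l → + 8 * a k l + (b k l + -1ℤ * b l k))
        ≡⟨ trans (sumℤ²-+ N (λ k l → + 8 * a k l) (λ k l → b k l + -1ℤ * b l k))
             (cong₂ _+_ (sumℤ²-* N (+ 8) a) (trans (sumℤ²-+ N b (λ k l → -1ℤ * b l k)) (cong (λ x → sumℤ² N b + x) (sumℤ²-* N -1ℤ (λ k l → b l k))))) ⟩
      + 8 * sumℤ² N a + (sumℤ² N b + -1ℤ * sumℤ² N (λ k l → b l k))
        ≡⟨ cong (λ x → + 8 * sumℤ² N a + (sumℤ² N b + -1ℤ * x)) (sym (sumℤ²-swap N b)) ⟩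
      + 8 * sumℤ² N a + (sumℤ² N b + -1ℤ * sumℤ² N b) ≡⟨ cancel (sumℤ² N a) (sumℤ² N b) ⟩
      + 8 * sumℤ² N a ≡⟨ cong (+ 8 *_) (Theta-⊗ JacobiCube.cube JacobiCube.cube n l) ⟨
      + 8 * (f₁³ ⊗ f₁³) n ∎
    where
    a b : ℤ → ℤ → ℤ
    a k l = (odd k * sg k) * (odd l * sg l) * kron (eT k ℕ.+ eT l) n
    b k l = sg k * sg l * (+ 3 * odd k * odd k) * kron (eT k ℕ.+ eT l) n
    cancel : ∀ a b → + 8 * a + (b + -1ℤ * b) ≡ + 8 * a
    cancel = solve-∀
    distribute : ∀ s t w u d → s * t * (+ 8 * u * w + + 3 * w * w - + 3 * u * u) * d
      ≡ + 8 * ((w * s) * (u * t) * d) + (s * t * (+ 3 * w * w) * d + -1ℤ * (t * s * (+ 3 * u * u) * d))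
    distribute = solve-∀
    split : ∀ k l → f k l ≡ + 8 * a k l + (b k l + -1ℤ * b l k)
    split k l = trans (distribute (sg k) (sg l) (odd k) (odd l) (kron (eT k ℕ.+ eT l) n))
      (cong (λ e → + 8 * a k l + (b k l + -1ℤ * (sg l * sg k * (+ 3 * odd l * odd l) * kron e n))) (ℕ.+-comm (eT k) (eT l)))

  rot : ℕ → ℤ → ℤ → ℕ
  rot c l k = eT (+ 2 * l - k) ℕ.+ eT (l + + 2 * k + + c)

  half-rot : ∀ c l k → Half (rot c l k) (+ 5 * l * l + + 5 * k * k + (+ 3 + + 2 * + c) * l + (+ 1 + + 4 * + c) * k + (+ c * + c + + c))
  half-rot c l k = half-≡ (expand l k (+ c)) (half-+ (half-eT (+ 2 * l - k)) (half-eT (l + + 2 * k + + c)))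
    where
    expand : ∀ l k c → ((+ 2 * l - k) * (+ 2 * l - k) + (+ 2 * l - k)) + ((l + + 2 * k + c) * (l + + 2 * k + c) + (l + + 2 * k + c))
      ≡ + 5 * l * l + + 5 * k * k + (+ 3 + + 2 * c) * l + (+ 1 + + 4 * c) * k + (c * c + c)
    expand = solve-∀

  ρ : ℕ → ℤ → ℤ → ℤ
  ρ c l k = (+ 10 * l + + 2 * + c + + 3) * (+ 10 * l + + 2 * + c + + 3) - (+ 10 * k + + 4 * + c + 1ℤ) * (+ 10 * k + + 4 * + c + 1ℤ)

  ω≡ρ : ∀ c l k → ω (odd (+ 2 * l - k)) (odd (l + + 2 * k + + c)) ≡ ρ c l k
  ω≡ρ c l k = expand l k (+ c)
    where
    expand : ∀ l k c → + 8 * (+ 2 * (l + + 2 * k + c) + 1ℤ) * (+ 2 * (+ 2 * l - k) + 1ℤ) + + 3 * (+ 2 * (+ 2 * l - k) + 1ℤ) * (+ 2 * (+ 2 * l - k) + 1ℤ) - + 3 * (+ 2 * (l + + 2 * k + c) + 1ℤ) * (+ 2 * (l + + 2 * k + c) + 1ℤ)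
      ≡ (+ 10 * l + + 2 * c + + 3) * (+ 10 * l + + 2 * c + + 3) - (+ 10 * k + + 4 * c + 1ℤ) * (+ 10 * k + + 4 * c + 1ℤ)
    expand = solve-∀

  g : ℕ → ℤ → ℤ → ℤ
  g c l k = sg l * sg k * sgℕ c * ρ c l k * kron (rot c l k) n

  h-supp : Supp² (suc (suc n)) h
  h-supp = kron-supp² (λ k l → sg k * sg l * Δ k l) eX eY (bound X-theta) (bound Y-theta) n

  to-h : ∀ c l k {k′ l′} → sg l * sg k * sgℕ c * ρ c l k ≡ sg k′ * sg l′ * Δ k′ l′ → rot c l k ≡ eX k′ ℕ.+ eY l′ → g c l k ≡ h k′ l′
  to-h c l k p e = cong₂ _*_ p (cong (λ m → kron m n) e)

  case₀ : sumℤ² M (g 0) ≡ sumℤ² M h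
  case₀ = trans (sumℤ²-cong M term) (sumℤ²-swap M (λ l k → h k l))
    where
    eq : ∀ l k → + 5 * l * l + + 5 * k * k + (+ 3 + + 2 * + 0) * l + (+ 1 + + 4 * + 0) * k + (+ 0 * + 0 + + 0)
      ≡ (+ 5 * k * k + k) + (+ 5 * l * l + + 3 * l)
    eq = solve-∀
    weight : ∀ s t l k → s * t * 1ℤ * ((+ 10 * l + + 2 * + 0 + + 3) * (+ 10 * l + + 2 * + 0 + + 3) - (+ 10 * k + + 4 * + 0 + 1ℤ) * (+ 10 * k + + 4 * + 0 + 1ℤ))
      ≡ t * s * ((+ 10 * l + + 3) * (+ 10 * l + + 3) - (+ 10 * k + + 1) * (+ 10 * k + + 1))
    weight = solve-∀
    term : ∀ l k → g 0 l k ≡ h k l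
    term l k = to-h 0 l k {k′ = k} {l′ = l} (weight (sg l) (sg k) l k) (half-unique (half-rot 0 l k) (half-+ (half-eX k) (half-eY l)) (eq l k))

  -- Here x = 10k + 5 and y = 10l + 5, so exchanging k and l negates y² - x² and preserves sign and
  -- exponent.
  case₁ : sumℤ² M (g 1) ≡ 0ℤ
  case₁ = 2i≡0 (begin
      sumℤ² M (g 1) + sumℤ² M (g 1) ≡⟨ cong (λ x → sumℤ² M (g 1) + x) (sumℤ²-swap M (g 1)) ⟩
      sumℤ² M (g 1) + sumℤ² M (λ l k → g 1 k l) ≡⟨ sumℤ²-+ M (g 1) (λ l k → g 1 k l) ⟨
      sumℤ² M (λ l k → g 1 l k + g 1 k l) ≡⟨ sumℤ-zero M (λ l → sumℤ-zero M (λ k → anti l k)) ⟩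
      0ℤ ∎)
    where
    2i≡0 : ∀ {i} → i + i ≡ 0ℤ → i ≡ 0ℤ
    2i≡0 {i} p = ℤ.*-cancelˡ-≡ (+ 2) i 0ℤ (trans (two i) p)
      where
      two : ∀ i → + 2 * i ≡ i + i
      two = solve-∀
    eq : ∀ l k → + 5 * k * k + + 5 * l * l + (+ 3 + + 2 * + 1) * k + (+ 1 + + 4 * + 1) * l + (+ 1 * + 1 + + 1)
      ≡ + 5 * l * l + + 5 * k * k + (+ 3 + + 2 * + 1) * l + (+ 1 + + 4 * + 1) * k + (+ 1 * + 1 + + 1)
    eq = solve-∀
    weight : ∀ s t l k d → s * t * -1ℤ * ((+ 10 * l + + 2 * + 1 + + 3) * (+ 10 * l + + 2 * + 1 + + 3) - (+ 10 * k + + 4 * + 1 + 1ℤ) * (+ 10 * k + + 4 * + 1 + 1ℤ)) * d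
      + t * s * -1ℤ * ((+ 10 * k + + 2 * + 1 + + 3) * (+ 10 * k + + 2 * + 1 + + 3) - (+ 10 * l + + 4 * + 1 + 1ℤ) * (+ 10 * l + + 4 * + 1 + 1ℤ)) * d ≡ 0ℤ
    weight = solve-∀
    anti : ∀ l k → g 1 l k + g 1 k l ≡ 0ℤ
    anti l k = trans (cong (λ m → g 1 l k + sg k * sg l * sgℕ 1 * ρ 1 k l * kron m n) (half-unique (half-rot 1 k l) (half-rot 1 l k) (eq l k)))
      (weight (sg l) (sg k) l k (kron (rot 1 l k) n))

  -- Reflecting both indices turns x = 10k + 9 and y = 10l + 7 into negatives of the standard shapes
  -- 10k + 1 and 10l + 3.
  case₂ : sumℤ² M (g 2) ≡ sumℤ² M h
  case₂ = begin
      sumℤ² M (g 2) ≡⟨ sumℤ²-cong M term ⟩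
      sumℤ M (λ l → sumℤ M (λ k → h (-1ℤ - k) (-1ℤ - l))) ≡⟨ sumℤ-cong M (λ l → sumℤ-reflect M (λ k → h k (-1ℤ - l))) ⟩
      sumℤ M (λ l → sumℤ M (λ k → h k (-1ℤ - l))) ≡⟨ sumℤ-reflect M (λ l → sumℤ M (λ k → h k l)) ⟩
      sumℤ M (λ l → sumℤ M (λ k → h k l)) ≡⟨ sumℤ²-swap M (λ l k → h k l) ⟩
      sumℤ² M h ∎
    where
    eq : ∀ l k → + 5 * l * l + + 5 * k * k + (+ 3 + + 2 * + 2) * l + (+ 1 + + 4 * + 2) * k + (+ 2 * + 2 + + 2)
      ≡ (+ 5 * (-1ℤ - k) * (-1ℤ - k) + (-1ℤ - k)) + (+ 5 * (-1ℤ - l) * (-1ℤ - l) + + 3 * (-1ℤ - l))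
    eq = solve-∀
    weight : ∀ s t l k → s * t * 1ℤ * ((+ 10 * l + + 2 * + 2 + + 3) * (+ 10 * l + + 2 * + 2 + + 3) - (+ 10 * k + + 4 * + 2 + 1ℤ) * (+ 10 * k + + 4 * + 2 + 1ℤ))
      ≡ (- t) * (- s) * ((+ 10 * (-1ℤ - l) + + 3) * (+ 10 * (-1ℤ - l) + + 3) - (+ 10 * (-1ℤ - k) + + 1) * (+ 10 * (-1ℤ - k) + + 1))
    weight = solve-∀
    term : ∀ l k → g 2 l k ≡ h (-1ℤ - k) (-1ℤ - l)
    term l k = to-h 2 l k {k′ = -1ℤ - k} {l′ = -1ℤ - l} (trans (weight (sg l) (sg k) l k) (cong₂ (λ s t → s * t * Δ (-1ℤ - k) (-1ℤ - l)) (sym (sg-reflect k)) (sym (sg-reflect l))))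
      (half-unique (half-rot 2 l k) (half-+ (half-eX (-1ℤ - k)) (half-eY (-1ℤ - l))) (eq l k))

  -- Now x has the shape 10k + 3 and y, up to sign, the shape 10l + 1. The exchange negates y² - x²,
  -- which the sign (-1)³ of the coset makes up for.
  case₃ : sumℤ² M (g 3) ≡ sumℤ² M h
  case₃ = begin
      sumℤ² M (g 3) ≡⟨ sumℤ²-cong M term ⟩
      sumℤ M (λ l → sumℤ M (λ k → h (-1ℤ - l) (1ℤ + k))) ≡⟨ sumℤ-cong M (λ l → sumℤ-shift1 (h (-1ℤ - l)) (λ k p → h-supp (-1ℤ - l) k (inj₂ p)) n+2≤M) ⟩
      sumℤ M (λ l → sumℤ M (h (-1ℤ - l))) ≡⟨ sumℤ-reflect M (λ l → sumℤ M (h l)) ⟩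
      sumℤ² M h ∎
    where
    eq : ∀ l k → + 5 * l * l + + 5 * k * k + (+ 3 + + 2 * + 3) * l + (+ 1 + + 4 * + 3) * k + (+ 3 * + 3 + + 3)
      ≡ (+ 5 * (-1ℤ - l) * (-1ℤ - l) + (-1ℤ - l)) + (+ 5 * (1ℤ + k) * (1ℤ + k) + + 3 * (1ℤ + k))
    eq = solve-∀
    weight : ∀ s t l k → s * t * -1ℤ * ((+ 10 * l + + 2 * + 3 + + 3) * (+ 10 * l + + 2 * + 3 + + 3) - (+ 10 * k + + 4 * + 3 + 1ℤ) * (+ 10 * k + + 4 * + 3 + 1ℤ))
      ≡ (- s) * (- t) * ((+ 10 * (1ℤ + k) + + 3) * (+ 10 * (1ℤ + k) + + 3) - (+ 10 * (-1ℤ - l) + + 1) * (+ 10 * (-1ℤ - l) + + 1))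
    weight = solve-∀
    term : ∀ l k → g 3 l k ≡ h (-1ℤ - l) (1ℤ + k)
    term l k = to-h 3 l k {k′ = -1ℤ - l} {l′ = 1ℤ + k} (trans (weight (sg l) (sg k) l k) (cong₂ (λ s t → s * t * Δ (-1ℤ - l) (1ℤ + k)) (sym (sg-reflect l)) (sym (sg-suc k))))
      (half-unique (half-rot 3 l k) (half-+ (half-eX (-1ℤ - l)) (half-eY (1ℤ + k))) (eq l k))

  -- The shapes are exchanged as in `case₃`; the compensating sign comes from the shift l ↦ l + 1.
  case₄ : sumℤ² M (g 4) ≡ sumℤ² M h
  case₄ = begin
      sumℤ² M (g 4) ≡⟨ sumℤ²-cong M term ⟩
      sumℤ M (λ l → sumℤ M (λ k → h (1ℤ + l) (-[1+ 1 ] - k))) ≡⟨ sumℤ-cong M (λ l → sumℤ-flip -[1+ 1 ] (h (1ℤ + l)) (λ k p → h-supp (1ℤ + l) k (inj₂ p)) n+4≤M) ⟩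
      sumℤ M (λ l → sumℤ M (h (1ℤ + l))) ≡⟨ sumℤ-shift1 (λ l → sumℤ M (h l)) (λ l p → sumℤ-zero M (λ k → h-supp l k (inj₁ p))) n+2≤M ⟩
      sumℤ² M h ∎
    where
    eq : ∀ l k → + 5 * l * l + + 5 * k * k + (+ 3 + + 2 * + 4) * l + (+ 1 + + 4 * + 4) * k + (+ 4 * + 4 + + 4)
      ≡ (+ 5 * (1ℤ + l) * (1ℤ + l) + (1ℤ + l)) + (+ 5 * (-[1+ 1 ] - k) * (-[1+ 1 ] - k) + + 3 * (-[1+ 1 ] - k))
    eq = solve-∀
    weight : ∀ s t l k → s * t * 1ℤ * ((+ 10 * l + + 2 * + 4 + + 3) * (+ 10 * l + + 2 * + 4 + + 3) - (+ 10 * k + + 4 * + 4 + 1ℤ) * (+ 10 * k + + 4 * + 4 + 1ℤ))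
      ≡ (- s) * t * ((+ 10 * (-[1+ 1 ] - k) + + 3) * (+ 10 * (-[1+ 1 ] - k) + + 3) - (+ 10 * (1ℤ + l) + + 1) * (+ 10 * (1ℤ + l) + + 1))
    weight = solve-∀
    term : ∀ l k → g 4 l k ≡ h (1ℤ + l) (-[1+ 1 ] - k)
    term l k = to-h 4 l k {k′ = 1ℤ + l} {l′ = -[1+ 1 ] - k} (trans (weight (sg l) (sg k) l k) (cong₂ (λ s t → s * t * Δ (1ℤ + l) (-[1+ 1 ] - k)) (sym (sg-suc l)) (sym (sg-reflect₂ k))))
      (half-unique (half-rot 4 l k) (half-+ (half-eX (1ℤ + l)) (half-eY (-[1+ 1 ] - k))) (eq l k))

  -- Four cosets reproduce the sum for 8W and one vanishes, while the square of 2f₁³ contributes 4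
  -- and `f-sum` contributes 8: both sides carry the factor 32.
  coefficient : W n ≡ (f₁ ^ 6) n
  coefficient = ℤ.*-cancelˡ-≡ (+ 32) (W n) ((f₁ ^ 6) n) (begin
      + 32 * W n ≡⟨ ℤ.*-assoc (+ 4) (+ 8) (W n) ⟩
      + 4 * (+ 8 * W n) ≡⟨ cong (+ 4 *_) 8W≡ ⟩
      + 4 * sumℤ² M h ≡⟨ four (sumℤ² M h) ⟩
      sumℤ² M h + 0ℤ + sumℤ² M h + sumℤ² M h + sumℤ² M h ≡⟨ cong₂ _+_ (cong₂ _+_ (cong₂ _+_ (cong₂ _+_ case₀ case₁) case₂) case₃) case₄ ⟨
      sum5 (λ c → sumℤ² M (g c)) ≡⟨ sum5-cong (λ c _ → sumℤ²-cong M (λ u w → cong₂ (λ s p → s * p * kron (rot c u w) n) (sg-rotate u w c) (ω≡ρ c u w))) ⟨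
      sum5 (λ c → sumℤ² M (λ u w → f (+ 2 * u - w) (u + + 2 * w + + c)))
        ≡⟨ lattice {suc n} {M} f (kron-supp² (λ k l → sg k * sg l * ω (odd k) (odd l)) eT eT (bound JacobiCube.cube) (bound JacobiCube.cube) n) le ⟨
      sumℤ² (M ℕ.* 5) f ≡⟨ f-sum (ℕ.≤-trans n+2≤M (ℕ.m≤m*n M 5)) ⟩
      + 8 * (f₁³ ⊗ f₁³) n ≡⟨ cong (+ 8 *_) (trans (at (solve 1 (λ x → (con (+ 2) :* x :^ 3) :* (con (+ 2) :* x :^ 3) := con (+ 4) :* x :^ 6) ≈-refl f₁) n) (scale-at (+ 4) (f₁ ^ 6) n)) ⟩
      + 8 * (+ 4 * (f₁ ^ 6) n) ≡⟨ ℤ.*-assoc (+ 8) (+ 4) ((f₁ ^ 6) n) ⟨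
      + 32 * (f₁ ^ 6) n ∎)
    where
    open Solver
    four : ∀ x → + 4 * x ≡ x + 0ℤ + x + x + x
    four = solve-∀

Wronskian : X ⊗ Y ⊕ const (+ 5) ⊗ (X ⊗ θ Y ⊕ ⊝ (θ X ⊗ Y)) ≈ f₁ ^ 6
Wronskian = ⟪ (λ n → Wronskian-coefficient.coefficient n _ ℕ.≤-refl) ⟫

-- The products G and H, their reciprocals, and R = H/G

a b G H f₁⁻¹ f₅⁻¹ : PS
a = Π 0 4 ⊗ Π 3 4
b = Π 1 4 ⊗ Π 2 4
G = Π⁻¹ 0 4 ⊗ Π⁻¹ 3 4
H = Π⁻¹ 1 4 ⊗ Π⁻¹ 2 4
f₁⁻¹ = Π⁻¹ 0 0
f₅⁻¹ = Π⁻¹ 4 4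

r r⁻¹ : PS
r = a ⊗ H
r⁻¹ = b ⊗ G

aG≈1 : a ⊗ G ≈ const 1ℤ
aG≈1 = ≈-trans (solve 4 (λ x y z w → (x :* y) :* (z :* w) := (x :* z) :* (y :* w)) ≈-refl (Π 0 4) (Π 3 4) (Π⁻¹ 0 4) (Π⁻¹ 3 4))
  (≈-trans (⊗-cong (Π-inverse 0 4) (Π-inverse 3 4)) (⊗-identityˡ _))
  where
  open Solver

bH≈1 : b ⊗ H ≈ const 1ℤ
bH≈1 = ≈-trans (solve 4 (λ x y z w → (x :* y) :* (z :* w) := (x :* z) :* (y :* w)) ≈-refl (Π 1 4) (Π 2 4) (Π⁻¹ 1 4) (Π⁻¹ 2 4))
  (≈-trans (⊗-cong (Π-inverse 1 4) (Π-inverse 2 4)) (⊗-identityˡ _))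
  where
  open Solver

r⊗r⁻¹≈1 : r ⊗ r⁻¹ ≈ const 1ℤ
r⊗r⁻¹≈1 = ≈-trans (solve 4 (λ a h b g → (a :* h) :* (b :* g) := (a :* g) :* (b :* h)) ≈-refl a H b G)
  (≈-trans (⊗-cong aG≈1 bH≈1) (⊗-identityˡ _))
  where
  open Solver

Π-head : ∀ c d → Π c d 0 ≡ 1ℤ
Π-head c d = lim-head (Tame-1-q^ c d)

Π⁻¹-head : ∀ c d → Π⁻¹ c d 0 ≡ 1ℤ
Π⁻¹-head c d = lim-head (Tame-geom c d)

a-head : a 0 ≡ 1ℤ
a-head = ⊗-head1 (Π-head 0 4) (Π-head 3 4)

b-head : b 0 ≡ 1ℤ
b-head = ⊗-head1 (Π-head 1 4) (Π-head 2 4)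

H-head : H 0 ≡ 1ℤ
H-head = ⊗-head1 (Π⁻¹-head 1 4) (Π⁻¹-head 2 4)

r-head : r 0 ≡ 1ℤ
r-head = ⊗-head1 a-head H-head

five : (ℕ → PS) → ℕ → PS
five F k = F (k ℕ.* 5) ⊗ F (1 ℕ.+ k ℕ.* 5) ⊗ F (2 ℕ.+ k ℕ.* 5) ⊗ F (3 ℕ.+ k ℕ.* 5) ⊗ F (4 ℕ.+ k ℕ.* 5)

prod-five : ∀ F N → prod F (N ℕ.* 5) ≈ prod (five F) N
prod-five F zero = ≈-refl
prod-five F (suc N) = ≈-trans (⊗-cong (⊗-cong (⊗-cong (⊗-cong (⊗-cong (prod-five F N) ≈-refl) ≈-refl) ≈-refl) ≈-refl) ≈-refl)
  (solve 6 (λ p x y z w t → p :* x :* y :* z :* w :* t := p :* (x :* y :* z :* w :* t)) ≈-refl (prod (five F) N)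
    (F (N ℕ.* 5)) (F (1 ℕ.+ N ℕ.* 5)) (F (2 ℕ.+ N ℕ.* 5)) (F (3 ℕ.+ N ℕ.* 5)) (F (4 ℕ.+ N ℕ.* 5)))
  where
  open Solver

lim-five : ∀ {F} → Tame F → Tame (five F) → lim F ≈ lim (five F)
lim-five {F} t t₅ = ≈[]⇒≈ (λ N → ≈[]-trans (≈[]-weaken (ℕ.m≤m*n N 5) (lim≈[]prod t (N ℕ.* 5)))
  (≈[]-trans (≈⇒≈[] N (prod-five F N)) (≈[]-sym (lim≈[]prod t₅ N))))

-- Taking the factors 1 - q^m five at a time sorts them by m modulo 5.
f₁≈abf₅ : f₁ ≈ a ⊗ b ⊗ f₅
f₁≈abf₅ = ≈-trans (lim-five (Tame-1-q^ 0 0) t₅) (≈-trans (lim-cong regroup) (≈-trans (lim-⊗ (Tame-⊗ (Tame-⊗ T₀ T₃) (Tame-⊗ T₁ T₂)) T₄)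
    (⊗-cong (≈-trans (lim-⊗ (Tame-⊗ T₀ T₃) (Tame-⊗ T₁ T₂)) (⊗-cong (lim-⊗ T₀ T₃) (lim-⊗ T₁ T₂))) ≈-refl)))
  where
  open Solver
  T₀ = Tame-1-q^ 0 4
  T₁ = Tame-1-q^ 1 4
  T₂ = Tame-1-q^ 2 4
  T₃ = Tame-1-q^ 3 4
  T₄ = Tame-1-q^ 4 4
  factor : ∀ c k → 1-q^ (suc 0 ℕ.+ suc 0 ℕ.* (c ℕ.+ k ℕ.* 5)) ≈ 1-q^ (suc c ℕ.+ 5 ℕ.* k)
  factor c k = ≡⇒≈ (cong 1-q^ (arith c k))
    where
    arith : ∀ c k → suc 0 ℕ.+ suc 0 ℕ.* (c ℕ.+ k ℕ.* 5) ≡ suc c ℕ.+ 5 ℕ.* k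
    arith = solveℕ-∀
  regroup : ∀ k → five (λ k → 1-q^ (suc 0 ℕ.+ suc 0 ℕ.* k)) k ≈
    ((1-q^ (1 ℕ.+ 5 ℕ.* k) ⊗ 1-q^ (4 ℕ.+ 5 ℕ.* k)) ⊗ (1-q^ (2 ℕ.+ 5 ℕ.* k) ⊗ 1-q^ (3 ℕ.+ 5 ℕ.* k))) ⊗ 1-q^ (5 ℕ.+ 5 ℕ.* k)
  regroup k = ≈-trans (⊗-cong (⊗-cong (⊗-cong (⊗-cong (factor 0 k) (factor 1 k)) (factor 2 k)) (factor 3 k)) (factor 4 k))
    (solve 5 (λ x y z w t → x :* y :* z :* w :* t := ((x :* w) :* (y :* z)) :* t) ≈-refl
      (1-q^ (1 ℕ.+ 5 ℕ.* k)) (1-q^ (2 ℕ.+ 5 ℕ.* k)) (1-q^ (3 ℕ.+ 5 ℕ.* k)) (1-q^ (4 ℕ.+ 5 ℕ.* k)) (1-q^ (5 ℕ.+ 5 ℕ.* k)))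
  t₅ : Tame (five (λ k → 1-q^ (suc 0 ℕ.+ suc 0 ℕ.* k)))
  t₅ k = ≈[]-trans (≈⇒≈[] (suc k) (regroup k)) (Tame-⊗ (Tame-⊗ (Tame-⊗ T₀ T₃) (Tame-⊗ T₁ T₂)) T₄ k)

dil-1-q^ : ∀ m → dil (1-q^ m) ≈ 1-q^ (5 ℕ.* m)
dil-1-q^ m = ≈-trans (dil-⊕ (const 1ℤ) (⊝ q ^ m)) (⊕-cong (dil-const 1ℤ) (≈-trans (dil-⊝ (q ^ m))
  (⊝-cong (≈-trans (dil-^ q m) (≈-trans (^-congˡ m dil-q) (^-assocʳ q 5 m))))))

dil-f₁ : dil f₁ ≈ f₅
dil-f₁ = ≈-trans (dil-lim (Tame-1-q^ 0 0)) (lim-cong (λ k → ≈-trans (dil-1-q^ (suc 0 ℕ.+ suc 0 ℕ.* k)) (≡⇒≈ (cong 1-q^ (arith k)))))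
  where
  arith : ∀ k → 5 ℕ.* (suc 0 ℕ.+ suc 0 ℕ.* k) ≡ 5 ℕ.+ 5 ℕ.* k
  arith = solveℕ-∀

-- Logarithmic derivatives

θlog-prod : ∀ F G → (∀ k → F k ⊗ G k ≈ const 1ℤ) → ∀ N → θ (prod F N) ⊗ prod G N ≈ ∑ N (λ k → θ (F k) ⊗ G k)
θlog-prod F G inv zero = ≈-trans (⊗-cong (θ-const 1ℤ) ≈-refl) (⊗-zeroˡ (const 1ℤ))
θlog-prod F G inv (suc N) = begin
    θ (prod F N ⊗ F N) ⊗ (prod G N ⊗ G N) ≈⟨ ⊗-cong (θ-⊗ (prod F N) (F N)) ≈-refl ⟩
    (θ (prod F N) ⊗ F N ⊕ prod F N ⊗ θ (F N)) ⊗ (prod G N ⊗ G N)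
      ≈⟨ solve 6 (λ p p′ x x′ y z → (p′ :* x :+ p :* x′) :* (y :* z) := (p′ :* y) :* (x :* z) :+ (p :* y) :* (x′ :* z)) ≈-refl
           (prod F N) (θ (prod F N)) (F N) (θ (F N)) (prod G N) (G N) ⟩
    (θ (prod F N) ⊗ prod G N) ⊗ (F N ⊗ G N) ⊕ (prod F N ⊗ prod G N) ⊗ (θ (F N) ⊗ G N)
      ≈⟨ ⊕-cong (⊗-cong (θlog-prod F G inv N) (inv N)) (⊗-cong (≈-trans (≈-sym (prod-⊗ F G N)) (≈-trans (prod-cong inv N) (prod-1 N))) ≈-refl) ⟩
    ∑ N (λ k → θ (F k) ⊗ G k) ⊗ const 1ℤ ⊕ const 1ℤ ⊗ (θ (F N) ⊗ G N) ≈⟨ ⊕-cong (⊗-identityʳ _) (⊗-identityˡ _) ⟩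
    ∑ N (λ k → θ (F k) ⊗ G k) ⊕ θ (F N) ⊗ G N ∎
  where
  open ≈-Reasoning
  open Solver

θlog-1-q^-at : ∀ m n → (θ (1-q^ (suc m)) ⊗ geom (suc m)) n ≡ - + suc m * (geom (suc m) n - kron 0 n)
θlog-1-q^-at m n = trans (at expand n) (trans (scale-at (- + suc m) _ n) (cong (- + suc m *_)
    (trans (⊕-at (geom (suc m)) (⊝ const 1ℤ) n) (cong (λ x → geom (suc m) n + x) (trans (⊝-at (const 1ℤ) n) (cong -_ (q^-at 0 n)))))))
  where
  open Solver
  open ≈-Reasoning
  expand : θ (1-q^ (suc m)) ⊗ geom (suc m) ≈ const (- + suc m) ⊗ (geom (suc m) ⊕ ⊝ const 1ℤ)
  expand = begin
    θ (const 1ℤ ⊕ ⊝ q ^ suc m) ⊗ geom (suc m)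
      ≈⟨ ⊗-cong (≈-trans (θ-⊕ (const 1ℤ) (⊝ q ^ suc m)) (⊕-cong (θ-const 1ℤ) (≈-trans (θ-⊝ (q ^ suc m)) (⊝-cong (θ-q^ (suc m)))))) ≈-refl ⟩
    (const 0ℤ ⊕ ⊝ (const (+ suc m) ⊗ q ^ suc m)) ⊗ geom (suc m)
      ≈⟨ solve 3 (λ c x g → (con 0ℤ :+ :- (c :* x)) :* g := :- c :* ((con 1ℤ :+ x :* g) :+ :- con 1ℤ)) ≈-refl (const (+ suc m)) (q ^ suc m) (geom (suc m)) ⟩
    ⊝ const (+ suc m) ⊗ ((const 1ℤ ⊕ q ^ suc m ⊗ geom (suc m)) ⊕ ⊝ const 1ℤ)
      ≈⟨ ⊗-cong (≈-sym (const-⊝ (+ suc m))) (⊕-cong (≈-sym (geom-rec m)) ≈-refl) ⟩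
    const (- + suc m) ⊗ (geom (suc m) ⊕ ⊝ const 1ℤ) ∎

coprime-5k+ : ∀ c → Coprime c 5 → ∀ k → Coprime (c ℕ.+ 5 ℕ.* k) 5
coprime-5k+ c p zero = subst (λ m → Coprime m 5) (sym (ℕ.+-identityʳ c)) p
coprime-5k+ c p (suc k) = subst (λ m → Coprime m 5) (arith c k) (coprime-+ (coprime-5k+ c p k))
  where
  arith : ∀ c k → 5 ℕ.+ (c ℕ.+ 5 ℕ.* k) ≡ c ℕ.+ 5 ℕ.* suc k
  arith = solveℕ-∀

geom-*5 : ∀ m n → Coprime m 5 → geom m (n ℕ.* 5) ≡ geom m n
geom-*5 m n cop with m ∣? n
... | yes d = geom-∣ (∣m⇒∣m*n 5 d)
... | no nd = geom-∤ (λ d → nd (coprime-divisor cop (subst (m ∣_) (ℕ.*-comm n 5) d)))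

θlog : ℕ → PS
θlog c = θ (Π c 4) ⊗ Π⁻¹ c 4

-- θ log (1 − qᵐ) = − Σ_{m ∣ n, n > 0} m qⁿ has the same coefficient at n and at 5n when 5 ∤ m.
comp-θlog : ∀ c → {_ : True (coprime? (suc c) 5)} → comp 0 (θlog c) ≈ θlog c
comp-θlog c {p} = ⟪ (λ n → begin
    comp 0 (θlog c) n ≡⟨ comp-at 0 (θlog c) n ⟩
    θlog c (n ℕ.* 5) ≡⟨ at< (approx (suc (n ℕ.* 5))) (n ℕ.* 5) ℕ.≤-refl ⟩
    ∑ (suc (n ℕ.* 5)) T (n ℕ.* 5) ≡⟨ ∑-at (suc (n ℕ.* 5)) T (n ℕ.* 5) ⟩
    Σ< (suc (n ℕ.* 5)) (λ k → T k (n ℕ.* 5)) ≡⟨ Σ<-cong (suc (n ℕ.* 5)) (λ k → term k n) ⟩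
    Σ< (suc (n ℕ.* 5)) (λ k → T k n) ≡⟨ ∑-at (suc (n ℕ.* 5)) T n ⟨
    ∑ (suc (n ℕ.* 5)) T n ≡⟨ at< (approx (suc (n ℕ.* 5))) n (s≤s (ℕ.m≤m*n n 5)) ⟨
    θlog c n ∎) ⟫
  where
  open ≡.≡-Reasoning
  T : ℕ → PS
  T k = θ (1-q^ (suc c ℕ.+ 5 ℕ.* k)) ⊗ geom (suc c ℕ.+ 5 ℕ.* k)
  approx : ∀ N → θlog c ≈[ N ] ∑ N T
  approx N = ≈[]-trans (⊗-cong[] (θ-cong[] (lim≈[]prod (Tame-1-q^ c 4) N)) (lim≈[]prod (Tame-geom c 4) N))
    (≈⇒≈[] N (θlog-prod (λ k → 1-q^ (suc c ℕ.+ 5 ℕ.* k)) (λ k → geom (suc c ℕ.+ 5 ℕ.* k)) (λ k → geom-inverse (c ℕ.+ 5 ℕ.* k)) N))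
  kron0 : ∀ n → kron 0 (n ℕ.* 5) ≡ kron 0 n
  kron0 zero = refl
  kron0 (suc n) = refl
  term : ∀ k n → T k (n ℕ.* 5) ≡ T k n
  term k n = trans (θlog-1-q^-at (c ℕ.+ 5 ℕ.* k) (n ℕ.* 5)) (trans
    (cong₂ (λ x y → - + suc (c ℕ.+ 5 ℕ.* k) * (x - y)) (geom-*5 (suc c ℕ.+ 5 ℕ.* k) n (coprime-5k+ (suc c) (toWitness p) k)) (kron0 n))
    (sym (θlog-1-q^-at (c ℕ.+ 5 ℕ.* k) n)))

θ-inverse : ∀ f g → f ⊗ g ≈ const 1ℤ → f ⊗ θ g ≈ ⊝ (θ f ⊗ g)
θ-inverse f g inv = ≈-trans (solve 2 (λ x y → x := (y :+ x) :+ :- y) ≈-refl (f ⊗ θ g) (θ f ⊗ g))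
  (≈-trans (⊕-cong (≈-trans (≈-sym (θ-⊗ f g)) (≈-trans (θ-cong inv) (θ-const 1ℤ))) ≈-refl) (⊕-identityˡ _))
  where
  open Solver

θlog-r : θ r ⊗ r⁻¹ ≈ (θlog 0 ⊕ θlog 3) ⊕ ⊝ (θlog 1 ⊕ θlog 2)
θlog-r = begin
    θ (a ⊗ H) ⊗ (b ⊗ G) ≈⟨ ⊗-cong (θ-⊗ a H) ≈-refl ⟩
    (θ a ⊗ H ⊕ a ⊗ θ H) ⊗ (b ⊗ G)
      ≈⟨ solve 6 (λ a a′ h h′ b g → (a′ :* h :+ a :* h′) :* (b :* g) := (b :* h) :* (a′ :* g) :+ (a :* g) :* (b :* h′)) ≈-refl a (θ a) H (θ H) b G ⟩
    (b ⊗ H) ⊗ (θ a ⊗ G) ⊕ (a ⊗ G) ⊗ (b ⊗ θ H) ≈⟨ ⊕-cong (⊗-cong bH≈1 ≈-refl) (⊗-cong aG≈1 (θ-inverse b H bH≈1)) ⟩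
    const 1ℤ ⊗ (θ a ⊗ G) ⊕ const 1ℤ ⊗ ⊝ (θ b ⊗ H) ≈⟨ ⊕-cong (⊗-identityˡ _) (⊗-identityˡ _) ⟩
    θ a ⊗ G ⊕ ⊝ (θ b ⊗ H) ≈⟨ ⊕-cong (pair 0 3) (⊝-cong (pair 1 2)) ⟩
    (θlog 0 ⊕ θlog 3) ⊕ ⊝ (θlog 1 ⊕ θlog 2) ∎
  where
  open ≈-Reasoning
  open Solver
  pair : ∀ c d → θ (Π c 4 ⊗ Π d 4) ⊗ (Π⁻¹ c 4 ⊗ Π⁻¹ d 4) ≈ θlog c ⊕ θlog d
  pair c d = begin
    θ (Π c 4 ⊗ Π d 4) ⊗ (Π⁻¹ c 4 ⊗ Π⁻¹ d 4) ≈⟨ ⊗-cong (θ-⊗ (Π c 4) (Π d 4)) ≈-refl ⟩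
    (θ (Π c 4) ⊗ Π d 4 ⊕ Π c 4 ⊗ θ (Π d 4)) ⊗ (Π⁻¹ c 4 ⊗ Π⁻¹ d 4)
      ≈⟨ solve 6 (λ x x′ y y′ z w → (x′ :* y :+ x :* y′) :* (z :* w) := (x′ :* z) :* (y :* w) :+ (x :* z) :* (y′ :* w)) ≈-refl
           (Π c 4) (θ (Π c 4)) (Π d 4) (θ (Π d 4)) (Π⁻¹ c 4) (Π⁻¹ d 4) ⟩
    θlog c ⊗ (Π d 4 ⊗ Π⁻¹ d 4) ⊕ (Π c 4 ⊗ Π⁻¹ c 4) ⊗ θlog d ≈⟨ ⊕-cong (⊗-cong ≈-refl (Π-inverse d 4)) (⊗-cong (Π-inverse c 4) ≈-refl) ⟩
    θlog c ⊗ const 1ℤ ⊕ const 1ℤ ⊗ θlog d ≈⟨ ⊕-cong (⊗-identityʳ _) (⊗-identityˡ _) ⟩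
    θlog c ⊕ θlog d ∎

comp-⊝ : ∀ r f → comp r (⊝ f) ≈ ⊝ comp r f
comp-⊝ r f = ⟪ (λ n → trans (comp-at r (⊝ f) n) (trans (⊝-at f _) (trans (cong -_ (sym (comp-at r f n))) (sym (⊝-at (comp r f) n))))) ⟫

comp-θr : comp 0 (θ r ⊗ r⁻¹) ≈ θ r ⊗ r⁻¹
comp-θr = ≈-trans (comp-cong 0 θlog-r) (≈-trans (comp-⊕ 0 _ _) (≈-trans (⊕-cong (≈-trans (comp-⊕ 0 _ _) (⊕-cong (comp-θlog 0) (comp-θlog 3)))
  (≈-trans (comp-⊝ 0 _) (⊝-cong (≈-trans (comp-⊕ 0 _ _) (⊕-cong (comp-θlog 1) (comp-θlog 2)))))) (≈-sym θlog-r)))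

-- 𝓕 = f₁⁵/f₅ turns out to be θ log (q r⁵).
𝓕 : PS
𝓕 = f₁ ^ 5 ⊗ f₅⁻¹

f₅f₅⁻¹≈1 : f₅ ⊗ f₅⁻¹ ≈ const 1ℤ
f₅f₅⁻¹≈1 = Π-inverse 4 4

X-head : X 0 ≡ 1ℤ
X-head = ⊗-head1 (Π-head 4 4) b-head

-- Since Y = X r, the difference X θY - θX Y is X² θr. Multiplied by X², the claim is the
-- `Wronskian` identity, with one factor f₁ on its right side rewritten as a b f₅.
5θr : r ⊕ const (+ 5) ⊗ θ r ≈ r ⊗ 𝓕
5θr = ⊗-cancelʳ (X ⊗ X) (⊗-head1 X-head X-head) (begin
    (r ⊕ const (+ 5) ⊗ θ r) ⊗ (X ⊗ X)
      ≈⟨ solve 4 (λ r r′ x x′ → (r :+ con (+ 5) :* r′) :* (x :* x) := x :* (x :* r) :+ con (+ 5) :* (x :* (x′ :* r :+ x :* r′) :+ :- (x′ :* (x :* r)))) ≈-refl r (θ r) X (θ X) ⟩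
    X ⊗ (X ⊗ r) ⊕ const (+ 5) ⊗ (X ⊗ (θ X ⊗ r ⊕ X ⊗ θ r) ⊕ ⊝ (θ X ⊗ (X ⊗ r)))
      ≈⟨ ⊕-cong (⊗-cong ≈-refl Xr≈Y) (⊗-cong ≈-refl (⊕-cong (⊗-cong ≈-refl (≈-trans (≈-sym (θ-⊗ X r)) (θ-cong Xr≈Y))) (⊝-cong (⊗-cong ≈-refl Xr≈Y)))) ⟩
    X ⊗ Y ⊕ const (+ 5) ⊗ (X ⊗ θ Y ⊕ ⊝ (θ X ⊗ Y)) ≈⟨ Wronskian ⟩
    f₁ ^ 6 ≈⟨ solve 1 (λ x → x :^ 6 := x :* x :^ 5) ≈-refl f₁ ⟩
    f₁ ⊗ f₁ ^ 5 ≈⟨ ⊗-cong f₁≈abf₅ ≈-refl ⟩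
    a ⊗ b ⊗ f₅ ⊗ f₁ ^ 5 ≈⟨ ≈-trans (⊗-identityˡ _) (⊗-identityˡ _) ⟨
    const 1ℤ ⊗ (const 1ℤ ⊗ (a ⊗ b ⊗ f₅ ⊗ f₁ ^ 5)) ≈⟨ ⊗-cong bH≈1 (⊗-cong f₅f₅⁻¹≈1 ≈-refl) ⟨
    (b ⊗ H) ⊗ ((f₅ ⊗ f₅⁻¹) ⊗ (a ⊗ b ⊗ f₅ ⊗ f₁ ^ 5))
      ≈⟨ solve 6 (λ a b h f g p → (b :* h) :* ((f :* g) :* (a :* b :* f :* p)) := ((a :* h) :* (p :* g)) :* ((f :* b) :* (f :* b))) ≈-refl a b H f₅ f₅⁻¹ (f₁ ^ 5) ⟩
    (r ⊗ 𝓕) ⊗ (X ⊗ X) ∎)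
  where
  open ≈-Reasoning
  open Solver
  Xr≈Y : X ⊗ r ≈ Y
  Xr≈Y = ≈-trans (solve 4 (λ f b a h → (f :* b) :* (a :* h) := (f :* a) :* (b :* h)) ≈-refl f₅ b a H) (≈-trans (⊗-cong ≈-refl bH≈1) (⊗-identityʳ _))

𝓕≈1+5θlog : 𝓕 ≈ const 1ℤ ⊕ const (+ 5) ⊗ (θ r ⊗ r⁻¹)
𝓕≈1+5θlog = begin
  𝓕 ≈⟨ ⊗-identityˡ 𝓕 ⟨
  const 1ℤ ⊗ 𝓕 ≈⟨ ⊗-cong r⊗r⁻¹≈1 ≈-refl ⟨
  (r ⊗ r⁻¹) ⊗ 𝓕 ≈⟨ solve 3 (λ r s f → (r :* s) :* f := s :* (r :* f)) ≈-refl r r⁻¹ 𝓕 ⟩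
  r⁻¹ ⊗ (r ⊗ 𝓕) ≈⟨ ⊗-cong ≈-refl 5θr ⟨
  r⁻¹ ⊗ (r ⊕ const (+ 5) ⊗ θ r) ≈⟨ solve 3 (λ r s t → s :* (r :+ con (+ 5) :* t) := (r :* s) :+ con (+ 5) :* (t :* s)) ≈-refl r r⁻¹ (θ r) ⟩
  (r ⊗ r⁻¹) ⊕ const (+ 5) ⊗ (θ r ⊗ r⁻¹) ≈⟨ ⊕-cong r⊗r⁻¹≈1 ≈-refl ⟩
  const 1ℤ ⊕ const (+ 5) ⊗ (θ r ⊗ r⁻¹) ∎
  where
  open ≈-Reasoning
  open Solver

comp-𝓕 : comp 0 𝓕 ≈ 𝓕
comp-𝓕 = ≈-trans (comp-cong 0 𝓕≈1+5θlog) (≈-trans (comp-⊕ 0 _ _) (≈-trans (⊕-cong comp-1 (≈-trans (comp-scale (+ 5) _) (⊗-cong ≈-refl comp-θr))) (≈-sym 𝓕≈1+5θlog)))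
  where
  comp-scale : ∀ c f → comp 0 (const c ⊗ f) ≈ const c ⊗ comp 0 f
  comp-scale c f = ≈-trans (comp-cong 0 (⊗-cong (≈-sym (dil-const c)) ≈-refl)) (comp-dil⊗ (s≤s z≤n) (const c) f)
  comp-1 : comp 0 (const 1ℤ) ≈ const 1ℤ
  comp-1 = ⟪ (λ n → trans (comp-at 0 (const 1ℤ) n) (go n)) ⟫
    where
    go : ∀ n → const 1ℤ (n ℕ.* 5) ≡ const 1ℤ n
    go zero = refl
    go (suc n) = trans (const-suc 1ℤ _) (sym (const-suc 1ℤ n))

-- The 5-dissection of Euler's product

V V⁻¹ v ρ f₂₅ f₂₅⁻¹ : PS
V = dil r
V⁻¹ = dil r⁻¹
v = q ⊗ V
ρ = q ⊗ r ^ 5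
f₂₅ = dil f₅
f₂₅⁻¹ = dil f₅⁻¹

dil-inverse : ∀ {f g} → f ⊗ g ≈ const 1ℤ → dil f ⊗ dil g ≈ const 1ℤ
dil-inverse {f} {g} inv = ≈-trans (≈-sym (dil-⊗ f g)) (≈-trans (dil-cong inv) (dil-const 1ℤ))

-- The reason for introducing `ρ`: the fifth power of v is a series in q⁵, and undoing the dilation
-- turns it into `ρ`.
dil-ρ : dil ρ ≈ v ^ 5
dil-ρ = ≈-trans (dil-⊗ q (r ^ 5)) (≈-trans (⊗-cong dil-q (dil-^ r 5)) (solve 2 (λ q v → q :^ 5 :* v :^ 5 := (q :* v) :^ 5) ≈-refl q V))
  where
  open Solver

f₂₅-head : f₂₅ 0 ≡ 1ℤ
f₂₅-head = trans (dil-head f₅) (Π-head 4 4)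

1-v-v² : PS
1-v-v² = const 1ℤ ⊕ ⊝ v ⊕ ⊝ v ^ 2

-- As f₁ f₅ = X Y and f₅ is the dilation of a b f₅, this is `XY-dissection` with that dilation
-- cancelled. The inserted units A g and B h make the quotients V⁻¹ and v visible.
f₁-dissection : f₁ ≈ f₂₅ ⊗ V⁻¹ ⊗ 1-v-v²
f₁-dissection = ⊗-cancelʳ (dil a ⊗ dil b ⊗ f₂₅) (⊗-head1 (⊗-head1 (trans (dil-head a) a-head) (trans (dil-head b) b-head)) f₂₅-head) (begin
    f₁ ⊗ (dil a ⊗ dil b ⊗ f₂₅) ≈⟨ ⊗-cong f₁≈abf₅ (≈-sym f₅≈) ⟩
    a ⊗ b ⊗ f₅ ⊗ f₅ ≈⟨ solve 3 (λ a b f → a :* b :* f :* f := (f :* b) :* (f :* a)) ≈-refl a b f₅ ⟩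
    X ⊗ Y ≈⟨ XY-dissection ⟩
    dil X ⊗ dil X ⊕ ⊝ ((q ^ 2 ⊗ dil Y) ⊗ dil Y) ⊕ ⊝ ((q ^ 1 ⊗ dil X) ⊗ dil Y)
      ≈⟨ ⊕-cong (⊕-cong (⊗-cong dX dX) (⊝-cong (⊗-cong (⊗-cong ≈-refl dY) dY))) (⊝-cong (⊗-cong (⊗-cong ≈-refl dX) dY)) ⟩
    (f₂₅ ⊗ B) ⊗ (f₂₅ ⊗ B) ⊕ ⊝ ((q ^ 2 ⊗ (f₂₅ ⊗ A)) ⊗ (f₂₅ ⊗ A)) ⊕ ⊝ ((q ^ 1 ⊗ (f₂₅ ⊗ B)) ⊗ (f₂₅ ⊗ A))
      ≈⟨ solve 4 (λ f a b q → (f :* b) :* (f :* b) :+ :- ((q :^ 2 :* (f :* a)) :* (f :* a)) :+ :- ((q :^ 1 :* (f :* b)) :* (f :* a))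
           := f :* f :* (con 1ℤ :* (con 1ℤ :* (b :* b)) :+ :- (con 1ℤ :* (con 1ℤ :* (q :* a :* b))) :+ :- (con 1ℤ :* (con 1ℤ :* (q :^ 2 :* a :* a))))) ≈-refl f₂₅ A B q ⟩
    f₂₅ ⊗ f₂₅ ⊗ (const 1ℤ ⊗ (const 1ℤ ⊗ (B ⊗ B)) ⊕ ⊝ (const 1ℤ ⊗ (const 1ℤ ⊗ (q ⊗ A ⊗ B))) ⊕ ⊝ (const 1ℤ ⊗ (const 1ℤ ⊗ (q ^ 2 ⊗ A ⊗ A))))
      ≈⟨ ⊗-cong ≈-refl (⊕-cong (⊕-cong (⊗-cong (dil-inverse aG≈1) ≈-refl)
            (⊝-cong (⊗-cong (dil-inverse aG≈1) (⊗-cong (dil-inverse bH≈1) ≈-refl))))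
            (⊝-cong (⊗-cong (dil-inverse aG≈1) (⊗-cong bbHH ≈-refl)))) ⟨
    f₂₅ ⊗ f₂₅ ⊗ ((A ⊗ g) ⊗ (const 1ℤ ⊗ (B ⊗ B)) ⊕ ⊝ ((A ⊗ g) ⊗ ((B ⊗ h) ⊗ (q ⊗ A ⊗ B))) ⊕ ⊝ ((A ⊗ g) ⊗ ((B ⊗ h) ⊗ (B ⊗ h) ⊗ (q ^ 2 ⊗ A ⊗ A))))
      ≈⟨ solve 6 (λ f a b g h q → f :* f :* ((a :* g) :* (con 1ℤ :* (b :* b)) :+ :- ((a :* g) :* ((b :* h) :* (q :* a :* b))) :+ :- ((a :* g) :* ((b :* h) :* (b :* h) :* (q :^ 2 :* a :* a))))
           := (f :* (b :* g) :* (con 1ℤ :+ :- (q :* (a :* h)) :+ :- (q :* (a :* h)) :^ 2)) :* (a :* b :* f)) ≈-refl f₂₅ A B g h q ⟩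
    (f₂₅ ⊗ (B ⊗ g) ⊗ (const 1ℤ ⊕ ⊝ (q ⊗ (A ⊗ h)) ⊕ ⊝ (q ⊗ (A ⊗ h)) ^ 2)) ⊗ (A ⊗ B ⊗ f₂₅)
      ≈⟨ ⊗-cong (⊗-cong (⊗-cong ≈-refl (dil-⊗ b G)) (⊕-cong (⊕-cong ≈-refl (⊝-cong v≈)) (⊝-cong (^-congˡ 2 v≈)))) ≈-refl ⟨
    (f₂₅ ⊗ V⁻¹ ⊗ 1-v-v²) ⊗ (A ⊗ B ⊗ f₂₅) ∎)
  where
  open ≈-Reasoning
  open Solver
  A = dil a
  B = dil b
  g = dil G
  h = dil H
  v≈ : v ≈ q ⊗ (A ⊗ h)
  v≈ = ⊗-cong ≈-refl (dil-⊗ a H)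
  bbHH : (B ⊗ h) ⊗ (B ⊗ h) ≈ const 1ℤ
  bbHH = ≈-trans (⊗-cong (dil-inverse bH≈1) (dil-inverse bH≈1)) (⊗-identityˡ _)
  dX : dil X ≈ f₂₅ ⊗ B
  dX = dil-⊗ f₅ b
  dY : dil Y ≈ f₂₅ ⊗ A
  dY = dil-⊗ f₅ a
  f₅≈ : f₅ ≈ A ⊗ B ⊗ f₂₅
  f₅≈ = ≈-trans (≈-sym dil-f₁) (≈-trans (dil-cong f₁≈abf₅) (≈-trans (dil-⊗ (a ⊗ b) f₅) (⊗-cong (dil-⊗ a b) ≈-refl)))

-- Components of a polynomial in v

poly : (ℕ → ℤ) → PS → PS
poly c x = const (c 0) ⊕ const (c 1) ⊗ x ⊕ const (c 2) ⊗ x ^ 2 ⊕ const (c 3) ⊗ x ^ 3 ⊕ const (c 4) ⊗ x ^ 4 ⊕ const (c 5) ⊗ x ^ 5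
  ⊕ const (c 6) ⊗ x ^ 6 ⊕ const (c 7) ⊗ x ^ 7 ⊕ const (c 8) ⊗ x ^ 8 ⊕ const (c 9) ⊗ x ^ 9 ⊕ const (c 10) ⊗ x ^ 10

-- For k < 5, component k collects vᵏ and v⁵⁺ᵏ, and v¹⁰ as well when k = 0. Removing qᵏ and undoing
-- the dilation turns vᵏ into rᵏ and v⁵ into `ρ`.
part : (ℕ → ℤ) → PS → ℕ → PS
part c K 0 = K ⊗ (const (c 0) ⊕ const (c 5) ⊗ ρ ⊕ const (c 10) ⊗ ρ ^ 2)
part c K k = K ⊗ r ^ k ⊗ (const (c k) ⊕ const (c (5 ℕ.+ k)) ⊗ ρ)

poly-dissection : ∀ c K → dil K ⊗ poly c v ≈ dissection (part c K)
poly-dissection c K = begin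
    dil K ⊗ poly c v ≈⟨ solve 13 (λ k x c0 c1 c2 c3 c4 c5 c6 c7 c8 c9 c10 →
        k :* (c0 :+ c1 :* x :+ c2 :* x :^ 2 :+ c3 :* x :^ 3 :+ c4 :* x :^ 4 :+ c5 :* x :^ 5 :+ c6 :* x :^ 6 :+ c7 :* x :^ 7 :+ c8 :* x :^ 8 :+ c9 :* x :^ 9 :+ c10 :* x :^ 10)
        := k :* (c0 :+ c5 :* x :^ 5 :+ c10 :* x :^ 10) :+ k :* (c1 :* x :^ 1 :+ c6 :* x :^ 6) :+ k :* (c2 :* x :^ 2 :+ c7 :* x :^ 7) :+ k :* (c3 :* x :^ 3 :+ c8 :* x :^ 8) :+ k :* (c4 :* x :^ 4 :+ c9 :* x :^ 9))
        ≈-refl (dil K) v (const (c 0)) (const (c 1)) (const (c 2)) (const (c 3)) (const (c 4)) (const (c 5)) (const (c 6)) (const (c 7)) (const (c 8)) (const (c 9)) (const (c 10)) ⟩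
    dil K ⊗ (const (c 0) ⊕ const (c 5) ⊗ v ^ 5 ⊕ const (c 10) ⊗ v ^ 10)
      ⊕ dil K ⊗ (const (c 1) ⊗ v ^ 1 ⊕ const (c 6) ⊗ v ^ 6) ⊕ dil K ⊗ (const (c 2) ⊗ v ^ 2 ⊕ const (c 7) ⊗ v ^ 7)
      ⊕ dil K ⊗ (const (c 3) ⊗ v ^ 3 ⊕ const (c 8) ⊗ v ^ 8) ⊕ dil K ⊗ (const (c 4) ⊗ v ^ 4 ⊕ const (c 9) ⊗ v ^ 9)
      ≈⟨ ⊕-cong (⊕-cong (⊕-cong (⊕-cong term₀ (term 0)) (term 1)) (term 2)) (term 3) ⟨
    dissection (part c K) ∎
  where
  open ≈-Reasoning
  open Solver
  dil-linear : ∀ c d → dil (const c ⊕ const d ⊗ ρ) ≈ const c ⊕ const d ⊗ v ^ 5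
  dil-linear c d = ≈-trans (dil-⊕ (const c) (const d ⊗ ρ)) (⊕-cong (dil-const c) (≈-trans (dil-scale d ρ) (⊗-cong ≈-refl dil-ρ)))
  term₀ : dil (part c K 0) ⊗ q ^ 0 ≈ dil K ⊗ (const (c 0) ⊕ const (c 5) ⊗ v ^ 5 ⊕ const (c 10) ⊗ v ^ 10)
  term₀ = ≈-trans (⊗-identityʳ _) (≈-trans (dil-⊗ K _) (⊗-cong ≈-refl (≈-trans (dil-⊕ (const (c 0) ⊕ const (c 5) ⊗ ρ) (const (c 10) ⊗ ρ ^ 2))
    (⊕-cong (dil-linear (c 0) (c 5)) (≈-trans (dil-scale (c 10) (ρ ^ 2)) (⊗-cong ≈-refl (≈-trans (dil-^ ρ 2) (≈-trans (^-congˡ 2 dil-ρ) (^-assocʳ v 5 2)))))))))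
  term : ∀ k → dil (part c K (suc k)) ⊗ q ^ suc k ≈ dil K ⊗ (const (c (suc k)) ⊗ v ^ suc k ⊕ const (c (6 ℕ.+ k)) ⊗ v ^ (6 ℕ.+ k))
  term k = begin
    dil (K ⊗ r ^ suc k ⊗ (const (c (suc k)) ⊕ const (c (6 ℕ.+ k)) ⊗ ρ)) ⊗ q ^ suc k
      ≈⟨ ⊗-cong (≈-trans (dil-⊗ (K ⊗ r ^ suc k) _) (⊗-cong (≈-trans (dil-⊗ K (r ^ suc k)) (⊗-cong ≈-refl (dil-^ r (suc k)))) (dil-linear (c (suc k)) (c (6 ℕ.+ k))))) ≈-refl ⟩
    dil K ⊗ V ^ suc k ⊗ (const (c (suc k)) ⊕ const (c (6 ℕ.+ k)) ⊗ v ^ 5) ⊗ q ^ suc k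
      ≈⟨ solve 6 (λ K x y d e w → K :* x :* (d :+ e :* w) :* y := K :* (d :* (y :* x) :+ e :* (w :* (y :* x)))) ≈-refl (dil K) (V ^ suc k) (q ^ suc k) (const (c (suc k))) (const (c (6 ℕ.+ k))) (v ^ 5) ⟩
    dil K ⊗ (const (c (suc k)) ⊗ (q ^ suc k ⊗ V ^ suc k) ⊕ const (c (6 ℕ.+ k)) ⊗ (v ^ 5 ⊗ (q ^ suc k ⊗ V ^ suc k)))
      ≈⟨ ⊗-cong ≈-refl (⊕-cong (⊗-cong ≈-refl (power (suc k))) (⊗-cong ≈-refl (≈-trans (⊗-cong ≈-refl (power (suc k))) (≈-sym (^-homo-* v 5 (suc k)))))) ⟩
    dil K ⊗ (const (c (suc k)) ⊗ v ^ suc k ⊕ const (c (6 ℕ.+ k)) ⊗ v ^ (6 ℕ.+ k)) ∎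
    where
    power : ∀ m → q ^ m ⊗ V ^ m ≈ v ^ m
    power zero = ⊗-identityˡ _
    power (suc m) = ≈-trans (solve 4 (λ q x v y → (q :* x) :* (v :* y) := (q :* v) :* (x :* y)) ≈-refl q (q ^ m) V (V ^ m)) (⊗-cong ≈-refl (power m))

-- Ramanujan's identity 1/R⁵ − 11 q − q² R⁵ = f₁⁶/f₅⁶

1-11ρ-ρ² : PS
1-11ρ-ρ² = const 1ℤ ⊕ const -[1+ 10 ] ⊗ ρ ⊕ const -1ℤ ⊗ ρ ^ 2

f₁f₁⁻¹≈1 : f₁ ⊗ f₁⁻¹ ≈ const 1ℤ
f₁f₁⁻¹≈1 = Π-inverse 0 0

dil-f₁⁻¹ : dil f₁⁻¹ ≈ f₅⁻¹
dil-f₁⁻¹ = ⊗-cancelʳ f₅ (Π-head 4 4) (≈-trans (⊗-cong ≈-refl (≈-sym dil-f₁)) (≈-trans (⊗-comm _ _) (≈-trans (dil-inverse f₁f₁⁻¹≈1)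
  (≈-trans (≈-sym f₅f₅⁻¹≈1) (⊗-comm _ _)))))

-- Of (1 - v - v²)⁵ only the terms 1, -11v⁵ and -v¹⁰ meet class 0, and `comp-𝓕` says that this class
-- returns f₁⁵/f₅ itself.
quintic : f₅ ^ 6 ⊗ r⁻¹ ^ 5 ⊗ 1-11ρ-ρ² ≈ f₁ ^ 6
quintic = begin
    f₅ ^ 6 ⊗ r⁻¹ ^ 5 ⊗ 1-11ρ-ρ² ≈⟨ ⊗-identityˡ _ ⟨
    const 1ℤ ⊗ (f₅ ^ 6 ⊗ r⁻¹ ^ 5 ⊗ 1-11ρ-ρ²) ≈⟨ ⊗-cong f₁f₁⁻¹≈1 ≈-refl ⟨
    (f₁ ⊗ f₁⁻¹) ⊗ (f₅ ^ 6 ⊗ r⁻¹ ^ 5 ⊗ 1-11ρ-ρ²)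
      ≈⟨ solve 5 (λ f g e s t → (f :* g) :* (e :^ 6 :* s :^ 5 :* t) := (f :* e) :* ((e :^ 5 :* g :* s :^ 5) :* t)) ≈-refl f₁ f₁⁻¹ f₅ r⁻¹ 1-11ρ-ρ² ⟩
    (f₁ ⊗ f₅) ⊗ part c K 0 ≈⟨ ⊗-cong ≈-refl (≈-trans (≈-sym (comp-dissection (s≤s z≤n) (part c K))) (≈-trans (comp-cong 0 (≈-sym 𝓕-dissection)) comp-𝓕)) ⟩
    (f₁ ⊗ f₅) ⊗ (f₁ ^ 5 ⊗ f₅⁻¹) ≈⟨ solve 3 (λ f e g → (f :* e) :* (f :^ 5 :* g) := f :^ 6 :* (e :* g)) ≈-refl f₁ f₅ f₅⁻¹ ⟩
    f₁ ^ 6 ⊗ (f₅ ⊗ f₅⁻¹) ≈⟨ ≈-trans (⊗-cong ≈-refl f₅f₅⁻¹≈1) (⊗-identityʳ _) ⟩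
    f₁ ^ 6 ∎
  where
  open ≈-Reasoning
  open Solver
  K : PS
  K = f₅ ^ 5 ⊗ f₁⁻¹ ⊗ r⁻¹ ^ 5
  -- coefficients of (1 − v − v²)⁵
  c : ℕ → ℤ
  c 0 = 1ℤ
  c 1 = -[1+ 4 ]
  c 2 = + 5
  c 3 = + 10
  c 4 = -[1+ 14 ]
  c 5 = -[1+ 10 ]
  c 6 = + 15
  c 7 = + 10
  c 8 = -[1+ 4 ]
  c 9 = -[1+ 4 ]
  c _ = -1ℤ
  power5 : 1-v-v² ^ 5 ≈ poly c v
  power5 = solve 1 (λ v → (con 1ℤ :+ :- v :+ :- v :^ 2) :^ 5
    := con 1ℤ :+ con -[1+ 4 ] :* v :+ con (+ 5) :* v :^ 2 :+ con (+ 10) :* v :^ 3 :+ con -[1+ 14 ] :* v :^ 4 :+ con -[1+ 10 ] :* v :^ 5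
       :+ con (+ 15) :* v :^ 6 :+ con (+ 10) :* v :^ 7 :+ con -[1+ 4 ] :* v :^ 8 :+ con -[1+ 4 ] :* v :^ 9 :+ con -1ℤ :* v :^ 10) ≈-refl v
  dil-K : dil K ≈ f₂₅ ^ 5 ⊗ f₅⁻¹ ⊗ V⁻¹ ^ 5
  dil-K = ≈-trans (dil-⊗ (f₅ ^ 5 ⊗ f₁⁻¹) (r⁻¹ ^ 5)) (⊗-cong (≈-trans (dil-⊗ (f₅ ^ 5) f₁⁻¹) (⊗-cong (dil-^ f₅ 5) dil-f₁⁻¹)) (dil-^ r⁻¹ 5))
  𝓕-dissection : 𝓕 ≈ dissection (part c K)
  𝓕-dissection = begin
    f₁ ^ 5 ⊗ f₅⁻¹ ≈⟨ ⊗-cong (^-congˡ 5 f₁-dissection) ≈-refl ⟩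
    (f₂₅ ⊗ V⁻¹ ⊗ 1-v-v²) ^ 5 ⊗ f₅⁻¹ ≈⟨ solve 4 (λ f g t e → (f :* g :* t) :^ 5 :* e := f :^ 5 :* e :* g :^ 5 :* t :^ 5) ≈-refl f₂₅ V⁻¹ 1-v-v² f₅⁻¹ ⟩
    f₂₅ ^ 5 ⊗ f₅⁻¹ ⊗ V⁻¹ ^ 5 ⊗ 1-v-v² ^ 5 ≈⟨ ⊗-cong (≈-sym dil-K) power5 ⟩
    dil K ⊗ poly c v ≈⟨ poly-dissection c K ⟩
    dissection (part c K) ∎

-- The relation f₁/f₅ = 1/(G H) removes Euler products from `quintic` and leaves an explicit inverse
-- of 1 - 11ρ - ρ².
quintic′ : r⁻¹ ^ 5 ⊗ G ^ 6 ⊗ H ^ 6 ⊗ 1-11ρ-ρ² ≈ const 1ℤ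
quintic′ = ⊗-cancelʳ ((a ⊗ b ⊗ f₅) ^ 6) (^-head1 6 (⊗-head1 (⊗-head1 a-head b-head) (Π-head 4 4))) (begin
    r⁻¹ ^ 5 ⊗ G ^ 6 ⊗ H ^ 6 ⊗ 1-11ρ-ρ² ⊗ (a ⊗ b ⊗ f₅) ^ 6
      ≈⟨ solve 7 (λ s g h t a b f → s :^ 5 :* g :^ 6 :* h :^ 6 :* t :* (a :* b :* f) :^ 6 := ((a :* g) :* (b :* h)) :^ 6 :* (f :^ 6 :* s :^ 5 :* t)) ≈-refl r⁻¹ G H 1-11ρ-ρ² a b f₅ ⟩
    ((a ⊗ G) ⊗ (b ⊗ H)) ^ 6 ⊗ (f₅ ^ 6 ⊗ r⁻¹ ^ 5 ⊗ 1-11ρ-ρ²) ≈⟨ ⊗-cong (^-congˡ 6 (⊗-cong aG≈1 bH≈1)) quintic ⟩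
    (const 1ℤ ⊗ const 1ℤ) ^ 6 ⊗ f₁ ^ 6 ≈⟨ solve 1 (λ x → (con 1ℤ :* con 1ℤ) :^ 6 :* x := con 1ℤ :* x) ≈-refl (f₁ ^ 6) ⟩
    const 1ℤ ⊗ f₁ ^ 6 ≈⟨ ⊗-cong ≈-refl (^-congˡ 6 f₁≈abf₅) ⟩
    const 1ℤ ⊗ (a ⊗ b ⊗ f₅) ^ 6 ∎)
  where
  open ≈-Reasoning
  open Solver

-- Ramanujan's modular equation relating R(q) and R(q⁵)

A A′ B B′ : PS
A  = const 1ℤ ⊕ const -[1+ 1 ] ⊗ v ⊕ const (+ 4) ⊗ v ^ 2 ⊕ const -[1+ 2 ] ⊗ v ^ 3 ⊕ v ^ 4
A′ = const -[1+ 1 ] ⊕ const (+ 8) ⊗ v ⊕ const -[1+ 8 ] ⊗ v ^ 2 ⊕ const (+ 4) ⊗ v ^ 3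
B  = const 1ℤ ⊕ const (+ 3) ⊗ v ⊕ const (+ 4) ⊗ v ^ 2 ⊕ const (+ 2) ⊗ v ^ 3 ⊕ v ^ 4
B′ = const (+ 3) ⊕ const (+ 8) ⊗ v ⊕ const (+ 6) ⊗ v ^ 2 ⊕ const (+ 4) ⊗ v ^ 3

-- Let α, β be the roots of x² = x + 1 and ζ a primitive fifth root of unity. The left side is the
-- product of all 1 - αζʲv and 1 - βζʲv; j = 0 gives 1 - v - v², and the Galois orbits of αζ and αζ²
-- give the rational quartics `A` and `B`.
v⁵-factors : const 1ℤ ⊕ const -[1+ 10 ] ⊗ v ^ 5 ⊕ const -1ℤ ⊗ (v ^ 5) ^ 2 ≈ 1-v-v² ⊗ (A ⊗ B)
v⁵-factors = solve 1 (λ v → con 1ℤ :+ con -[1+ 10 ] :* v :^ 5 :+ con -1ℤ :* (v :^ 5) :^ 2 := (con 1ℤ :+ :- v :+ :- v :^ 2)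
  :* ((con 1ℤ :+ con -[1+ 1 ] :* v :+ con (+ 4) :* v :^ 2 :+ con -[1+ 2 ] :* v :^ 3 :+ v :^ 4) :* (con 1ℤ :+ con (+ 3) :* v :+ con (+ 4) :* v :^ 2 :+ con (+ 2) :* v :^ 3 :+ v :^ 4))) ≈-refl v
  where
  open Solver

dil-1-11ρ-ρ² : dil 1-11ρ-ρ² ≈ 1-v-v² ⊗ (A ⊗ B)
dil-1-11ρ-ρ² = ≈-trans (≈-trans (dil-⊕ _ _) (⊕-cong (≈-trans (dil-⊕ _ _) (⊕-cong (dil-const 1ℤ) (≈-trans (dil-scale -[1+ 10 ] ρ) (⊗-cong ≈-refl dil-ρ))))
  (≈-trans (dil-scale -1ℤ (ρ ^ 2)) (⊗-cong ≈-refl (≈-trans (dil-^ ρ 2) (^-congˡ 2 dil-ρ)))))) v⁵-factors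

v-head : v 0 ≡ 0ℤ
v-head = q⊗-zero V

head-⊕ : ∀ {f g x y} → f 0 ≡ x → g 0 ≡ y → (f ⊕ g) 0 ≡ x + y
head-⊕ {f} {g} p r = trans (⊕-at f g 0) (cong₂ _+_ p r)

head-c⊗v : ∀ c g → g 0 ≡ 0ℤ → (const c ⊗ g) 0 ≡ 0ℤ
head-c⊗v c g p = trans (scale-at c g 0) (trans (cong (c *_) p) (ℤ.*-zeroʳ c))

v^-head : ∀ n → (v ^ suc n) 0 ≡ 0ℤ
v^-head n = trans (⊗-zero v (v ^ n)) (cong (_* (v ^ n) 0) v-head)

A-head : A 0 ≡ 1ℤ
A-head = head-⊕ (head-⊕ (head-⊕ (head-⊕ (const-zero 1ℤ) (head-c⊗v _ v v-head)) (head-c⊗v _ _ (v^-head 1))) (head-c⊗v _ _ (v^-head 2))) (v^-head 3)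

B-head : B 0 ≡ 1ℤ
B-head = head-⊕ (head-⊕ (head-⊕ (head-⊕ (const-zero 1ℤ) (head-c⊗v _ v v-head)) (head-c⊗v _ _ (v^-head 1))) (head-c⊗v _ _ (v^-head 2))) (v^-head 3)

1-v-v²-head : 1-v-v² 0 ≡ 1ℤ
1-v-v²-head = head-⊕ (head-⊕ (const-zero 1ℤ) (trans (⊝-at v 0) (cong -_ v-head))) (trans (⊝-at (v ^ 2) 0) (cong -_ (v^-head 1)))

𝓕₅ : PS
𝓕₅ = dil 𝓕

-- The ratio of `𝓕` to `𝓕₅` is f₁⁵ f₂₅/f₅⁶, where `f₁-dissection` supplies f₁⁵ and the dilated
-- `quintic` supplies f₅⁶. The logarithmic derivatives of `ρ` and `v` are thereby compared through a
-- rational function of v.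
𝓕AB : 𝓕 ⊗ (A ⊗ B) ≈ 𝓕₅ ⊗ 1-v-v² ^ 4
𝓕AB = ⊗-cancelʳ (t ⊗ f₅ ⊗ f₂₅) (⊗-head1 (⊗-head1 1-v-v²-head (Π-head 4 4)) f₂₅-head) (begin
    f₁ ^ 5 ⊗ f₅⁻¹ ⊗ (A ⊗ B) ⊗ (t ⊗ f₅ ⊗ f₂₅)
      ≈⟨ solve 6 (λ f e′ e n t d → f :^ 5 :* e′ :* n :* (t :* e :* d) := (e :* e′) :* (f :^ 5 :* n :* t :* d)) ≈-refl f₁ f₅⁻¹ f₅ (A ⊗ B) t f₂₅ ⟩
    (f₅ ⊗ f₅⁻¹) ⊗ (f₁ ^ 5 ⊗ (A ⊗ B) ⊗ t ⊗ f₂₅) ≈⟨ ⊗-cong f₅f₅⁻¹≈1 (⊗-cong (⊗-cong (⊗-cong (^-congˡ 5 f₁-dissection) ≈-refl) ≈-refl) ≈-refl) ⟩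
    const 1ℤ ⊗ ((f₂₅ ⊗ V⁻¹ ⊗ t) ^ 5 ⊗ (A ⊗ B) ⊗ t ⊗ f₂₅)
      ≈⟨ solve 4 (λ d s t n → con 1ℤ :* ((d :* s :* t) :^ 5 :* n :* t :* d) := (d :^ 6 :* s :^ 5 :* (t :* n)) :* (con 1ℤ :* t :^ 5)) ≈-refl f₂₅ V⁻¹ t (A ⊗ B) ⟩
    (f₂₅ ^ 6 ⊗ V⁻¹ ^ 5 ⊗ (t ⊗ (A ⊗ B))) ⊗ (const 1ℤ ⊗ t ^ 5) ≈⟨ ⊗-cong dil-quintic (⊗-cong (≈-sym (dil-inverse f₅f₅⁻¹≈1)) ≈-refl) ⟩
    f₅ ^ 6 ⊗ ((f₂₅ ⊗ f₂₅⁻¹) ⊗ t ^ 5)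
      ≈⟨ solve 4 (λ e d d′ t → e :^ 6 :* ((d :* d′) :* t :^ 5) := (e :^ 5 :* d′) :* t :^ 4 :* (t :* e :* d)) ≈-refl f₅ f₂₅ f₂₅⁻¹ t ⟩
    (f₅ ^ 5 ⊗ f₂₅⁻¹) ⊗ t ^ 4 ⊗ (t ⊗ f₅ ⊗ f₂₅)
      ≈⟨ ⊗-cong (⊗-cong (≈-trans (dil-⊗ (f₁ ^ 5) f₅⁻¹) (⊗-cong (≈-trans (dil-^ f₁ 5) (^-congˡ 5 dil-f₁)) ≈-refl)) ≈-refl) ≈-refl ⟨
    𝓕₅ ⊗ t ^ 4 ⊗ (t ⊗ f₅ ⊗ f₂₅) ∎)
  where
  open ≈-Reasoning
  open Solver
  t : PS
  t = 1-v-v²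
  dil-quintic : f₂₅ ^ 6 ⊗ V⁻¹ ^ 5 ⊗ (t ⊗ (A ⊗ B)) ≈ f₅ ^ 6
  dil-quintic = begin
    f₂₅ ^ 6 ⊗ V⁻¹ ^ 5 ⊗ (t ⊗ (A ⊗ B)) ≈⟨ ⊗-cong (⊗-cong (dil-^ f₅ 6) (dil-^ r⁻¹ 5)) dil-1-11ρ-ρ² ⟨
    dil (f₅ ^ 6) ⊗ dil (r⁻¹ ^ 5) ⊗ dil 1-11ρ-ρ² ≈⟨ ≈-trans (dil-⊗ (f₅ ^ 6 ⊗ r⁻¹ ^ 5) 1-11ρ-ρ²) (⊗-cong (dil-⊗ (f₅ ^ 6) (r⁻¹ ^ 5)) ≈-refl) ⟨
    dil (f₅ ^ 6 ⊗ r⁻¹ ^ 5 ⊗ 1-11ρ-ρ²) ≈⟨ dil-cong quintic ⟩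
    dil (f₁ ^ 6) ≈⟨ ≈-trans (dil-^ f₁ 6) (^-congˡ 6 dil-f₁) ⟩
    f₅ ^ 6 ∎

θ-^ : ∀ f n → θ (f ^ suc n) ≈ const (+ suc n) ⊗ f ^ n ⊗ θ f
θ-^ f zero = ≈-trans (θ-cong (⊗-identityʳ f)) (solve 1 (λ x → x := con 1ℤ :* con 1ℤ :* x) ≈-refl (θ f))
  where
  open Solver
θ-^ f (suc n) = begin
    θ (f ⊗ f ^ suc n) ≈⟨ θ-⊗ f (f ^ suc n) ⟩
    θ f ⊗ f ^ suc n ⊕ f ⊗ θ (f ^ suc n) ≈⟨ ⊕-cong ≈-refl (⊗-cong ≈-refl (θ-^ f n)) ⟩
    θ f ⊗ (f ⊗ f ^ n) ⊕ f ⊗ (const (+ suc n) ⊗ f ^ n ⊗ θ f)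
      ≈⟨ solve 4 (λ f p c t → t :* (f :* p) :+ f :* (c :* p :* t) := (con 1ℤ :+ c) :* (f :* p) :* t) ≈-refl f (f ^ n) (const (+ suc n)) (θ f) ⟩
    (const 1ℤ ⊕ const (+ suc n)) ⊗ (f ⊗ f ^ n) ⊗ θ f ≈⟨ ⊗-cong (⊗-cong (≈-sym (const-⊕ 1ℤ (+ suc n))) ≈-refl) ≈-refl ⟩
    const (+ suc (suc n)) ⊗ f ^ suc n ⊗ θ f ∎
  where
  open ≈-Reasoning
  open Solver

θ-scale : ∀ c f → θ (const c ⊗ f) ≈ const c ⊗ θ f
θ-scale c f = ≈-trans (θ-⊗ (const c) f) (≈-trans (⊕-cong (≈-trans (⊗-cong (θ-const c) ≈-refl) (⊗-zeroˡ f)) ≈-refl) (⊕-identityˡ _))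

θ-quartic : ∀ c₁ c₂ c₃ → θ (const 1ℤ ⊕ const c₁ ⊗ v ⊕ const c₂ ⊗ v ^ 2 ⊕ const c₃ ⊗ v ^ 3 ⊕ v ^ 4)
  ≈ (const c₁ ⊕ const (+ 2) ⊗ const c₂ ⊗ v ⊕ const (+ 3) ⊗ const c₃ ⊗ v ^ 2 ⊕ const (+ 4) ⊗ v ^ 3) ⊗ θ v
θ-quartic c₁ c₂ c₃ = begin
    θ (const 1ℤ ⊕ const c₁ ⊗ v ⊕ const c₂ ⊗ v ^ 2 ⊕ const c₃ ⊗ v ^ 3 ⊕ v ^ 4)
      ≈⟨ ≈-trans (θ-⊕ _ _) (⊕-cong (≈-trans (θ-⊕ _ _) (⊕-cong (≈-trans (θ-⊕ _ _) (⊕-cong (≈-trans (θ-⊕ _ _) (⊕-cong (θ-const 1ℤ) (θ-scale c₁ v)))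
           (≈-trans (θ-scale c₂ (v ^ 2)) (⊗-cong ≈-refl (θ-^ v 1))))) (≈-trans (θ-scale c₃ (v ^ 3)) (⊗-cong ≈-refl (θ-^ v 2))))) (θ-^ v 3)) ⟩
    const 0ℤ ⊕ const c₁ ⊗ θ v ⊕ const c₂ ⊗ (const (+ 2) ⊗ v ^ 1 ⊗ θ v) ⊕ const c₃ ⊗ (const (+ 3) ⊗ v ^ 2 ⊗ θ v) ⊕ const (+ 4) ⊗ v ^ 3 ⊗ θ v
      ≈⟨ solve 5 (λ c d e v t → con 0ℤ :+ c :* t :+ d :* (con (+ 2) :* v :^ 1 :* t) :+ e :* (con (+ 3) :* v :^ 2 :* t) :+ con (+ 4) :* v :^ 3 :* t
           := (c :+ con (+ 2) :* d :* v :+ con (+ 3) :* e :* v :^ 2 :+ con (+ 4) :* v :^ 3) :* t) ≈-refl (const c₁) (const c₂) (const c₃) v (θ v) ⟩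
    (const c₁ ⊕ const (+ 2) ⊗ const c₂ ⊗ v ⊕ const (+ 3) ⊗ const c₃ ⊗ v ^ 2 ⊕ const (+ 4) ⊗ v ^ 3) ⊗ θ v ∎
  where
  open ≈-Reasoning
  open Solver

θA : θ A ≈ A′ ⊗ θ v
θA = ≈-trans (θ-quartic -[1+ 1 ] (+ 4) -[1+ 2 ]) (⊗-cong (solve 1 (λ v → con -[1+ 1 ] :+ con (+ 2) :* con (+ 4) :* v :+ con (+ 3) :* con -[1+ 2 ] :* v :^ 2 :+ con (+ 4) :* v :^ 3
  := con -[1+ 1 ] :+ con (+ 8) :* v :+ con -[1+ 8 ] :* v :^ 2 :+ con (+ 4) :* v :^ 3) ≈-refl v) ≈-refl)
  where
  open Solver

θB : θ B ≈ B′ ⊗ θ v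
θB = ≈-trans (θ-quartic (+ 3) (+ 4) (+ 2)) (⊗-cong (solve 1 (λ v → con (+ 3) :+ con (+ 2) :* con (+ 4) :* v :+ con (+ 3) :* con (+ 2) :* v :^ 2 :+ con (+ 4) :* v :^ 3
  := con (+ 3) :+ con (+ 8) :* v :+ con (+ 6) :* v :^ 2 :+ con (+ 4) :* v :^ 3) ≈-refl v) ≈-refl)
  where
  open Solver

5θr′ : const (+ 5) ⊗ θ r ≈ r ⊗ (𝓕 ⊕ ⊝ const 1ℤ)
5θr′ = ≈-trans (solve 2 (λ r t → t := (r :+ t) :+ :- r) ≈-refl r (const (+ 5) ⊗ θ r)) (≈-trans (⊕-cong 5θr ≈-refl)
  (solve 2 (λ r f → r :* f :+ :- r := r :* (f :+ :- con 1ℤ)) ≈-refl r 𝓕))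
  where
  open Solver

θr⁵ : θ (r ^ 5) ≈ r ^ 5 ⊗ (𝓕 ⊕ ⊝ const 1ℤ)
θr⁵ = ≈-trans (θ-^ r 4) (≈-trans (solve 2 (λ r t → con (+ 5) :* r :^ 4 :* t := r :^ 4 :* (con (+ 5) :* t)) ≈-refl r (θ r)) (≈-trans (⊗-cong ≈-refl 5θr′)
  (solve 2 (λ r f → r :^ 4 :* (r :* f) := r :^ 5 :* f) ≈-refl r (𝓕 ⊕ ⊝ const 1ℤ))))
  where
  open Solver

θV : θ V ≈ V ⊗ (𝓕₅ ⊕ ⊝ const 1ℤ)
θV = ≈-trans (θ-dil r) (≈-trans (≈-sym (dil-scale (+ 5) (θ r))) (≈-trans (dil-cong 5θr′) (≈-trans (dil-⊗ r _)
  (⊗-cong ≈-refl (≈-trans (dil-⊕ 𝓕 _) (⊕-cong ≈-refl (≈-trans (dil-⊝ (const 1ℤ)) (⊝-cong (dil-const 1ℤ)))))))))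

θv : θ v ≈ v ⊗ 𝓕₅
θv = ≈-trans (θ-⊗ q V) (≈-trans (⊕-cong (⊗-cong θq ≈-refl) (⊗-cong ≈-refl θV))
    (solve 3 (λ q V f → q :* V :+ q :* (V :* (f :+ :- con 1ℤ)) := (q :* V) :* f) ≈-refl q V 𝓕₅))
  where
  open Solver
  θq : θ q ≈ q
  θq = ≈-trans (θ-cong (≈-sym (⊗-identityʳ q))) (≈-trans (θ-q^ 1) (solve 1 (λ q → con 1ℤ :* q :^ 1 := q) ≈-refl q))

-- The difference δ = f - g satisfies the same relation. If its coefficients below N > 0 vanish, the
-- coefficient of order N is N δ_N on the left and 0 on the right, because θ g has no constant term.
θlog-unique : ∀ f g → f 0 ≡ 1ℤ → g 0 ≡ 1ℤ → θ f ⊗ g ≈ f ⊗ θ g → f ≈ g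
θlog-unique f g f0 g0 e = ≈[]⇒≈ go
  where
  open Solver
  δ : PS
  δ = f ⊕ ⊝ g
  δ-eq : θ δ ⊗ g ≈ δ ⊗ θ g
  δ-eq = ≈-trans (⊗-cong (≈-trans (θ-⊕ f (⊝ g)) (⊕-cong ≈-refl (θ-⊝ g))) ≈-refl)
    (≈-trans (solve 3 (λ f′ g g′ → (f′ :+ :- g′) :* g := f′ :* g :+ :- (g :* g′)) ≈-refl (θ f) g (θ g))
      (≈-trans (⊕-cong e ≈-refl) (solve 3 (λ f g g′ → f :* g′ :+ :- (g :* g′) := (f :+ :- g) :* g′) ≈-refl f g (θ g))))
  leading : ∀ N h k → (∀ m → m ℕ.< N → h m ≡ 0ℤ) → (h ⊗ k) N ≡ h N * k 0
  leading zero h k z = ⊗-zero h k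
  leading (suc N) h k z = trans (⊗-suc h k N) (trans (cong₂ (λ x y → x * k (suc N) + y) (z 0 (s≤s z≤n)) (leading N (tail h) k (λ m l → z (suc m) (s≤s l))))
    (ℤ.+-identityˡ _))
  δ-at : ∀ n → δ n ≡ f n - g n
  δ-at n = trans (⊕-at f (⊝ g) n) (cong (λ x → f n + x) (⊝-at g n))
  δ0 : ∀ N m → m ℕ.< N → δ m ≡ 0ℤ
  step : ∀ N → δ N ≡ 0ℤ
  step zero = trans (δ-at 0) (trans (cong₂ _-_ f0 g0) refl)
  step (suc N) = ℤ.*-cancelˡ-≡ (+ suc N) (δ (suc N)) 0ℤ (begin
      + suc N * δ (suc N) ≡⟨ θ-at δ (suc N) ⟨
      θ δ (suc N) ≡⟨ ℤ.*-identityʳ _ ⟨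
      θ δ (suc N) * 1ℤ ≡⟨ cong (θ δ (suc N) *_) g0 ⟨
      θ δ (suc N) * g 0 ≡⟨ leading (suc N) (θ δ) g (λ m l → trans (θ-at δ m) (trans (cong (+ m *_) (δ0 (suc N) m l)) (ℤ.*-zeroʳ (+ m)))) ⟨
      (θ δ ⊗ g) (suc N) ≡⟨ at δ-eq (suc N) ⟩
      (δ ⊗ θ g) (suc N) ≡⟨ leading (suc N) δ (θ g) (δ0 (suc N)) ⟩
      δ (suc N) * θ g 0 ≡⟨ cong (δ (suc N) *_) (θ-at g 0) ⟩
      δ (suc N) * 0ℤ ≡⟨ ℤ.*-zeroʳ (δ (suc N)) ⟩
      0ℤ ≡⟨ ℤ.*-zeroʳ (+ suc N) ⟨
      + suc N * 0ℤ ∎)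
    where
    open ≡.≡-Reasoning
  δ0 (suc N) m (s≤s l) with ℕ.m≤n⇒m<n∨m≡n l
  ... | inj₁ m<N = δ0 N m m<N
  ... | inj₂ refl = step m
  go : ∀ N → f ≈[ N ] g
  go N = ⟪ (λ n l → ℤ.i-j≡0⇒i≡j (f n) (g n) (trans (sym (δ-at n)) (δ0 N n l))) ⟫ₙ

-- The logarithmic derivatives of the two sides are `𝓕` - 1 + v`B′`𝓕₅`/`B`and`𝓕₅`− 1 + v`A′`𝓕₅`/`A`.
-- After clearing denominators, `𝓕AB` eliminates `𝓕`, and a polynomial identity in v remains.
modular-equation : r ^ 5 ⊗ B ≈ V ⊗ A
modular-equation = θlog-unique (r ^ 5 ⊗ B) (V ⊗ A) (⊗-head1 (^-head1 5 r-head) B-head) (⊗-head1 (trans (dil-head r) r-head) A-head) (begin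
    θ (r ^ 5 ⊗ B) ⊗ (V ⊗ A)
      ≈⟨ ⊗-cong (≈-trans (θ-⊗ (r ^ 5) B) (⊕-cong (⊗-cong θr⁵ ≈-refl) (⊗-cong ≈-refl (≈-trans θB (⊗-cong ≈-refl θv))))) ≈-refl ⟩
    (p ⊗ (𝓕 ⊕ ⊝ const 1ℤ) ⊗ B ⊕ p ⊗ (B′ ⊗ (v ⊗ 𝓕₅))) ⊗ (V ⊗ A)
      ≈⟨ solve 8 (λ p F B B′ v F₅ V A → (p :* (F :+ :- con 1ℤ) :* B :+ p :* (B′ :* (v :* F₅))) :* (V :* A)
           := p :* V :* (F :* (A :* B) :+ :- (A :* B) :+ F₅ :* (v :* (B′ :* A)))) ≈-refl p 𝓕 B B′ v 𝓕₅ V A ⟩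
    p ⊗ V ⊗ (𝓕 ⊗ (A ⊗ B) ⊕ ⊝ (A ⊗ B) ⊕ 𝓕₅ ⊗ (v ⊗ (B′ ⊗ A))) ≈⟨ ⊗-cong ≈-refl (⊕-cong (⊕-cong 𝓕AB ≈-refl) ≈-refl) ⟩
    p ⊗ V ⊗ (𝓕₅ ⊗ 1-v-v² ^ 4 ⊕ ⊝ (A ⊗ B) ⊕ 𝓕₅ ⊗ (v ⊗ (B′ ⊗ A)))
      ≈⟨ solve 8 (λ p V F t A B v B′ → p :* V :* (F :* t :+ :- (A :* B) :+ F :* (v :* (B′ :* A))) := p :* V :* (F :* (t :+ v :* (B′ :* A)) :+ :- (A :* B))) ≈-refl
           p V 𝓕₅ (1-v-v² ^ 4) A B v B′ ⟩
    p ⊗ V ⊗ (𝓕₅ ⊗ (1-v-v² ^ 4 ⊕ v ⊗ (B′ ⊗ A)) ⊕ ⊝ (A ⊗ B)) ≈⟨ ⊗-cong ≈-refl (⊕-cong (⊗-cong ≈-refl polynomial) ≈-refl) ⟩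
    p ⊗ V ⊗ (𝓕₅ ⊗ (A ⊗ B ⊕ v ⊗ (A′ ⊗ B)) ⊕ ⊝ (A ⊗ B))
      ≈⟨ solve 7 (λ p V F A B v A′ → p :* V :* (F :* (A :* B :+ v :* (A′ :* B)) :+ :- (A :* B)) := (p :* B) :* (V :* (F :+ :- con 1ℤ) :* A :+ V :* (A′ :* (v :* F)))) ≈-refl
           p V 𝓕₅ A B v A′ ⟩
    (p ⊗ B) ⊗ (V ⊗ (𝓕₅ ⊕ ⊝ const 1ℤ) ⊗ A ⊕ V ⊗ (A′ ⊗ (v ⊗ 𝓕₅)))
      ≈⟨ ⊗-cong ≈-refl (≈-trans (θ-⊗ V A) (⊕-cong (⊗-cong θV ≈-refl) (⊗-cong ≈-refl (≈-trans θA (⊗-cong ≈-refl θv))))) ⟨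
    (p ⊗ B) ⊗ θ (V ⊗ A) ∎)
  where
  open ≈-Reasoning
  open Solver
  p : PS
  p = r ^ 5
  polynomial : 1-v-v² ^ 4 ⊕ v ⊗ (B′ ⊗ A) ≈ A ⊗ B ⊕ v ⊗ (A′ ⊗ B)
  polynomial = solve 1 (λ v →
    let A = con 1ℤ :+ con -[1+ 1 ] :* v :+ con (+ 4) :* v :^ 2 :+ con -[1+ 2 ] :* v :^ 3 :+ v :^ 4
        A′ = con -[1+ 1 ] :+ con (+ 8) :* v :+ con -[1+ 8 ] :* v :^ 2 :+ con (+ 4) :* v :^ 3
        B = con 1ℤ :+ con (+ 3) :* v :+ con (+ 4) :* v :^ 2 :+ con (+ 2) :* v :^ 3 :+ v :^ 4
        B′ = con (+ 3) :+ con (+ 8) :* v :+ con (+ 6) :* v :^ 2 :+ con (+ 4) :* v :^ 3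
    in (con 1ℤ :+ :- v :+ :- v :^ 2) :^ 4 :+ v :* (B′ :* A) := A :* B :+ v :* (A′ :* B)) ≈-refl v

-- The 5-dissection of D

K : PS
K = r⁻¹ ^ 5 ⊗ G ^ 6 ⊗ H ^ 6

-- coefficients of B² (1 − v − v²), which is D ⊗ A ⊗ B ⊗ (1 − v − v²) by the modular equation
γ : ℕ → ℤ
γ 0 = 1ℤ
γ 1 = + 5
γ 2 = + 10
γ 3 = + 5
γ 4 = -[1+ 14 ]
γ 5 = -[1+ 35 ]
γ 6 = -[1+ 39 ]
γ 7 = -[1+ 29 ]
γ 8 = -[1+ 14 ]
γ 9 = -[1+ 4 ]
γ _ = -1ℤ

R≈r : R ≈ r
R≈r = ≈-trans (·≈⊗ _ _) (≈-trans (⊗-cong (≈-trans (·≈⊗ _ _) (⊗-cong (≈-trans (·≈⊗ _ _) (⊗-cong (poch≈Π 0 4) (poch≈Π 3 4))) (pochInv≈Π⁻¹ 1 4))) (pochInv≈Π⁻¹ 2 4)) (⊗-assoc _ _ _))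

Rinv≈r⁻¹ : Rinv ≈ r⁻¹
Rinv≈r⁻¹ = ≈-trans (·≈⊗ _ _) (≈-trans (⊗-cong (≈-trans (·≈⊗ _ _) (⊗-cong (≈-trans (·≈⊗ _ _) (⊗-cong (poch≈Π 1 4) (poch≈Π 2 4))) (pochInv≈Π⁻¹ 0 4))) (pochInv≈Π⁻¹ 3 4)) (⊗-assoc _ _ _))

D-dissection : D ≈ dissection (part γ K)
D-dissection = begin
    D ≈⟨ ≈-trans (·≈⊗ _ _) (⊗-cong (≈-trans (dil≈dilate5 R) (dil-cong R≈r)) (power 5)) ⟩
    V ⊗ r⁻¹ ^ 5 ≈⟨ ⊗-identityˡ _ ⟨
    -- This unit contains the factor `A`, which the modular equation needs in order to turn V into
    -- r⁵ `B`.
    const 1ℤ ⊗ (V ⊗ r⁻¹ ^ 5) ≈⟨ ⊗-cong dil-quintic′ ≈-refl ⟨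
    (dil K ⊗ (1-v-v² ⊗ (A ⊗ B))) ⊗ (V ⊗ r⁻¹ ^ 5)
      ≈⟨ solve 6 (λ K t A B V s → (K :* (t :* (A :* B))) :* (V :* s :^ 5) := K :* (t :* B :* (s :^ 5 :* (V :* A)))) ≈-refl (dil K) 1-v-v² A B V r⁻¹ ⟩
    dil K ⊗ (1-v-v² ⊗ B ⊗ (r⁻¹ ^ 5 ⊗ (V ⊗ A))) ≈⟨ ⊗-cong ≈-refl (⊗-cong ≈-refl (⊗-cong ≈-refl modular-equation)) ⟨
    dil K ⊗ (1-v-v² ⊗ B ⊗ (r⁻¹ ^ 5 ⊗ (r ^ 5 ⊗ B)))
      ≈⟨ solve 5 (λ K t B s r → K :* (t :* B :* (s :^ 5 :* (r :^ 5 :* B))) := K :* ((r :* s) :^ 5 :* (B :^ 2 :* t))) ≈-refl (dil K) 1-v-v² B r⁻¹ r ⟩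
    dil K ⊗ ((r ⊗ r⁻¹) ^ 5 ⊗ (B ^ 2 ⊗ 1-v-v²)) ≈⟨ ⊗-cong ≈-refl (≈-trans (⊗-cong (^-congˡ 5 r⊗r⁻¹≈1) polynomial) (solve 1 (λ x → con 1ℤ :^ 5 :* x := x) ≈-refl (poly γ v))) ⟩
    dil K ⊗ poly γ v ≈⟨ poly-dissection γ K ⟩
    dissection (part γ K) ∎
  where
  open ≈-Reasoning
  open Solver
  power : ∀ n → Rinv ^ᵖ n ≈ r⁻¹ ^ n
  power zero = one≈const
  power (suc n) = ≈-trans (·≈⊗ _ _) (⊗-cong Rinv≈r⁻¹ (power n))
  dil-quintic′ : dil K ⊗ (1-v-v² ⊗ (A ⊗ B)) ≈ const 1ℤ
  dil-quintic′ = ≈-trans (⊗-cong ≈-refl (≈-sym dil-1-11ρ-ρ²)) (≈-trans (≈-sym (dil-⊗ K 1-11ρ-ρ²)) (≈-trans (dil-cong quintic′) (dil-const 1ℤ)))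
  polynomial : B ^ 2 ⊗ 1-v-v² ≈ poly γ v
  polynomial = solve 1 (λ v → (con 1ℤ :+ con (+ 3) :* v :+ con (+ 4) :* v :^ 2 :+ con (+ 2) :* v :^ 3 :+ v :^ 4) :^ 2 :* (con 1ℤ :+ :- v :+ :- v :^ 2)
    := con 1ℤ :+ con (+ 5) :* v :+ con (+ 10) :* v :^ 2 :+ con (+ 5) :* v :^ 3 :+ con -[1+ 14 ] :* v :^ 4 :+ con -[1+ 35 ] :* v :^ 5
       :+ con -[1+ 39 ] :* v :^ 6 :+ con -[1+ 29 ] :* v :^ 7 :+ con -[1+ 14 ] :* v :^ 8 :+ con -[1+ 4 ] :* v :^ 9 :+ con -1ℤ :* v :^ 10) ≈-refl v

-- Series with nonnegative coefficients

NonNeg : PS → Set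
NonNeg f = ∀ n → 0ℤ ≤ f n

0≤i*j : ∀ {i j} → 0ℤ ≤ i → 0ℤ ≤ j → 0ℤ ≤ i * j
0≤i*j {+ m} {+ n} _ _ = subst (0ℤ ≤_) (ℤ.pos-* m n) (+≤+ z≤n)

NonNeg-≈ : ∀ {f g} → f ≈ g → NonNeg f → NonNeg g
NonNeg-≈ e p n = subst (0ℤ ≤_) (at e n) (p n)

NonNeg-⊕ : ∀ {f g} → NonNeg f → NonNeg g → NonNeg (f ⊕ g)
NonNeg-⊕ {f} {g} p s n = subst (0ℤ ≤_) (sym (⊕-at f g n)) (ℤ.+-mono-≤ (p n) (s n))

NonNeg-⊗ : ∀ {f g} → NonNeg f → NonNeg g → NonNeg (f ⊗ g)
NonNeg-⊗ {f} {g} p s zero = subst (0ℤ ≤_) (sym (⊗-zero f g)) (0≤i*j (p 0) (s 0))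
NonNeg-⊗ {f} {g} p s (suc n) = subst (0ℤ ≤_) (sym (⊗-suc f g n)) (ℤ.+-mono-≤ (0≤i*j (p 0) (s (suc n))) (NonNeg-⊗ {tail f} {g} (λ m → p (suc m)) s n))

NonNeg-const : ∀ c → NonNeg (const (+ c))
NonNeg-const c zero = subst (0ℤ ≤_) (sym (const-zero (+ c))) (+≤+ z≤n)
NonNeg-const c (suc n) = subst (0ℤ ≤_) (sym (const-suc (+ c) n)) (+≤+ z≤n)

NonNeg-q^ : ∀ e → NonNeg (q ^ e)
NonNeg-q^ e n = subst (0ℤ ≤_) (sym (q^-at e n)) (go e n)
  where
  go : ∀ e n → 0ℤ ≤ kron e n
  go zero zero = +≤+ z≤n
  go zero (suc n) = +≤+ z≤n
  go (suc e) zero = +≤+ z≤n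
  go (suc e) (suc n) = go e n

NonNeg-q : NonNeg q
NonNeg-q = NonNeg-≈ (⊗-identityʳ q) (NonNeg-q^ 1)

NonNeg-^ : ∀ {f} n → NonNeg f → NonNeg (f ^ n)
NonNeg-^ zero p = NonNeg-const 1
NonNeg-^ {f} (suc n) p = NonNeg-⊗ {f} {f ^ n} p (NonNeg-^ n p)

NonNeg-geom : ∀ m → NonNeg (geom m)
NonNeg-geom m n with m ∣? n
... | yes _ = +≤+ z≤n
... | no _ = +≤+ z≤n

NonNeg-prod : ∀ {F} → (∀ k → NonNeg (F k)) → ∀ N → NonNeg (prod F N)
NonNeg-prod p zero = NonNeg-const 1
NonNeg-prod {F} p (suc N) = NonNeg-⊗ {prod F N} {F N} (NonNeg-prod p N) (p N)

NonNeg-lim : ∀ {F} → (∀ k → NonNeg (F k)) → NonNeg (lim F)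
NonNeg-lim p n = NonNeg-prod p (suc n) n

g₁ : PS
g₁ = geom 1

-- Multiplying by 1/(1 − q) takes partial sums of the coefficients.
partial-sums-pos : ∀ {f} → NonNeg f → f 0 ≡ 1ℤ → ∀ n → 0ℤ < (g₁ ⊗ f) n
partial-sums-pos {f} p f0 zero = subst (0ℤ <_) (sym (trans (⊗-zero g₁ f) (trans (ℤ.*-identityˡ (f 0)) f0))) (+<+ (s≤s z≤n))
partial-sums-pos {f} p f0 (suc n) = subst (0ℤ <_) (sym eq) (ℤ.+-mono-≤-< (p (suc n)) (partial-sums-pos p f0 n))
  where
  open Solver
  rec : g₁ ⊗ f ≈ f ⊕ q ⊗ (g₁ ⊗ f)
  rec = ≈-trans (⊗-cong (geom-rec 0) ≈-refl) (solve 3 (λ q g f → (con 1ℤ :+ q :^ 1 :* g) :* f := f :+ q :* (g :* f)) ≈-refl q g₁ f)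
  eq : (g₁ ⊗ f) (suc n) ≡ f (suc n) + (g₁ ⊗ f) n
  eq = trans (at rec (suc n)) (trans (⊕-at f _ (suc n)) (cong (λ x → f (suc n) + x) (q⊗-suc (g₁ ⊗ f) n)))

-- Factorwise comparison of G and H

g h : ℕ → PS
g k = geom (1 ℕ.+ 5 ℕ.* k) ⊗ geom (4 ℕ.+ 5 ℕ.* k)
h k = geom (2 ℕ.+ 5 ℕ.* k) ⊗ geom (3 ℕ.+ 5 ℕ.* k)

NonNeg-g : ∀ k → NonNeg (g k)
NonNeg-g k = NonNeg-⊗ (NonNeg-geom (1 ℕ.+ 5 ℕ.* k)) (NonNeg-geom (4 ℕ.+ 5 ℕ.* k))

NonNeg-h : ∀ k → NonNeg (h k)
NonNeg-h k = NonNeg-⊗ (NonNeg-geom (2 ℕ.+ 5 ℕ.* k)) (NonNeg-geom (3 ℕ.+ 5 ℕ.* k))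

Tame-g : Tame g
Tame-g = Tame-⊗ (Tame-geom 0 4) (Tame-geom 3 4)

Tame-h : Tame h
Tame-h = Tame-⊗ (Tame-geom 1 4) (Tame-geom 2 4)

Tame-suc : ∀ {F} → Tame F → Tame (λ k → F (suc k))
Tame-suc t k = ≈[]-weaken (ℕ.n≤1+n (suc k)) (t (suc k))

prod-first : ∀ F N → prod F (suc N) ≈ F 0 ⊗ prod (λ k → F (suc k)) N
prod-first F zero = ⊗-comm (const 1ℤ) (F 0)
prod-first F (suc N) = ≈-trans (⊗-cong (prod-first F N) ≈-refl) (⊗-assoc (F 0) (prod (λ k → F (suc k)) N) (F (suc N)))

lim-first : ∀ {F} → Tame F → lim F ≈ F 0 ⊗ lim (λ k → F (suc k))
lim-first {F} t = ≈[]⇒≈ (λ N → ≈[]-trans (≈[]-weaken (ℕ.n≤1+n N) (lim≈[]prod t (suc N)))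
  (≈[]-trans (≈⇒≈[] N (prod-first F N)) (⊗-cong[] ≈[]-refl (≈[]-sym (lim≈[]prod (Tame-suc t) N)))))

-- The factors with k = 0 are split off because they alone absorb the coefficient 3 of E, in `E₀`;
-- for the remaining factors the difference Ĝ - Ĥ suffices.
Ĝ Ĥ : PS
Ĝ = lim (λ k → g (suc k))
Ĥ = lim (λ k → h (suc k))

G≈ : G ≈ g 0 ⊗ Ĝ
G≈ = ≈-trans (≈-sym (lim-⊗ (Tame-geom 0 4) (Tame-geom 3 4))) (lim-first Tame-g)

H≈ : H ≈ h 0 ⊗ Ĥ
H≈ = ≈-trans (≈-sym (lim-⊗ (Tame-geom 1 4) (Tame-geom 2 4))) (lim-first Tame-h)

-- (1 − q²x)(1 − q³x) − (1 − qx)(1 − q⁴x) = qx (1 − q)² (1 + q)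
g-h : ∀ k → g₁ ^ 2 ⊗ (g k ⊕ ⊝ h k) ≈ q ^ (1 ℕ.+ 5 ℕ.* k) ⊗ (const 1ℤ ⊕ q) ⊗ (g k ⊗ h k)
g-h k = begin
    g₁ ^ 2 ⊗ (u 1 ⊗ u 4 ⊕ ⊝ (u 2 ⊗ u 3))
      ≈⟨ solve 5 (λ s a b c d → s :^ 2 :* (a :* d :+ :- (b :* c)) := s :^ 2 :* ((a :* d) :* (con 1ℤ :* con 1ℤ) :+ :- ((b :* c) :* (con 1ℤ :* con 1ℤ)))) ≈-refl g₁ (u 1) (u 2) (u 3) (u 4) ⟩
    g₁ ^ 2 ⊗ ((u 1 ⊗ u 4) ⊗ (const 1ℤ ⊗ const 1ℤ) ⊕ ⊝ ((u 2 ⊗ u 3) ⊗ (const 1ℤ ⊗ const 1ℤ)))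
      ≈⟨ ⊗-cong ≈-refl (⊕-cong (⊗-cong ≈-refl (⊗-cong (inv 1) (inv 2))) (⊝-cong (⊗-cong ≈-refl (⊗-cong (inv 0) (inv 3))))) ⟨
    g₁ ^ 2 ⊗ ((u 1 ⊗ u 4) ⊗ ((const 1ℤ ⊕ ⊝ (q ^ 2 ⊗ x)) ⊗ u 2 ⊗ ((const 1ℤ ⊕ ⊝ (q ^ 3 ⊗ x)) ⊗ u 3)) ⊕ ⊝ ((u 2 ⊗ u 3) ⊗ ((const 1ℤ ⊕ ⊝ (q ^ 1 ⊗ x)) ⊗ u 1 ⊗ ((const 1ℤ ⊕ ⊝ (q ^ 4 ⊗ x)) ⊗ u 4))))
      ≈⟨ solve 7 (λ s a b c d q x → s :^ 2 :* ((a :* d) :* ((con 1ℤ :+ :- (q :^ 2 :* x)) :* b :* ((con 1ℤ :+ :- (q :^ 3 :* x)) :* c)) :+ :- ((b :* c) :* ((con 1ℤ :+ :- (q :^ 1 :* x)) :* a :* ((con 1ℤ :+ :- (q :^ 4 :* x)) :* d))))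
           := ((con 1ℤ :+ :- q :^ 1) :* s) :^ 2 :* ((q :^ 1 :* x) :* (con 1ℤ :+ q) :* ((a :* d) :* (b :* c)))) ≈-refl g₁ (u 1) (u 2) (u 3) (u 4) q x ⟩
    (1-q^ 1 ⊗ g₁) ^ 2 ⊗ ((q ^ 1 ⊗ x) ⊗ (const 1ℤ ⊕ q) ⊗ (g k ⊗ h k)) ≈⟨ ⊗-cong (^-congˡ 2 (geom-inverse 0)) (⊗-cong (⊗-cong (≈-sym (^-homo-* q 1 (5 ℕ.* k))) ≈-refl) ≈-refl) ⟩
    const 1ℤ ^ 2 ⊗ (q ^ (1 ℕ.+ 5 ℕ.* k) ⊗ (const 1ℤ ⊕ q) ⊗ (g k ⊗ h k)) ≈⟨ solve 1 (λ y → con 1ℤ :^ 2 :* y := y) ≈-refl _ ⟩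
    q ^ (1 ℕ.+ 5 ℕ.* k) ⊗ (const 1ℤ ⊕ q) ⊗ (g k ⊗ h k) ∎
  where
  open ≈-Reasoning
  open Solver
  x : PS
  x = q ^ (5 ℕ.* k)
  u : ℕ → PS
  u c = geom (c ℕ.+ 5 ℕ.* k)
  inv : ∀ c → (const 1ℤ ⊕ ⊝ (q ^ suc c ⊗ x)) ⊗ u (suc c) ≈ const 1ℤ
  inv c = ≈-trans (⊗-cong (⊕-cong ≈-refl (⊝-cong (≈-sym (^-homo-* q (suc c) (5 ℕ.* k))))) ≈-refl) (geom-inverse (c ℕ.+ 5 ℕ.* k))

-- Telescoping with p x - p′ y = (p - p′) x + p′ (x - y); by `g-h` the factor 1/(1 - q)² makes the
-- last difference nonnegative.
NonNeg-prod-diff : ∀ N → NonNeg (g₁ ^ 2 ⊗ (prod (λ k → g (suc k)) N ⊕ ⊝ prod (λ k → h (suc k)) N))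
NonNeg-prod-diff zero = NonNeg-≈ (solve 1 (λ s → con 0ℤ := s :^ 2 :* (con 1ℤ :+ :- con 1ℤ)) ≈-refl g₁) (NonNeg-const 0)
  where
  open Solver
NonNeg-prod-diff (suc N) = NonNeg-≈ (≈-sym step) (NonNeg-⊕ (NonNeg-⊗ (NonNeg-prod-diff N) (NonNeg-g (suc N)))
    (NonNeg-⊗ (NonNeg-prod (λ k → NonNeg-h (suc k)) N) (NonNeg-⊗ (NonNeg-⊗ (NonNeg-q^ (1 ℕ.+ 5 ℕ.* suc N)) (NonNeg-⊕ (NonNeg-const 1) NonNeg-q)) (NonNeg-⊗ (NonNeg-g (suc N)) (NonNeg-h (suc N))))))
  where
  open Solver
  PG = prod (λ k → g (suc k)) N
  PH = prod (λ k → h (suc k)) N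
  step : g₁ ^ 2 ⊗ (PG ⊗ g (suc N) ⊕ ⊝ (PH ⊗ h (suc N))) ≈ g₁ ^ 2 ⊗ (PG ⊕ ⊝ PH) ⊗ g (suc N) ⊕ PH ⊗ (q ^ (1 ℕ.+ 5 ℕ.* suc N) ⊗ (const 1ℤ ⊕ q) ⊗ (g (suc N) ⊗ h (suc N)))
  step = ≈-trans (solve 5 (λ s p p′ x y → s :^ 2 :* (p :* x :+ :- (p′ :* y)) := s :^ 2 :* (p :+ :- p′) :* x :+ p′ :* (s :^ 2 :* (x :+ :- y))) ≈-refl g₁ PG PH (g (suc N)) (h (suc N)))
    (⊕-cong ≈-refl (⊗-cong ≈-refl (g-h (suc N))))

NonNeg-Ĝ-Ĥ : NonNeg (g₁ ^ 2 ⊗ (Ĝ ⊕ ⊝ Ĥ))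
NonNeg-Ĝ-Ĥ n = subst (0ℤ ≤_) (sym (at< approx n ℕ.≤-refl)) (NonNeg-prod-diff (suc n) n)
  where
  approx : g₁ ^ 2 ⊗ (Ĝ ⊕ ⊝ Ĥ) ≈[ suc n ] g₁ ^ 2 ⊗ (prod (λ k → g (suc k)) (suc n) ⊕ ⊝ prod (λ k → h (suc k)) (suc n))
  approx = ⊗-cong[] ≈[]-refl (⊕-cong[] (lim≈[]prod (Tame-suc Tame-g) (suc n)) (⊝-cong[] (lim≈[]prod (Tame-suc Tame-h) (suc n))))

E₀ : PS
E₀ = g 0 ^ 5 ⊕ const -[1+ 2 ] ⊗ q ⊗ h 0 ^ 5

-- Over the common denominator (1 - q³)⁵(1 - q⁴)⁵ the numerator is (1 + q + q²)⁵ - 3q(1 + q²)⁵,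
-- whose only negative terms are -10q⁹ and -3q¹¹. They are hidden in (10q⁶ + 3q⁸)(1 - q³), and one
-- factor 1/(1 - q³) cancels the 1 - q³.
NonNeg-E₀ : NonNeg E₀
NonNeg-E₀ = NonNeg-≈ (≈-sym eq) (NonNeg-⊗ (NonNeg-⊗ (NonNeg-^ 4 (NonNeg-geom 3)) (NonNeg-^ 5 (NonNeg-geom 4)))
    (NonNeg-⊕ (NonNeg-⊗ nn-s (NonNeg-geom 3)) nn-t))
  where
  open ≈-Reasoning
  open Solver
  u₁ = geom 1
  u₂ = geom 2
  u₃ = geom 3
  u₄ = geom 4
  s t : PS
  s = const 1ℤ ⊕ const (+ 2) ⊗ q ^ 1 ⊕ const (+ 15) ⊗ q ^ 2 ⊕ const (+ 15) ⊗ q ^ 3 ⊕ const (+ 45) ⊗ q ^ 4 ⊕ const (+ 21) ⊗ q ^ 5 ⊕ const (+ 35) ⊗ q ^ 6 ⊕ const (+ 12) ⊗ q ^ 8 ⊕ const 1ℤ ⊗ q ^ 10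
  t = const (+ 10) ⊗ q ^ 6 ⊕ const (+ 3) ⊗ q ^ 8
  nn : ∀ c e → NonNeg (const (+ c) ⊗ q ^ e)
  nn c e = NonNeg-⊗ (NonNeg-const c) (NonNeg-q^ e)
  nn-s : NonNeg s
  nn-s = NonNeg-⊕ (NonNeg-⊕ (NonNeg-⊕ (NonNeg-⊕ (NonNeg-⊕ (NonNeg-⊕ (NonNeg-⊕ (NonNeg-⊕ (NonNeg-const 1) (nn 2 1)) (nn 15 2)) (nn 15 3)) (nn 45 4)) (nn 21 5)) (nn 35 6)) (nn 12 8)) (nn 1 10)
  nn-t : NonNeg t
  nn-t = NonNeg-⊕ (nn 10 6) (nn 3 8)
  u₁≈ : u₁ ≈ (const 1ℤ ⊕ q ⊕ q ^ 2) ⊗ u₃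
  u₁≈ = begin
    u₁ ≈⟨ ⊗-identityʳ _ ⟨
    u₁ ⊗ const 1ℤ ≈⟨ ⊗-cong ≈-refl (geom-inverse 2) ⟨
    u₁ ⊗ (1-q^ 3 ⊗ u₃) ≈⟨ solve 3 (λ u q w → u :* ((con 1ℤ :+ :- q :^ 3) :* w) := ((con 1ℤ :+ :- q :^ 1) :* u) :* ((con 1ℤ :+ q :+ q :^ 2) :* w)) ≈-refl u₁ q u₃ ⟩
    (1-q^ 1 ⊗ u₁) ⊗ ((const 1ℤ ⊕ q ⊕ q ^ 2) ⊗ u₃) ≈⟨ ≈-trans (⊗-cong (geom-inverse 0) ≈-refl) (⊗-identityˡ _) ⟩
    (const 1ℤ ⊕ q ⊕ q ^ 2) ⊗ u₃ ∎
  u₂≈ : u₂ ≈ (const 1ℤ ⊕ q ^ 2) ⊗ u₄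
  u₂≈ = begin
    u₂ ≈⟨ ⊗-identityʳ _ ⟨
    u₂ ⊗ const 1ℤ ≈⟨ ⊗-cong ≈-refl (geom-inverse 3) ⟨
    u₂ ⊗ (1-q^ 4 ⊗ u₄) ≈⟨ solve 3 (λ u q w → u :* ((con 1ℤ :+ :- q :^ 4) :* w) := ((con 1ℤ :+ :- q :^ 2) :* u) :* ((con 1ℤ :+ q :^ 2) :* w)) ≈-refl u₂ q u₄ ⟩
    (1-q^ 2 ⊗ u₂) ⊗ ((const 1ℤ ⊕ q ^ 2) ⊗ u₄) ≈⟨ ≈-trans (⊗-cong (geom-inverse 1) ≈-refl) (⊗-identityˡ _) ⟩
    (const 1ℤ ⊕ q ^ 2) ⊗ u₄ ∎
  polynomial : (const 1ℤ ⊕ q ⊕ q ^ 2) ^ 5 ⊕ const -[1+ 2 ] ⊗ q ⊗ (const 1ℤ ⊕ q ^ 2) ^ 5 ≈ s ⊕ t ⊗ 1-q^ 3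
  polynomial = solve 1 (λ q → (con 1ℤ :+ q :+ q :^ 2) :^ 5 :+ con -[1+ 2 ] :* q :* (con 1ℤ :+ q :^ 2) :^ 5
    := (con 1ℤ :+ con (+ 2) :* q :^ 1 :+ con (+ 15) :* q :^ 2 :+ con (+ 15) :* q :^ 3 :+ con (+ 45) :* q :^ 4 :+ con (+ 21) :* q :^ 5 :+ con (+ 35) :* q :^ 6 :+ con (+ 12) :* q :^ 8 :+ con 1ℤ :* q :^ 10)
       :+ (con (+ 10) :* q :^ 6 :+ con (+ 3) :* q :^ 8) :* (con 1ℤ :+ :- q :^ 3)) ≈-refl q
  eq : E₀ ≈ u₃ ^ 4 ⊗ u₄ ^ 5 ⊗ (s ⊗ u₃ ⊕ t)
  eq = begin
    (u₁ ⊗ u₄) ^ 5 ⊕ const -[1+ 2 ] ⊗ q ⊗ (u₂ ⊗ u₃) ^ 5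
      ≈⟨ ⊕-cong (^-congˡ 5 (⊗-cong u₁≈ ≈-refl)) (⊗-cong ≈-refl (^-congˡ 5 (⊗-cong u₂≈ ≈-refl))) ⟩
    (α ⊗ u₃ ⊗ u₄) ^ 5 ⊕ const -[1+ 2 ] ⊗ q ⊗ (β ⊗ u₄ ⊗ u₃) ^ 5
      ≈⟨ solve 5 (λ α β c d q → (α :* c :* d) :^ 5 :+ con -[1+ 2 ] :* q :* (β :* d :* c) :^ 5 := c :^ 5 :* d :^ 5 :* (α :^ 5 :+ con -[1+ 2 ] :* q :* β :^ 5)) ≈-refl α β u₃ u₄ q ⟩
    u₃ ^ 5 ⊗ u₄ ^ 5 ⊗ (α ^ 5 ⊕ const -[1+ 2 ] ⊗ q ⊗ β ^ 5) ≈⟨ ⊗-cong ≈-refl polynomial ⟩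
    u₃ ^ 5 ⊗ u₄ ^ 5 ⊗ (s ⊕ t ⊗ 1-q^ 3) ≈⟨ solve 5 (λ c d s t p → c :^ 5 :* d :^ 5 :* (s :+ t :* p) := c :^ 4 :* d :^ 5 :* (s :* c :+ t :* (p :* c))) ≈-refl u₃ u₄ s t (1-q^ 3) ⟩
    u₃ ^ 4 ⊗ u₄ ^ 5 ⊗ (s ⊗ u₃ ⊕ t ⊗ (1-q^ 3 ⊗ u₃)) ≈⟨ ⊗-cong ≈-refl (⊕-cong ≈-refl (≈-trans (⊗-cong ≈-refl (geom-inverse 2)) (⊗-identityʳ t))) ⟩
    u₃ ^ 4 ⊗ u₄ ^ 5 ⊗ (s ⊗ u₃ ⊕ t) ∎
    where
    α = const 1ℤ ⊕ q ⊕ q ^ 2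
    β = const 1ℤ ⊕ q ^ 2

E : PS
E = G ^ 5 ⊕ const -[1+ 2 ] ⊗ q ⊗ H ^ 5

NonNeg-Ĝ : NonNeg Ĝ
NonNeg-Ĝ = NonNeg-lim (λ k → NonNeg-g (suc k))

NonNeg-Ĥ : NonNeg Ĥ
NonNeg-Ĥ = NonNeg-lim (λ k → NonNeg-h (suc k))

-- With g₀ = `g 0`, adding and subtracting g₀⁵Ĥ⁵ splits E into g₀⁵(Ĝ⁵ - Ĥ⁵) and `E₀` Ĥ⁵; the first
-- part contains the factor Ĝ - Ĥ.
NonNeg-g₁²E : NonNeg (g₁ ^ 2 ⊗ E)
NonNeg-g₁²E = NonNeg-≈ (≈-sym split) (NonNeg-⊕
    (NonNeg-⊗ (NonNeg-⊗ (NonNeg-^ 5 (NonNeg-g 0)) NonNeg-Ĝ-Ĥ)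
      (NonNeg-⊕ (NonNeg-⊕ (NonNeg-⊕ (NonNeg-⊕ (NonNeg-^ 4 NonNeg-Ĝ) (NonNeg-⊗ (NonNeg-^ 3 NonNeg-Ĝ) NonNeg-Ĥ)) (NonNeg-⊗ (NonNeg-^ 2 NonNeg-Ĝ) (NonNeg-^ 2 NonNeg-Ĥ))) (NonNeg-⊗ NonNeg-Ĝ (NonNeg-^ 3 NonNeg-Ĥ))) (NonNeg-^ 4 NonNeg-Ĥ)))
    (NonNeg-⊗ (NonNeg-⊗ (NonNeg-^ 2 (NonNeg-geom 1)) NonNeg-E₀) (NonNeg-^ 5 NonNeg-Ĥ)))
  where
  open Solver
  split : g₁ ^ 2 ⊗ E ≈ g 0 ^ 5 ⊗ (g₁ ^ 2 ⊗ (Ĝ ⊕ ⊝ Ĥ)) ⊗ (Ĝ ^ 4 ⊕ Ĝ ^ 3 ⊗ Ĥ ⊕ Ĝ ^ 2 ⊗ Ĥ ^ 2 ⊕ Ĝ ⊗ Ĥ ^ 3 ⊕ Ĥ ^ 4) ⊕ g₁ ^ 2 ⊗ E₀ ⊗ Ĥ ^ 5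
  split = ≈-trans (⊗-cong ≈-refl (⊕-cong (^-congˡ 5 G≈) (⊗-cong ≈-refl (^-congˡ 5 H≈))))
    (solve 6 (λ s g h x y q → s :^ 2 :* ((g :* x) :^ 5 :+ con -[1+ 2 ] :* q :* (h :* y) :^ 5)
      := g :^ 5 :* (s :^ 2 :* (x :+ :- y)) :* (x :^ 4 :+ x :^ 3 :* y :+ x :^ 2 :* y :^ 2 :+ x :* y :^ 3 :+ y :^ 4) :+ s :^ 2 :* (g :^ 5 :+ con -[1+ 2 ] :* q :* h :^ 5) :* y :^ 5)
      ≈-refl g₁ (g 0) (h 0) Ĝ Ĥ q)

-- G without its factor 1/(1 - q), which is set aside for `partial-sums-pos` and for `NonNeg-g₁²E`.
G° : PS
G° = geom 4 ⊗ Ĝ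

G≈g₁G° : G ≈ g₁ ⊗ G°
G≈g₁G° = ≈-trans G≈ (⊗-assoc (geom 1) (geom 4) Ĝ)

NonNeg-G° : NonNeg G°
NonNeg-G° = NonNeg-⊗ (NonNeg-geom 4) NonNeg-Ĝ

NonNeg-G : NonNeg G
NonNeg-G = NonNeg-≈ (≈-sym G≈g₁G°) (NonNeg-⊗ (NonNeg-geom 1) NonNeg-G°)

NonNeg-H : NonNeg H
NonNeg-H = NonNeg-≈ (≈-sym H≈) (NonNeg-⊗ (NonNeg-h 0) NonNeg-Ĥ)

G-head : G 0 ≡ 1ℤ
G-head = ⊗-head1 (Π⁻¹-head 0 4) (Π⁻¹-head 3 4)

G°-head : G° 0 ≡ 1ℤ
G°-head = ⊗-head1 {geom 4} {Ĝ} refl (lim-head (Tame-suc Tame-g))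

E-head : E 0 ≡ 1ℤ
E-head = trans (⊕-at _ _ 0) (cong₂ _+_ (^-head1 5 G-head) (trans (at (⊗-assoc _ _ _) 0) (trans (scale-at -[1+ 2 ] _ 0) (cong (-[1+ 2 ] *_) (q⊗-zero (H ^ 5))))))

pos-G⊗ : ∀ {f} → NonNeg f → f 0 ≡ 1ℤ → ∀ n → 0ℤ < (G ⊗ f) n
pos-G⊗ {f} p f0 n = subst (0ℤ <_) (sym (at (≈-trans (⊗-cong G≈g₁G° ≈-refl) (⊗-assoc g₁ G° f)) n))
  (partial-sums-pos (NonNeg-⊗ NonNeg-G° p) (⊗-head1 G°-head f0) n)

NonNeg-G²E : NonNeg (G ^ 2 ⊗ E)
NonNeg-G²E = NonNeg-≈ (≈-sym (≈-trans (⊗-cong (^-congˡ 2 G≈g₁G°) ≈-refl)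
    (solve 3 (λ s x e → (s :* x) :^ 2 :* e := x :^ 2 :* (s :^ 2 :* e)) ≈-refl g₁ G° E))) (NonNeg-⊗ (NonNeg-^ 2 NonNeg-G°) NonNeg-g₁²E)
  where
  open Solver

-- The components of D modulo 5

GH : ℕ → ℕ → PS
GH i j = G ^ i ⊗ H ^ j

cancel-units : ∀ i j f → (b ⊗ H) ^ i ⊗ ((a ⊗ G) ^ j ⊗ f) ≈ f
cancel-units i j f = ≈-trans (⊗-cong (1^ i bH≈1) (⊗-cong (1^ j aG≈1) ≈-refl)) (≈-trans (⊗-identityˡ _) (⊗-identityˡ f))
  where
  1^ : ∀ n {x} → x ≈ const 1ℤ → x ^ n ≈ const 1ℤ
  1^ zero e = ≈-refl
  1^ (suc n) e = ≈-trans (⊗-cong e (1^ n e)) (⊗-identityˡ _)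

-- Writing 1 - 36ρ - ρ² as (1 - 11ρ - ρ²) - 25ρ, the first summand is inverse to `K` by `quintic′`,
-- and the powers of r cancel in `K` ρ.
part₀ : part γ K 0 ≈ const 1ℤ ⊕ const -[1+ 24 ] ⊗ (q ⊗ GH 6 6)
part₀ = begin
    K ⊗ (const 1ℤ ⊕ const -[1+ 35 ] ⊗ ρ ⊕ const -1ℤ ⊗ ρ ^ 2)
      ≈⟨ solve 5 (λ s g h q r → let k = s :^ 5 :* g :^ 6 :* h :^ 6 ; ρ = q :* r :^ 5 in k :* (con 1ℤ :+ con -[1+ 35 ] :* ρ :+ con -1ℤ :* ρ :^ 2)
           := k :* (con 1ℤ :+ con -[1+ 10 ] :* ρ :+ con -1ℤ :* ρ :^ 2) :+ con -[1+ 24 ] :* ((r :* s) :^ 5 :* (q :* (g :^ 6 :* h :^ 6)))) ≈-refl r⁻¹ G H q r ⟩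
    K ⊗ 1-11ρ-ρ² ⊕ const -[1+ 24 ] ⊗ ((r ⊗ r⁻¹) ^ 5 ⊗ (q ⊗ GH 6 6))
      ≈⟨ ⊕-cong quintic′ (⊗-cong ≈-refl (≈-trans (⊗-cong (^-congˡ 5 r⊗r⁻¹≈1) ≈-refl) (solve 1 (λ x → con 1ℤ :^ 5 :* x := x) ≈-refl (q ⊗ GH 6 6)))) ⟩
    const 1ℤ ⊕ const -[1+ 24 ] ⊗ (q ⊗ GH 6 6) ∎
  where
  open ≈-Reasoning
  open Solver

-- The coefficients 10, -30 here and 5, -15 in class 3 have the same ratio -3, which is why one
-- series `E` serves both. A single G stands apart for `pos-G⊗`.
part₂ : part γ K 2 ≈ const (+ 10) ⊗ (G ⊗ (G ^ 2 ⊗ E ⊗ GH 1 3))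
part₂ = begin
    K ⊗ r ^ 2 ⊗ (const (+ 10) ⊕ const -[1+ 29 ] ⊗ ρ)
      ≈⟨ solve 5 (λ a b g h q → (b :* g) :^ 5 :* g :^ 6 :* h :^ 6 :* (a :* h) :^ 2 :* (con (+ 10) :+ con -[1+ 29 ] :* (q :* (a :* h) :^ 5))
           := con (+ 10) :* ((b :* h) :^ 5 :* ((a :* g) :^ 2 :* (g :^ 9 :* h :^ 3))) :+ con -[1+ 29 ] :* (q :* ((b :* h) :^ 5 :* ((a :* g) :^ 7 :* (g :^ 4 :* h :^ 8))))) ≈-refl a b G H q ⟩
    const (+ 10) ⊗ ((b ⊗ H) ^ 5 ⊗ ((a ⊗ G) ^ 2 ⊗ GH 9 3)) ⊕ const -[1+ 29 ] ⊗ (q ⊗ ((b ⊗ H) ^ 5 ⊗ ((a ⊗ G) ^ 7 ⊗ GH 4 8)))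
      ≈⟨ ⊕-cong (⊗-cong ≈-refl (cancel-units 5 2 _)) (⊗-cong ≈-refl (⊗-cong ≈-refl (cancel-units 5 7 _))) ⟩
    const (+ 10) ⊗ GH 9 3 ⊕ const -[1+ 29 ] ⊗ (q ⊗ GH 4 8)
      ≈⟨ solve 3 (λ g h q → con (+ 10) :* (g :^ 9 :* h :^ 3) :+ con -[1+ 29 ] :* (q :* (g :^ 4 :* h :^ 8))
           := con (+ 10) :* (g :* (g :^ 2 :* (g :^ 5 :+ con -[1+ 2 ] :* q :* h :^ 5) :* (g :^ 1 :* h :^ 3)))) ≈-refl G H q ⟩
    const (+ 10) ⊗ (G ⊗ (G ^ 2 ⊗ E ⊗ GH 1 3)) ∎
  where
  open ≈-Reasoning
  open Solver

part₃ : part γ K 3 ≈ const (+ 5) ⊗ (G ⊗ (G ^ 2 ⊗ E ⊗ GH 0 4))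
part₃ = begin
    K ⊗ r ^ 3 ⊗ (const (+ 5) ⊕ const -[1+ 14 ] ⊗ ρ)
      ≈⟨ solve 5 (λ a b g h q → (b :* g) :^ 5 :* g :^ 6 :* h :^ 6 :* (a :* h) :^ 3 :* (con (+ 5) :+ con -[1+ 14 ] :* (q :* (a :* h) :^ 5))
           := con (+ 5) :* ((b :* h) :^ 5 :* ((a :* g) :^ 3 :* (g :^ 8 :* h :^ 4))) :+ con -[1+ 14 ] :* (q :* ((b :* h) :^ 5 :* ((a :* g) :^ 8 :* (g :^ 3 :* h :^ 9))))) ≈-refl a b G H q ⟩
    const (+ 5) ⊗ ((b ⊗ H) ^ 5 ⊗ ((a ⊗ G) ^ 3 ⊗ GH 8 4)) ⊕ const -[1+ 14 ] ⊗ (q ⊗ ((b ⊗ H) ^ 5 ⊗ ((a ⊗ G) ^ 8 ⊗ GH 3 9)))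
      ≈⟨ ⊕-cong (⊗-cong ≈-refl (cancel-units 5 3 _)) (⊗-cong ≈-refl (⊗-cong ≈-refl (cancel-units 5 8 _))) ⟩
    const (+ 5) ⊗ GH 8 4 ⊕ const -[1+ 14 ] ⊗ (q ⊗ GH 3 9)
      ≈⟨ solve 3 (λ g h q → con (+ 5) :* (g :^ 8 :* h :^ 4) :+ con -[1+ 14 ] :* (q :* (g :^ 3 :* h :^ 9))
           := con (+ 5) :* (g :* (g :^ 2 :* (g :^ 5 :+ con -[1+ 2 ] :* q :* h :^ 5) :* (g :^ 0 :* h :^ 4)))) ≈-refl G H q ⟩
    const (+ 5) ⊗ (G ⊗ (G ^ 2 ⊗ E ⊗ GH 0 4)) ∎
  where
  open ≈-Reasoning
  open Solver

-- Both coefficients -15 and -5 are negative, so no cancellation has to be controlled in this class.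
part₄ : part γ K 4 ≈ const -[1+ 4 ] ⊗ (const (+ 3) ⊗ (G ⊗ GH 6 5) ⊕ q ⊗ GH 2 10)
part₄ = begin
    K ⊗ r ^ 4 ⊗ (const -[1+ 14 ] ⊕ const -[1+ 4 ] ⊗ ρ)
      ≈⟨ solve 5 (λ a b g h q → (b :* g) :^ 5 :* g :^ 6 :* h :^ 6 :* (a :* h) :^ 4 :* (con -[1+ 14 ] :+ con -[1+ 4 ] :* (q :* (a :* h) :^ 5))
           := con -[1+ 14 ] :* ((b :* h) :^ 5 :* ((a :* g) :^ 4 :* (g :^ 7 :* h :^ 5))) :+ con -[1+ 4 ] :* (q :* ((b :* h) :^ 5 :* ((a :* g) :^ 9 :* (g :^ 2 :* h :^ 10))))) ≈-refl a b G H q ⟩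
    const -[1+ 14 ] ⊗ ((b ⊗ H) ^ 5 ⊗ ((a ⊗ G) ^ 4 ⊗ GH 7 5)) ⊕ const -[1+ 4 ] ⊗ (q ⊗ ((b ⊗ H) ^ 5 ⊗ ((a ⊗ G) ^ 9 ⊗ GH 2 10)))
      ≈⟨ ⊕-cong (⊗-cong ≈-refl (cancel-units 5 4 _)) (⊗-cong ≈-refl (⊗-cong ≈-refl (cancel-units 5 9 _))) ⟩
    const -[1+ 14 ] ⊗ GH 7 5 ⊕ const -[1+ 4 ] ⊗ (q ⊗ GH 2 10)
      ≈⟨ solve 3 (λ g h q → con -[1+ 14 ] :* (g :^ 7 :* h :^ 5) :+ con -[1+ 4 ] :* (q :* (g :^ 2 :* h :^ 10))
           := con -[1+ 4 ] :* (con (+ 3) :* (g :* (g :^ 6 :* h :^ 5)) :+ q :* (g :^ 2 :* h :^ 10))) ≈-refl G H q ⟩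
    const -[1+ 4 ] ⊗ (const (+ 3) ⊗ (G ⊗ GH 6 5) ⊕ q ⊗ GH 2 10) ∎
  where
  open ≈-Reasoning
  open Solver

-- Signs of the coefficients of D

NonNeg-GH : ∀ i j → NonNeg (GH i j)
NonNeg-GH i j = NonNeg-⊗ (NonNeg-^ i NonNeg-G) (NonNeg-^ j NonNeg-H)

GH-head : ∀ i j → GH i j 0 ≡ 1ℤ
GH-head i j = ⊗-head1 (^-head1 i G-head) (^-head1 j H-head)

D-part : ∀ {k} → k ℕ.< 5 → ∀ n → D (k ℕ.+ n ℕ.* 5) ≡ part γ K k n
D-part {k} l n = trans (at D-dissection (k ℕ.+ n ℕ.* 5)) (trans (sym (comp-at k _ n)) (at (comp-dissection l (part γ K)) n))

scale-pos : ∀ c {i} → 0ℤ < i → 0ℤ < + suc c * i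
scale-pos c {i} p = subst (_< + suc c * i) (ℤ.*-zeroʳ (+ suc c)) (ℤ.*-monoˡ-<-pos (+ suc c) p)

scale-neg : ∀ c {i} → 0ℤ < i → -[1+ c ] * i < 0ℤ
scale-neg c {i} p = subst (-[1+ c ] * i <_) (ℤ.*-zeroʳ -[1+ c ]) (ℤ.*-monoˡ-<-neg -[1+ c ] p)

D-0 : D 0 ≡ 1ℤ
D-0 = trans (D-part {0} (s≤s z≤n) 0) (trans (at part₀ 0) (trans (⊕-at _ _ 0) (cong₂ _+_ (const-zero 1ℤ)
  (trans (scale-at -[1+ 24 ] _ 0) (cong (-[1+ 24 ] *_) (q⊗-zero (GH 6 6)))))))

-- The constant 1 in `part₀` reaches only D(0); above it the factor q shifts the positive
-- coefficients of G⁶H⁶ by one.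
D-5n : ∀ n → D (suc n ℕ.* 5) < 0ℤ
D-5n n = subst (_< 0ℤ) (sym eq) (scale-neg 24 (subst (0ℤ <_) (at G⊗GH n) (pos-G⊗ (NonNeg-GH 5 6) (GH-head 5 6) n)))
  where
  G⊗GH : G ⊗ GH 5 6 ≈ GH 6 6
  G⊗GH = ≈-sym (⊗-assoc G (G ^ 5) (H ^ 6))
  eq : D (suc n ℕ.* 5) ≡ -[1+ 24 ] * GH 6 6 n
  eq = trans (D-part {0} (s≤s z≤n) (suc n)) (trans (at part₀ (suc n)) (trans (⊕-at _ _ (suc n)) (trans (cong₂ _+_ (const-suc 1ℤ n)
    (trans (scale-at -[1+ 24 ] _ (suc n)) (cong (-[1+ 24 ] *_) (q⊗-suc (GH 6 6) n)))) (ℤ.+-identityˡ _))))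

NonNeg-G²E⊗GH : ∀ i j → NonNeg (G ^ 2 ⊗ E ⊗ GH i j)
NonNeg-G²E⊗GH i j = NonNeg-⊗ NonNeg-G²E (NonNeg-GH i j)

G²E⊗GH-head : ∀ i j → (G ^ 2 ⊗ E ⊗ GH i j) 0 ≡ 1ℤ
G²E⊗GH-head i j = ⊗-head1 (⊗-head1 (^-head1 2 G-head) E-head) (GH-head i j)

D-5n+2 : ∀ n → 0ℤ < D (2 ℕ.+ n ℕ.* 5)
D-5n+2 n = subst (0ℤ <_) (sym (trans (D-part {2} (s≤s (s≤s (s≤s z≤n))) n) (trans (at part₂ n) (scale-at (+ 10) _ n))))
  (scale-pos 9 (pos-G⊗ (NonNeg-G²E⊗GH 1 3) (G²E⊗GH-head 1 3) n))

D-5n+3 : ∀ n → 0ℤ < D (3 ℕ.+ n ℕ.* 5)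
D-5n+3 n = subst (0ℤ <_) (sym (trans (D-part {3} (s≤s (s≤s (s≤s (s≤s z≤n)))) n) (trans (at part₃ n) (scale-at (+ 5) _ n))))
  (scale-pos 4 (pos-G⊗ (NonNeg-G²E⊗GH 0 4) (G²E⊗GH-head 0 4) n))

D-5n+4 : ∀ n → D (4 ℕ.+ n ℕ.* 5) < 0ℤ
D-5n+4 n = subst (_< 0ℤ) (sym (trans (D-part {4} (s≤s (s≤s (s≤s (s≤s (s≤s z≤n))))) n) (trans (at part₄ n) (scale-at -[1+ 4 ] _ n))))
  (scale-neg 4 (subst (0ℤ <_) (sym (trans (⊕-at _ _ n) (cong (_+ (q ⊗ GH 2 10) n) (scale-at (+ 3) _ n))))
    (ℤ.+-mono-<-≤ (scale-pos 2 (pos-G⊗ (NonNeg-GH 6 5) (GH-head 6 5) n)) (NonNeg-⊗ NonNeg-q (NonNeg-GH 2 10) n))))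

theorem1p5 : (D 0 ≡ 1ℤ)
    × (∀ (n : ℕ) → D (5 Data.Nat.* suc n) < 0ℤ)
    × (∀ (n : ℕ) → D (5 Data.Nat.* n Data.Nat.+ 2) > 0ℤ)
    × (∀ (n : ℕ) → D (5 Data.Nat.* n Data.Nat.+ 3) > 0ℤ)
    × (∀ (n : ℕ) → D (5 Data.Nat.* n Data.Nat.+ 4) < 0ℤ)
theorem1p5 = D-0
  , (λ n → subst (λ m → D m < 0ℤ) (ℕ.*-comm (suc n) 5) (D-5n n))
  , (λ n → subst (λ m → D m > 0ℤ) (index 2 n) (D-5n+2 n))
  , (λ n → subst (λ m → D m > 0ℤ) (index 3 n) (D-5n+3 n))
  , (λ n → subst (λ m → D m < 0ℤ) (index 4 n) (D-5n+4 n))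
  where
  index : ∀ k n → k ℕ.+ n ℕ.* 5 ≡ 5 ℕ.* n ℕ.+ k
  index k n = trans (ℕ.+-comm k (n ℕ.* 5)) (cong (ℕ._+ k) (ℕ.*-comm n 5))
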